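{- Let $\widetilde{G}$ be a mixed graph with underlying graph $G$. Then $rk(\widetilde{G})-r(G)=2d(G)$ if and only if all of the following hold: (i) the mixed cycles (if any) of $\widetilde{G}$ are pairwise vertex-disjoint; (ii) for each mixed cycle $\widetilde{C}_l$ of $\widetilde{G}$ (of length $l$), $l\equiv 0\pmod 4$ and either $\eta(\widetilde{C}_l)$ is odd or $\eta(\widetilde{C}_l)\equiv 2\pmod 4$; (iii) a series of $\delta$-transformations can switch $G$ to a crucial subgraph which is the disjoint union of $d(G)$ cycles together with some isolated vertices.
   Context: All graphs are finite and simple. A mixed graph $\widetilde{G}$ is obtained from a simple graph $G$ (its underlying graph) by orienting some of its edges. The Hermitian adjacency matrix $H(\widetilde{G})=(h_{uv})$ has $h_{uv}=1$ for an undirected edge $\{u,v\}$, $h_{uv}=i$ for an arc $(u,v)$, $h_{uv}=-i$ for an arc $(v,u)$, $0$ otherwise; $rk(\widetilde{G})$ is its rank and $r(G)$ is the rank of the adjacency matrix of $G$. $d(G)=|E_G|-|V_G|+\omega(G)$ with $\omega(G)$ the number of components. A mixed cycle of $\widetilde{G}$ is a cycle of $G$ with the orientations/non-orientations its edges have in $\widetilde{G}$. The signature $\eta(\widetilde{C})$ of a mixed cycle is $|f-b|$, where, traversing the cycle in one direction, $f$ is the number of arcs oriented forward and $b$ the number oriented backward (undirected edges are not counted). A pendant vertex is a vertex of degree one. A $\delta$-transformation on a graph with a pendant vertex deletes a pendant vertex together with its neighbour. For a graph whose cycles are pairwise vertex-disjoint, one repeatedly applies $\delta$-transformations until an induced subgraph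 without pendant vertices is obtained; this resulting induced subgraph is called a crucial subgraph. -}

module Defs where

open import Data.Bool using (Bool; true; false; not; _∧_; _∨_; if_then_else_)
open import Data.Nat using (ℕ; zero; suc; _≤_; _⊔_; _%_; _<ᵇ_) renaming (_+_ to _+ℕ_)
open import Data.Integer as ℤ using (ℤ; +_; -[1+_]; ∣_∣)
open import Data.Fin using (Fin; toℕ)
open import Data.Fin.Properties using () renaming (_≟_ to _≟F_)
open import Data.List using (List; []; _∷_; _++_; [_]; map; foldr; length; allFin; zip; concatMap)
open import Data.Bool.ListAction using (any)
open import Data.List.Membership.Propositional using (_∈_)
open import Data.List.Relation.Unary.All using (All)
open import Data.List.Relation.Unary.Any using (Any)
open import Data.List.Relation.Unary.Unique.Propositional using (Unique)
open import Data.List.Relation.Unary.AllPairs using (AllPairs)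
open import Data.Product using (Σ; ∃; ∃-syntax; _×_; _,_)
open import Data.Sum using (_⊎_)
open import Data.Empty using (⊥)
open import Function.Bundles using (_⇔_)
open import Relation.Nullary using (¬_; does)
open import Relation.Binary.PropositionalEquality using (_≡_)
open import Relation.Binary.Construct.Closure.ReflexiveTransitive using (Star)

-- Mixed graphs on vertex set Fin n
-- The label h u v is the (u,v)-entry of the Hermitian adjacency matrix:
--   o = 0 (non-adjacent), e = 1 (undirected edge),
--   ar = i (arc (u,v)), ra = -i (arc (v,u)).

data Lab : Set where
  o e ar ra : Lab

conjLab : Lab → Lab
conjLab o  = o
conjLab e  = e
conjLab ar = ra
conjLab ra = ar

record MixedGraph (n : ℕ) : Set where
  field
    h        : Fin n → Fin n → Lab
    loopless : ∀ v → h v v ≡ o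
    herm     : ∀ u v → h v u ≡ conjLab (h u v)
open MixedGraph public

isO : Lab → Bool
isO o = true
isO _ = false

adjB : ∀ {n} → MixedGraph n → Fin n → Fin n → Bool
adjB G u v = not (isO (h G u v))

Adj : ∀ {n} → MixedGraph n → Fin n → Fin n → Set
Adj G u v = adjB G u v ≡ true

record ℤi : Set where
  constructor gi
  field re im : ℤ

0i 1i : ℤi
0i = gi (+ 0) (+ 0)
1i = gi (+ 1) (+ 0)

_+ᵢ_ : ℤi → ℤi → ℤi
gi a b +ᵢ gi c d = gi (a ℤ.+ c) (b ℤ.+ d)

_*ᵢ_ : ℤi → ℤi → ℤi
gi a b *ᵢ gi c d = gi ((a ℤ.* c) ℤ.- (b ℤ.* d)) ((a ℤ.* d) ℤ.+ (b ℤ.* c))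

-ᵢ_ : ℤi → ℤi
-ᵢ gi a b = gi (ℤ.- a) (ℤ.- b)

isZeroℤ : ℤ → Bool
isZeroℤ (+ zero) = true
isZeroℤ _        = false

isZeroᵢ : ℤi → Bool
isZeroᵢ (gi a b) = isZeroℤ a ∧ isZeroℤ b

-- Determinantal rank of a square matrix over a commutative ring
-- (an integral domain: ℤ or ℤ[i]); equals the rank over its fraction field.

sublists : {B : Set} → List B → List (List B)
sublists []       = [ [] ]
sublists (x ∷ xs) = map (x ∷_) (sublists xs) ++ sublists xs

picks : {B : Set} → List B → List (B × List B)
picks []       = []
picks (x ∷ xs) = (x , xs) ∷ map (λ { (y , ys) → (y , x ∷ ys) }) (picks xs)

module MatrixRank {A : Set} (0# 1# : A) (_+_ _*_ : A → A → A) (-_ : A → A)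
                  (isZero : A → Bool) where

  altSum : List A → A
  altSum []       = 0#
  altSum (x ∷ xs) = x + (- altSum xs)

  -- determinant of the submatrix with the given row and column index lists
  -- (Laplace expansion along the first row; 0 if the lengths differ)
  det : ∀ {n} → (Fin n → Fin n → A) → List (Fin n) → List (Fin n) → A
  det M []       []      = 1#
  det M []       (_ ∷ _) = 0#
  det M (r ∷ rs) cs      =
    altSum (map (λ { (c , cs') → M r c * det M rs cs' }) (picks cs))

  rank : ∀ {n} → (Fin n → Fin n → A) → ℕ
  rank {n} M =
    foldr _⊔_ 0
      (concatMap (λ rs → map (λ cs → if isZero (det M rs cs) then 0 else length rs)
                             (sublists (allFin n)))
                 (sublists (allFin n)))

labℤi : Lab → ℤi
labℤi o  = 0i
labℤi e  = 1i
labℤi ar = gi (+ 0) (+ 1)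
labℤi ra = gi (+ 0) -[1+ 0 ]

rk : ∀ {n} → MixedGraph n → ℕ
rk G = MatrixRank.rank 0i 1i _+ᵢ_ _*ᵢ_ -ᵢ_ isZeroᵢ (λ u v → labℤi (h G u v))

r : ∀ {n} → MixedGraph n → ℕ
r G = MatrixRank.rank (+ 0) (+ 1) ℤ._+_ ℤ._*_ ℤ.-_ isZeroℤ
        (λ u v → if adjB G u v then + 1 else + 0)

countFin : ∀ {n} → (Fin n → Bool) → ℕ
countFin {n} p = foldr (λ x k → if p x then suc k else k) 0 (allFin n)

numEdges : ∀ {n} → MixedGraph n → ℕ
numEdges {n} G = foldr _+ℕ_ 0
  (map (λ u → countFin (λ v → (toℕ u <ᵇ toℕ v) ∧ adjB G u v)) (allFin n))

reachK : ∀ {n} → MixedGraph n → ℕ → Fin n → Fin n → Bool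
reachK G zero    u v = does (u ≟F v)
reachK {n} G (suc k) u v =
  reachK G k u v ∨ any (λ w → reachK G k u w ∧ adjB G w v) (allFin n)

reach : ∀ {n} → MixedGraph n → Fin n → Fin n → Bool
reach {n} G = reachK G n

-- ω(G): number of components = number of vertices that are the least
-- vertex of their component
ω : ∀ {n} → MixedGraph n → ℕ
ω {n} G = countFin (λ v → not (any (λ u → (toℕ u <ᵇ toℕ v) ∧ reach G u v) (allFin n)))

d : ∀ {n} → MixedGraph n → ℤ
d {n} G = (+ numEdges G ℤ.- + n) ℤ.+ + ω G

cyclicPairs : {B : Set} → List B → List (B × B)
cyclicPairs []       = []
cyclicPairs (x ∷ xs) = zip (x ∷ xs) (xs ++ [ x ])

IsCycle : ∀ {n} → MixedGraph n → List (Fin n) → Set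
IsCycle G c = (3 ≤ length c) × Unique c × All (λ { (u , v) → Adj G u v }) (cyclicPairs c)

CycleEdge : ∀ {n} → List (Fin n) → Fin n → Fin n → Set
CycleEdge c u v = ((u , v) ∈ cyclicPairs c) ⊎ ((v , u) ∈ cyclicPairs c)

SameCycle : ∀ {n} → List (Fin n) → List (Fin n) → Set
SameCycle c₁ c₂ = ∀ u v → CycleEdge c₁ u v ⇔ CycleEdge c₂ u v

VertexDisjoint : ∀ {n} → List (Fin n) → List (Fin n) → Set
VertexDisjoint c₁ c₂ = ∀ v → v ∈ c₁ → v ∈ c₂ → ⊥

forwardArcs backwardArcs : ∀ {n} → MixedGraph n → List (Fin n) → ℕ
forwardArcs G c =
  foldr (λ { (u , v) k → isAr (h G u v) k }) 0 (cyclicPairs c)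
  where isAr : Lab → ℕ → ℕ
        isAr ar k = suc k
        isAr _  k = k
backwardArcs G c =
  foldr (λ { (u , v) k → isRa (h G u v) k }) 0 (cyclicPairs c)
  where isRa : Lab → ℕ → ℕ
        isRa ra k = suc k
        isRa _  k = k

η : ∀ {n} → MixedGraph n → List (Fin n) → ℕ
η G c = ∣ + forwardArcs G c ℤ.- + backwardArcs G c ∣

CondI : ∀ {n} → MixedGraph n → Set
CondI {n} G = ∀ (c₁ c₂ : List (Fin n)) → IsCycle G c₁ → IsCycle G c₂ →
  (∃[ v ] (v ∈ c₁ × v ∈ c₂)) → SameCycle c₁ c₂

CondII : ∀ {n} → MixedGraph n → Set
CondII {n} G = ∀ (c : List (Fin n)) → IsCycle G c →
  (length c % 4 ≡ 0) × ((η G c % 2 ≡ 1) ⊎ (η G c % 4 ≡ 2))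

-- δ-transformations on induced subgraphs G[S], S : Fin n → Bool

VSet : ℕ → Set
VSet n = Fin n → Bool

degIn : ∀ {n} → MixedGraph n → VSet n → Fin n → ℕ
degIn G S v = countFin (λ w → S w ∧ adjB G v w)

Pendant : ∀ {n} → MixedGraph n → VSet n → Fin n → Set
Pendant G S v = (S v ≡ true) × (degIn G S v ≡ 1)

removeTwo : ∀ {n} → VSet n → Fin n → Fin n → VSet n
removeTwo S v w x = S x ∧ not (does (x ≟F v)) ∧ not (does (x ≟F w))

data DeltaStep {n} (G : MixedGraph n) (S : VSet n) : VSet n → Set where
  δ : ∀ v w → Pendant G S v → S w ≡ true → Adj G v w →
      DeltaStep G S (removeTwo S v w)

fullSet : ∀ {n} → VSet n
fullSet _ = true

NoPendant : ∀ {n} → MixedGraph n → VSet n → Set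
NoPendant G S = ∀ v → ¬ Pendant G S v

UnionOfCyclesAndIsolated : ∀ {n} → MixedGraph n → VSet n → ℕ → Set
UnionOfCyclesAndIsolated {n} G S k =
  Σ (List (List (Fin n))) λ cs →
    (length cs ≡ k) ×
    All (λ c → IsCycle G c × All (λ v → S v ≡ true) c) cs ×
    AllPairs VertexDisjoint cs ×
    (∀ u v → S u ≡ true → S v ≡ true → Adj G u v → Any (λ c → CycleEdge c u v) cs)

CondIII : ∀ {n} → MixedGraph n → Set
CondIII {n} G = Σ (VSet n) λ S →
  Star (DeltaStep G) fullSet S × NoPendant G S ×
  Σ ℕ λ k → (+ k ≡ d G) × UnionOfCyclesAndIsolated G S k

{-# OPTIONS --safe #-}
module Submission where

-- Both ranks are ranks over ℤ[i] of Hermitian matrices with the same zero pattern (r forgets the orientations). The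
-- inequality rk − r ≤ 2d follows by induction on induced subgraphs: deleting a pendant vertex and its neighbour lowers both
-- ranks by 2, and deleting a vertex of a cycle lowers rk by at most 2, does not raise r, and lowers d.
--
-- If the bound is attained, all these inequalities are equalities, at every vertex x of every cycle. So d drops by exactly 1
-- at x, whence x lies on a single cycle; some kernel vector of the adjacency matrix is nonzero at x, and all kernel vectors
-- of the Hermitian matrix vanish at x. After the δ-transformations no pendant vertex is left. Suppose then that a vertex u of
-- a cycle had a neighbour w off the cycle. Every kernel vector of the adjacency matrix of G − u vanishes at w, and an
-- alternating walk starting at w ends in a pendant vertex of G − u other than w in the component of w. This vertex is
-- adjacent to u, and a second cycle runs through u: a contradiction. Hence the crucial subgraph is a union of cycles and
-- isolated vertices, and going around a cycle of length l with kernel vectors gives 4 ∣ l and i^η ≠ 1.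
--
-- Conversely, in a crucial subgraph as in (iii), deleting one vertex of each cycle preserves r and lowers rk by 2.

open import Defs
open import Data.Nat using (ℕ)
open import Data.Integer using (+_; _-_; _*_)
open import Data.Product using (_×_)
open import Function.Bundles using (_⇔_)
open import Relation.Binary.PropositionalEquality using (_≡_)

open Defs using () renaming (_+ᵢ_ to infixl 6 _⊕_; _*ᵢ_ to infixl 7 _⊗_; -ᵢ_ to infix 8 ⊖_)
open import Algebra.Bundles using (CommutativeRing)
open import Algebra.Consequences.Propositional using (comm∧idˡ⇒id; comm∧invˡ⇒inv; comm∧distrˡ⇒distrʳ)
open import Algebra.Structures using (IsCommutativeRing)
open import Data.Bool using (Bool; true; false; not; T; if_then_else_; _∧_; _∨_)
open import Data.Bool.ListAction using (any)
open import Data.Bool.Properties using (∨-zeroʳ; ∧-zeroʳ; ∧-identityʳ; ∧-comm; ∨-comm; ¬-not) renaming (_≟_ to _≟ᴮ_)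
open import Data.Empty using (⊥; ⊥-elim)
open import Data.Fin using (Fin; zero; suc; toℕ; punchIn; punchOut)
import Data.Fin.Properties as FinP
open import Data.Integer as ℤ using (ℤ; -[1+_])
import Data.Integer.Properties as ℤP
open import Data.Integer.Tactic.RingSolver using () renaming (solve-∀ to ℤ-solve-∀)
open import Data.List using (List; []; _∷_; _++_; [_]; map; foldr; length; lookup; allFin; zip; concatMap)
import Data.List.Membership.DecPropositional as DecMembership
open import Data.List.Membership.Propositional using (_∈_; _∉_; find)
open import Data.List.Membership.Propositional.Properties
  using (∈-map⁺; ∈-map⁻; ∈-++⁺ˡ; ∈-++⁺ʳ; ∈-++⁻; ∈-concatMap⁺; ∈-concatMap⁻; ∈-∃++; ∈-allFin; ∈-lookup)
open import Data.List.Properties using (map-∘; map-cong; map-++; length-map; length-++; length-tabulate; ++-assoc; concatMap-cong)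
open import Data.List.Relation.Unary.All as All using (All; []; _∷_)
open import Data.List.Relation.Unary.All.Properties using (¬Any⇒All¬; All¬⇒¬Any) renaming (++⁻ˡ to All-++⁻ˡ; ++⁻ʳ to All-++⁻ʳ)
open import Data.List.Relation.Unary.AllPairs using (AllPairs; []; _∷_)
open import Data.List.Relation.Unary.Any as Any using (Any; here; there)
open import Data.List.Relation.Unary.Any.Properties using (lookup-index)
open import Data.List.Relation.Unary.Unique.Propositional using (Unique)
open import Data.List.Relation.Unary.Unique.Propositional.Properties using () renaming (allFin⁺ to allFin-unique; ++⁺ to Unique-++⁺)
open import Data.Maybe using (just; nothing)
open import Data.Nat as ℕ using (zero; suc; _+_; _∸_; _%_; _≤_; _<_; _⊔_; _<ᵇ_; _≤′_; ≤′-refl; ≤′-step; z≤n; s≤s; s≤s⁻¹)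
import Data.Nat.Divisibility as Div
open import Data.Nat.DivMod using (m%n<n; m*n%n≡0; [m+n]%n≡m%n; m∣n⇒o%n%m≡o%m)
open import Data.Nat.Induction using (<-wellFounded)
import Data.Nat.Properties as ℕP
open import Data.Nat.Tactic.RingSolver using () renaming (solve-∀ to ℕ-solve-∀)
open import Data.Product using (∃; ∃-syntax; _,_; proj₁; proj₂)
open import Data.Product.Properties using () renaming (≡-dec to ×-≡-dec)
open import Data.Sum using (_⊎_; inj₁; inj₂) renaming (map to ⊎-map; swap to ⊎-swap)
open import Function using (_∘_; id)
open import Function.Bundles using (mk⇔)
open import Induction.WellFounded using (Acc; acc)
open import Level using (0ℓ)
open import Relation.Binary.Construct.Closure.ReflexiveTransitive as Star using (Star; ε; _◅_; _◅◅_)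
open import Relation.Binary.Definitions using (tri<; tri≈; tri>)
open import Relation.Binary.PropositionalEquality hiding ([_])
open import Relation.Nullary using (¬_; Dec; yes; no; does)
open import Relation.Nullary.Decidable using (dec-true; dec-false; _×-dec_; _⊎-dec_; ¬?)
open import Tactic.RingSolver using (solve-∀)
open import Tactic.RingSolver.Core.AlmostCommutativeRing using (AlmostCommutativeRing; fromCommutativeRing)

cong-gi : ∀ {a b c d} → a ≡ c → b ≡ d → gi a b ≡ gi c d
cong-gi refl refl = refl

ℤi-isCommutativeRing : IsCommutativeRing _≡_ _+ᵢ_ _*ᵢ_ -ᵢ_ 0i 1i
ℤi-isCommutativeRing = record
  { isRing = record
    { +-isAbelianGroup = record
      { isGroup = record
        { isMonoid = record
          { isSemigroup = record
            { isMagma = isMagma _+ᵢ_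
            ; assoc = λ { (gi a b) (gi a' b') (gi a'' b'') →
                cong-gi (ℤP.+-assoc a a' a'') (ℤP.+-assoc b b' b'') } }
          ; identity = comm∧idˡ⇒id +-comm (λ { (gi a b) → cong-gi (ℤP.+-identityˡ a) (ℤP.+-identityˡ b) }) }
        ; inverse = comm∧invˡ⇒inv +-comm (λ { (gi a b) → cong-gi (ℤP.+-inverseˡ a) (ℤP.+-inverseˡ b) })
        ; ⁻¹-cong = cong -ᵢ_ }
      ; comm = +-comm }
    ; *-cong = cong₂ _*ᵢ_
    ; *-assoc = λ { (gi a b) (gi a' b') (gi a'' b'') → cong-gi (assocʳᵉ a b a' b' a'' b'') (assocⁱᵐ a b a' b' a'' b'') }
    ; *-identity = comm∧idˡ⇒id *-comm (λ { (gi a b) → cong-gi (idʳᵉ a b) (idⁱᵐ a b) })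
    ; distrib = *-distribˡ , comm∧distrˡ⇒distrʳ *-comm *-distribˡ
    }
  ; *-comm = *-comm
  }
  where
  +-comm : ∀ x y → x +ᵢ y ≡ y +ᵢ x
  +-comm (gi a b) (gi a' b') = cong-gi (ℤP.+-comm a a') (ℤP.+-comm b b')
  commʳᵉ : ∀ a b c d → a ℤ.* c ℤ.- b ℤ.* d ≡ c ℤ.* a ℤ.- d ℤ.* b
  commʳᵉ = ℤ-solve-∀
  commⁱᵐ : ∀ a b c d → a ℤ.* d ℤ.+ b ℤ.* c ≡ c ℤ.* b ℤ.+ d ℤ.* a
  commⁱᵐ = ℤ-solve-∀
  *-comm : ∀ x y → x *ᵢ y ≡ y *ᵢ x
  *-comm (gi a b) (gi a' b') = cong-gi (commʳᵉ a b a' b') (commⁱᵐ a b a' b')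
  idʳᵉ : ∀ a b → + 1 ℤ.* a ℤ.- + 0 ℤ.* b ≡ a
  idʳᵉ = ℤ-solve-∀
  idⁱᵐ : ∀ a b → + 1 ℤ.* b ℤ.+ + 0 ℤ.* a ≡ b
  idⁱᵐ = ℤ-solve-∀
  assocʳᵉ : ∀ a b c d x y → (a ℤ.* c ℤ.- b ℤ.* d) ℤ.* x ℤ.- (a ℤ.* d ℤ.+ b ℤ.* c) ℤ.* y
                          ≡ a ℤ.* (c ℤ.* x ℤ.- d ℤ.* y) ℤ.- b ℤ.* (c ℤ.* y ℤ.+ d ℤ.* x)
  assocʳᵉ = ℤ-solve-∀
  assocⁱᵐ : ∀ a b c d x y → (a ℤ.* c ℤ.- b ℤ.* d) ℤ.* y ℤ.+ (a ℤ.* d ℤ.+ b ℤ.* c) ℤ.* x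
                          ≡ a ℤ.* (c ℤ.* y ℤ.+ d ℤ.* x) ℤ.+ b ℤ.* (c ℤ.* x ℤ.- d ℤ.* y)
  assocⁱᵐ = ℤ-solve-∀
  distribʳᵉ : ∀ a b c d x y → a ℤ.* (c ℤ.+ x) ℤ.- b ℤ.* (d ℤ.+ y)
                            ≡ a ℤ.* c ℤ.- b ℤ.* d ℤ.+ (a ℤ.* x ℤ.- b ℤ.* y)
  distribʳᵉ = ℤ-solve-∀
  distribⁱᵐ : ∀ a b c d x y → a ℤ.* (d ℤ.+ y) ℤ.+ b ℤ.* (c ℤ.+ x)
                            ≡ a ℤ.* d ℤ.+ b ℤ.* c ℤ.+ (a ℤ.* y ℤ.+ b ℤ.* x)
  distribⁱᵐ = ℤ-solve-∀
  *-distribˡ : ∀ x y z → x *ᵢ (y +ᵢ z) ≡ (x *ᵢ y) +ᵢ (x *ᵢ z)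
  *-distribˡ (gi a b) (gi a' b') (gi a'' b'') = cong-gi (distribʳᵉ a b a' b' a'' b'') (distribⁱᵐ a b a' b' a'' b'')

ℤi-commutativeRing : CommutativeRing 0ℓ 0ℓ
ℤi-commutativeRing = record { isCommutativeRing = ℤi-isCommutativeRing }

ℤi-ring : AlmostCommutativeRing 0ℓ 0ℓ
ℤi-ring = fromCommutativeRing ℤi-commutativeRing
  λ { (gi (+ 0) (+ 0)) → just refl ; _ → nothing }

open CommutativeRing ℤi-commutativeRing
  using (semiring; *-identityˡ; *-identityʳ; *-comm; *-assoc; zeroˡ; zeroʳ; -‿inverseʳ)

isZeroℤ⇒≡0 : ∀ a → isZeroℤ a ≡ true → a ≡ + 0
isZeroℤ⇒≡0 (+ zero) _ = refl
isZeroℤ⇒≡0 (+ suc _) ()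
isZeroℤ⇒≡0 -[1+ _ ] ()

isZero⇒≡0 : ∀ x → isZeroᵢ x ≡ true → x ≡ 0i
isZero⇒≡0 (gi a b) p with isZeroℤ a in a0 | isZeroℤ b in b0
... | true | true = cong-gi (isZeroℤ⇒≡0 a a0) (isZeroℤ⇒≡0 b b0)
isZero⇒≡0 (gi a b) () | true | false
isZero⇒≡0 (gi a b) () | false | _

_≟0 : (x : ℤi) → Dec (x ≡ 0i)
x ≟0 with isZeroᵢ x in x0
... | true  = yes (isZero⇒≡0 x x0)
... | false = no λ { refl → case-false x0 }
  where
  case-false : true ≡ false → ⊥
  case-false ()

isZero-≡0 : ∀ {x} → x ≢ 0i → isZeroᵢ x ≡ false
isZero-≡0 {x} x≢0 with isZeroᵢ x in x0
... | true  = ⊥-elim (x≢0 (isZero⇒≡0 x x0))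
... | false = refl

sum-of-squares-≡0 : ∀ a b → a ℤ.* a ℤ.+ b ℤ.* b ≡ + 0 → a ≡ + 0 × b ≡ + 0
sum-of-squares-≡0 (+ zero)  (+ zero)  _ = refl , refl
sum-of-squares-≡0 (+ zero)  (+ suc _) ()
sum-of-squares-≡0 (+ zero)  -[1+ _ ]  ()
sum-of-squares-≡0 (+ suc _) (+ zero)  ()
sum-of-squares-≡0 (+ suc _) (+ suc _) ()
sum-of-squares-≡0 (+ suc _) -[1+ _ ]  ()
sum-of-squares-≡0 -[1+ _ ]  (+ zero)  ()
sum-of-squares-≡0 -[1+ _ ]  (+ suc _) ()
sum-of-squares-≡0 -[1+ _ ]  -[1+ _ ]  ()

⊗-cancelˡ-0 : ∀ x {y} → x ≢ 0i → x ⊗ y ≡ 0i → y ≡ 0i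
⊗-cancelˡ-0 (gi a b) {gi c d} x≢0 xy≡0 with ℤP.i*j≡0⇒i≡0∨j≡0 (a ℤ.* a ℤ.+ b ℤ.* b) {c} normʳᵉ
                                         | ℤP.i*j≡0⇒i≡0∨j≡0 (a ℤ.* a ℤ.+ b ℤ.* b) {d} normⁱᵐ
  where
  open ≡-Reasoning
  P = a ℤ.* c ℤ.- b ℤ.* d
  Q = a ℤ.* d ℤ.+ b ℤ.* c
  P≡0 : P ≡ + 0
  P≡0 = cong ℤi.re xy≡0
  Q≡0 : Q ≡ + 0
  Q≡0 = cong ℤi.im xy≡0
  idʳᵉ : ∀ a b c d → (a ℤ.* a ℤ.+ b ℤ.* b) ℤ.* c ≡ a ℤ.* (a ℤ.* c ℤ.- b ℤ.* d) ℤ.+ b ℤ.* (a ℤ.* d ℤ.+ b ℤ.* c)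
  idʳᵉ = ℤ-solve-∀
  idⁱᵐ : ∀ a b c d → (a ℤ.* a ℤ.+ b ℤ.* b) ℤ.* d ≡ a ℤ.* (a ℤ.* d ℤ.+ b ℤ.* c) ℤ.- b ℤ.* (a ℤ.* c ℤ.- b ℤ.* d)
  idⁱᵐ = ℤ-solve-∀
  zeroʳᵉ : ∀ a b → a ℤ.* + 0 ℤ.+ b ℤ.* + 0 ≡ + 0
  zeroʳᵉ = ℤ-solve-∀
  zeroⁱᵐ : ∀ a b → a ℤ.* + 0 ℤ.- b ℤ.* + 0 ≡ + 0
  zeroⁱᵐ = ℤ-solve-∀
  normʳᵉ : (a ℤ.* a ℤ.+ b ℤ.* b) ℤ.* c ≡ + 0
  normʳᵉ = trans (idʳᵉ a b c d) (trans (cong₂ (λ p q → a ℤ.* p ℤ.+ b ℤ.* q) P≡0 Q≡0) (zeroʳᵉ a b))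
  normⁱᵐ : (a ℤ.* a ℤ.+ b ℤ.* b) ℤ.* d ≡ + 0
  normⁱᵐ = trans (idⁱᵐ a b c d) (trans (cong₂ (λ p q → a ℤ.* p ℤ.- b ℤ.* q) Q≡0 P≡0) (zeroⁱᵐ a b))
... | inj₁ n≡0  | _  = let a≡0 , b≡0 = sum-of-squares-≡0 a b n≡0 in ⊥-elim (x≢0 (cong-gi a≡0 b≡0))
... | inj₂ _  | inj₁ n≡0  = let a≡0 , b≡0 = sum-of-squares-≡0 a b n≡0 in ⊥-elim (x≢0 (cong-gi a≡0 b≡0))
... | inj₂ c≡0  | inj₂ d≡0  = cong-gi c≡0 d≡0

⊗-≢0 : ∀ {x y} → x ≢ 0i → y ≢ 0i → x ⊗ y ≢ 0i
⊗-≢0 {x} x≢0 y≢0 xy≡0 = y≢0 (⊗-cancelˡ-0 x x≢0 xy≡0)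

≡⊖⇒≡0 : ∀ {x} → x ≡ ⊖ x → x ≡ 0i
≡⊖⇒≡0 {x} x≡-x = ⊗-cancelˡ-0 (gi (+ 2) (+ 0)) (λ ())
  (trans (double x) (trans (cong (x ⊕_) x≡-x) (-‿inverseʳ x)))
  where
  double : ∀ x → gi (+ 2) (+ 0) ⊗ x ≡ x ⊕ x
  double (gi a b) = cong-gi (dʳᵉ a b) (dⁱᵐ a b)
    where
    dʳᵉ : ∀ a b → + 2 ℤ.* a ℤ.- + 0 ℤ.* b ≡ a ℤ.+ a
    dʳᵉ = ℤ-solve-∀
    dⁱᵐ : ∀ a b → + 2 ℤ.* b ℤ.+ + 0 ℤ.* a ≡ b ℤ.+ b
    dⁱᵐ = ℤ-solve-∀

⊖-involutive : ∀ x → ⊖ (⊖ x) ≡ x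
⊖-involutive = solve-∀ ℤi-ring

conj : ℤi → ℤi
conj (gi a b) = gi a (ℤ.- b)

conj-⊗ : ∀ x y → conj (x ⊗ y) ≡ conj x ⊗ conj y
conj-⊗ (gi a b) (gi c d) = cong-gi (cʳᵉ a b c d) (cⁱᵐ a b c d)
  where
  cʳᵉ : ∀ a b c d → a ℤ.* c ℤ.- b ℤ.* d ≡ a ℤ.* c ℤ.- (ℤ.- b) ℤ.* (ℤ.- d)
  cʳᵉ = ℤ-solve-∀
  cⁱᵐ : ∀ a b c d → ℤ.- (a ℤ.* d ℤ.+ b ℤ.* c) ≡ a ℤ.* (ℤ.- d) ℤ.+ (ℤ.- b) ℤ.* c
  cⁱᵐ = ℤ-solve-∀

conj-⊕ : ∀ x y → conj (x ⊕ y) ≡ conj x ⊕ conj y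
conj-⊕ (gi a b) (gi c d) = cong-gi refl (ℤP.neg-distrib-+ b d)

conj-conj : ∀ x → conj (conj x) ≡ x
conj-conj (gi a b) = cong-gi refl (ℤP.neg-involutive b)

conj-≢0 : ∀ {x} → x ≢ 0i → conj x ≢ 0i
conj-≢0 {x} x≢0 cx≡0 = x≢0 (trans (sym (conj-conj x)) (cong conj cx≡0))

labℤi-conj : ∀ l → labℤi (conjLab l) ≡ conj (labℤi l)
labℤi-conj o  = refl
labℤi-conj e  = refl
labℤi-conj ar = refl
labℤi-conj ra = refl

open import Algebra.Properties.Semiring.Sum semiring
  using (sum; sum-cong-≗; sum-remove; ∑-distrib-+; *-distribˡ-sum; *-distribʳ-sum; ∑-comm; sum-replicate-zero)
open MatrixRank 0i 1i _+ᵢ_ _*ᵢ_ -ᵢ_ isZeroᵢ using () renaming (det to detᵢ; rank to rankᵢ; altSum to altSumᵢ)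

Vec Mat : ℕ → Set
Vec n = Fin n → ℤi
Mat n = Fin n → Fin n → ℤi

-- Laplace expansion along row r, with F the minor on the remaining rows.
L : ∀ {n} → (List (Vec n) → ℤi) → Fin n → List (Vec n) → ℤi
L F r []  = 0i
L F r (x ∷ xs) = x r ⊗ F xs ⊕ ⊖ L (λ ys → F (x ∷ ys)) r xs

D : ∀ {n} → List (Fin n) → List (Vec n) → ℤi
D []  []  = 1i
D []  (_ ∷ _) = 0i
D (r ∷ rs) xs  = L (D rs) r xs

column : ∀ {n} → Mat n → Fin n → Vec n
column M c r = M r c

L-cong : ∀ {n} {F G : List (Vec n) → ℤi} → (∀ xs → F xs ≡ G xs) → ∀ r xs → L F r xs ≡ L G r xs
L-cong F≗G r []  = refl
L-cong F≗G r (x ∷ xs) = cong₂ (λ a b → x r ⊗ a ⊕ ⊖ b) (F≗G xs) (L-cong (λ ys → F≗G (x ∷ ys)) r xs)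

L-zero : ∀ {n} {F : List (Vec n) → ℤi} → (∀ xs → F xs ≡ 0i) → ∀ r xs → L F r xs ≡ 0i
L-zero F0 r []  = refl
L-zero F0 r (x ∷ xs) = trans (cong₂ (λ a b → x r ⊗ a ⊕ ⊖ b) (F0 xs) (L-zero (λ ys → F0 (x ∷ ys)) r xs)) (cong (_⊕ ⊖ 0i) (zeroʳ (x r)))

L-lin : ∀ {n} a (F G : List (Vec n) → ℤi) r xs →
        L (λ ys → a ⊗ F ys ⊕ G ys) r xs ≡ a ⊗ L F r xs ⊕ L G r xs
L-lin a F G r []  = lemma a
  where
  lemma : ∀ a → 0i ≡ a ⊗ 0i ⊕ 0i
  lemma = solve-∀ ℤi-ring
L-lin a F G r (x ∷ xs) = trans
  (cong (λ z → x r ⊗ (a ⊗ F xs ⊕ G xs) ⊕ ⊖ z) (L-lin a (λ ys → F (x ∷ ys)) (λ ys → G (x ∷ ys)) r xs))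
  (lemma a (x r) (F xs) (G xs) _ _)
  where
  lemma : ∀ a x f g u v → x ⊗ (a ⊗ f ⊕ g) ⊕ ⊖ (a ⊗ u ⊕ v) ≡ a ⊗ (x ⊗ f ⊕ ⊖ u) ⊕ (x ⊗ g ⊕ ⊖ v)
  lemma = solve-∀ ℤi-ring

L-neg : ∀ {n} (F : List (Vec n) → ℤi) r xs → L (λ ys → ⊖ F ys) r xs ≡ ⊖ L F r xs
L-neg F r []  = refl
L-neg F r (x ∷ xs) = trans (cong (λ z → x r ⊗ (⊖ F xs) ⊕ ⊖ z) (L-neg (λ ys → F (x ∷ ys)) r xs)) (lemma (x r) (F xs) _)
  where
  lemma : ∀ x f u → x ⊗ (⊖ f) ⊕ ⊖ (⊖ u) ≡ ⊖ (x ⊗ f ⊕ ⊖ u)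
  lemma = solve-∀ ℤi-ring

det-picks : ∀ {n} (M : Mat n) (F : List (Fin n) → ℤi) (G : List (Vec n) → ℤi) →
            (∀ cs → F cs ≡ G (map (column M) cs)) → ∀ r cs →
            altSumᵢ (map (λ (c , cs') → M r c ⊗ F cs') (picks cs)) ≡ L G r (map (column M) cs)
det-picks M F G F≗G r []  = refl
det-picks M F G F≗G r (c ∷ cs) = cong₂ (λ a b → M r c ⊗ a ⊕ ⊖ b) (F≗G cs)
  (trans (cong altSumᵢ (trans (sym (map-∘ (picks cs))) (map-cong (λ _ → refl) (picks cs))))
         (det-picks M (λ cs' → F (c ∷ cs')) (λ ys → G (column M c ∷ ys)) (λ cs' → F≗G (c ∷ cs')) r cs))

det≡D : ∀ {n} (M : Mat n) rs cs → detᵢ M rs cs ≡ D rs (map (column M) cs)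
det≡D M []  []  = refl
det≡D M []  (_ ∷ _)  = refl
det≡D M (r ∷ rs) cs  = trans (cong altSumᵢ (map-cong (λ _ → refl) (picks cs)))
                                  (det-picks M (detᵢ M rs) (D rs) (det≡D M rs) r cs)

D-length : ∀ {n} (rs : List (Fin n)) xs → D rs xs ≢ 0i → length rs ≡ length xs
D-length rs xs D≢0 with length rs ℕP.≟ length xs
... | yes eq  = eq
... | no  neq = ⊥-elim (D≢0 (D-≢length rs xs neq))
  where
  L-≢length : ∀ {n} (F : List (Vec n) → ℤi) m → (∀ ys → m ≢ length ys → F ys ≡ 0i) →
              ∀ r xs → suc m ≢ length xs → L F r xs ≡ 0i
  L-≢length F m F0 r []  m≢ = refl
  L-≢length F m F0 r (x ∷ xs) m≢ = trans
    (cong₂ (λ a b → x r ⊗ a ⊕ ⊖ b) (F0 xs (m≢ ∘ cong suc)) (rest m F0 m≢))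
    (lemma (x r))
    where
    lemma : ∀ x → x ⊗ 0i ⊕ ⊖ 0i ≡ 0i
    lemma = solve-∀ ℤi-ring
    rest : ∀ m → (∀ ys → m ≢ length ys → F ys ≡ 0i) → suc m ≢ suc (length xs) → L (λ ys → F (x ∷ ys)) r xs ≡ 0i
    rest zero  F0 m≢ = L-zero (λ ys → F0 (x ∷ ys) λ ()) r xs
    rest (suc m) F0 m≢ = L-≢length (λ ys → F (x ∷ ys)) m (λ ys m≢' → F0 (x ∷ ys) (m≢' ∘ ℕP.suc-injective)) r xs
                                   (m≢ ∘ cong suc)
  D-≢length : ∀ rs xs → length rs ≢ length xs → D rs xs ≡ 0i
  D-≢length []  []  neq = ⊥-elim (neq refl)
  D-≢length []  (_ ∷ _)  neq = refl
  D-≢length (r ∷ rs) xs  neq = L-≢length (D rs) (length rs) (D-≢length rs) r xs neq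

Alternating : ∀ {A : Set} → (List A → ℤi) → Set
Alternating F = ∀ as x y bs → F (as ++ x ∷ y ∷ bs) ≡ ⊖ F (as ++ y ∷ x ∷ bs)

L-alternating : ∀ {n} {F : List (Vec n) → ℤi} → Alternating F → ∀ r → Alternating (L F r)
L-alternating {F = F} alt r [] x y bs = trans
  (cong (λ z → x r ⊗ F (y ∷ bs) ⊕ ⊖ (y r ⊗ F (x ∷ bs) ⊕ ⊖ z))
        (trans (L-cong (λ zs → alt [] x y zs) r bs) (L-neg (λ zs → F (y ∷ x ∷ zs)) r bs)))
  (lemma (x r ⊗ F (y ∷ bs)) (y r ⊗ F (x ∷ bs)) _)
  where
  lemma : ∀ a b z → a ⊕ ⊖ (b ⊕ ⊖ (⊖ z)) ≡ ⊖ (b ⊕ ⊖ (a ⊕ ⊖ z))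
  lemma = solve-∀ ℤi-ring
L-alternating {F = F} alt r (a ∷ as) x y bs = trans
  (cong₂ (λ u v → a r ⊗ u ⊕ ⊖ v) (alt as x y bs)
         (L-alternating {F = λ ys → F (a ∷ ys)} (λ cs → alt (a ∷ cs)) r as x y bs))
  (lemma (a r) _ _)
  where
  lemma : ∀ a f u → a ⊗ (⊖ f) ⊕ ⊖ (⊖ u) ≡ ⊖ (a ⊗ f ⊕ ⊖ u)
  lemma = solve-∀ ℤi-ring

D-alternating-columns : ∀ {n} (rs : List (Fin n)) → Alternating (D rs)
D-alternating-columns []  []  x y bs = refl
D-alternating-columns []  (_ ∷ _) x y bs = refl
D-alternating-columns (r ∷ rs)  = L-alternating (D-alternating-columns rs) r

L-L : ∀ {n} (F : List (Vec n) → ℤi) p q xs → L (L F p) q xs ≡ ⊖ L (L F q) p xs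
L-L F p q []  = refl
L-L F p q (x ∷ xs) = trans
  (cong (λ z → x q ⊗ L F p xs ⊕ ⊖ z) (expand p q))
  (trans (cong (λ z → x q ⊗ L F p xs ⊕ ⊖ (x p ⊗ L F q xs ⊕ ⊖ z)) (L-L (λ ys → F (x ∷ ys)) p q xs))
  (trans (lemma (x q ⊗ L F p xs) (x p ⊗ L F q xs) _)
         (cong (λ z → ⊖ (x p ⊗ L F q xs ⊕ ⊖ z)) (sym (expand q p)))))
  where
  expand : ∀ p q → L (λ ys → x p ⊗ F ys ⊕ ⊖ L (λ zs → F (x ∷ zs)) p ys) q xs ≡
                   x p ⊗ L F q xs ⊕ ⊖ L (L (λ zs → F (x ∷ zs)) p) q xs
  expand p q = trans (L-lin (x p) F (λ ys → ⊖ L (λ zs → F (x ∷ zs)) p ys) q xs)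
                     (cong (x p ⊗ L F q xs ⊕_) (L-neg (L (λ zs → F (x ∷ zs)) p) q xs))
  lemma : ∀ a b z → a ⊕ ⊖ (b ⊕ ⊖ (⊖ z)) ≡ ⊖ (b ⊕ ⊖ (a ⊕ ⊖ z))
  lemma = solve-∀ ℤi-ring

D-alternating-rows : ∀ {n} (xs : List (Vec n)) → Alternating (λ rs → D rs xs)
D-alternating-rows xs []  p q bs = L-L (D bs) q p xs
D-alternating-rows xs (a ∷ as) p q bs = trans
  (L-cong (λ ys → D-alternating-rows ys as p q bs) a xs)
  (L-neg (D (as ++ q ∷ p ∷ bs)) a xs)

⊖-≡0 : ∀ {x} → x ≡ 0i → ⊖ x ≡ 0i
⊖-≡0 refl = refl

⊖-≡0⁻¹ : ∀ {x} → ⊖ x ≡ 0i → x ≡ 0i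
⊖-≡0⁻¹ {x} p = trans (sym (⊖-involutive x)) (⊖-≡0 p)

module _ {A : Set} where

  move-front : ∀ (F : List A → ℤi) → Alternating F → ∀ as c bs → F (as ++ c ∷ bs) ≡ 0i → F (c ∷ as ++ bs) ≡ 0i
  move-front F alt []  c bs p = p
  move-front F alt (a ∷ as) c bs p = trans (alt [] c a (as ++ bs))
    (⊖-≡0 (move-front (F ∘ (a ∷_)) (λ cs → alt (a ∷ cs)) as c bs p))

  move-back : ∀ (F : List A → ℤi) → Alternating F → ∀ as c bs → F (c ∷ as ++ bs) ≡ 0i → F (as ++ c ∷ bs) ≡ 0i
  move-back F alt []  c bs p = p
  move-back F alt (a ∷ as) c bs p = move-back (F ∘ (a ∷_)) (λ cs → alt (a ∷ cs)) as c bs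
    (⊖-≡0⁻¹ (trans (sym (alt [] c a (as ++ bs))) p))

  repeated : ∀ (F : List A → ℤi) → Alternating F → ∀ as c bs → F (c ∷ as ++ c ∷ bs) ≡ 0i
  repeated F alt []  c bs = ≡⊖⇒≡0 (alt [] c c bs)
  repeated F alt (a ∷ as) c bs = trans (alt [] c a (as ++ c ∷ bs))
    (⊖-≡0 (repeated (F ∘ (a ∷_)) (λ cs → alt (a ∷ cs)) as c bs))

D-vanishing : ∀ {n} rs {w : Vec n} → (∀ {r} → r ∈ rs → w r ≡ 0i) → ∀ as bs → D rs (as ++ w ∷ bs) ≡ 0i
D-vanishing []  w0 []  bs = refl
D-vanishing []  w0 (_ ∷ _)  bs = refl
D-vanishing (r ∷ rs) {w} w0 as bs = L-vanishing (D rs) (D-vanishing rs (w0 ∘ there)) as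
  where
  lemma : ∀ x → x ⊗ 0i ⊕ ⊖ 0i ≡ 0i
  lemma = solve-∀ ℤi-ring
  L-vanishing : ∀ F → (∀ as bs → F (as ++ w ∷ bs) ≡ 0i) → ∀ as → L F r (as ++ w ∷ bs) ≡ 0i
  L-vanishing F F0 []  = trans (cong₂ (λ a b → a ⊗ F bs ⊕ ⊖ b) (w0 (here refl)) (L-zero (F0 []) r bs))
                                    (cong (_⊕ ⊖ 0i) (zeroˡ (F bs)))
  L-vanishing F F0 (a ∷ as) = trans (cong₂ (λ u v → a r ⊗ u ⊕ ⊖ v) (F0 as bs) (L-vanishing (λ ys → F (a ∷ ys)) (λ cs → F0 (a ∷ cs)) as))
                                    (lemma (a r))

D-linear : ∀ {n} rs a (x y : Vec n) bs → D rs ((λ r → a ⊗ x r ⊕ y r) ∷ bs) ≡ a ⊗ D rs (x ∷ bs) ⊕ D rs (y ∷ bs)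
D-linear rs a x y = linear rs []
  where
  z = λ r → a ⊗ x r ⊕ y r
  lemma₀ : ∀ a → 0i ≡ a ⊗ 0i ⊕ 0i
  lemma₀ = solve-∀ ℤi-ring
  lemma₁ : ∀ a x y f u v → (a ⊗ x ⊕ y) ⊗ f ⊕ ⊖ (a ⊗ u ⊕ v) ≡ a ⊗ (x ⊗ f ⊕ ⊖ u) ⊕ (y ⊗ f ⊕ ⊖ v)
  lemma₁ = solve-∀ ℤi-ring
  lemma₂ : ∀ a c f g u v → c ⊗ (a ⊗ f ⊕ g) ⊕ ⊖ (a ⊗ u ⊕ v) ≡ a ⊗ (c ⊗ f ⊕ ⊖ u) ⊕ (c ⊗ g ⊕ ⊖ v)
  lemma₂ = solve-∀ ℤi-ring
  L-linear : ∀ F r → (∀ as bs → F (as ++ z ∷ bs) ≡ a ⊗ F (as ++ x ∷ bs) ⊕ F (as ++ y ∷ bs)) →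
             ∀ as bs → L F r (as ++ z ∷ bs) ≡ a ⊗ L F r (as ++ x ∷ bs) ⊕ L F r (as ++ y ∷ bs)
  L-linear F r lin []  bs = trans
    (cong (λ u → z r ⊗ F bs ⊕ ⊖ u)
          (trans (L-cong (lin []) r bs) (L-lin a (λ ys → F (x ∷ ys)) (λ ys → F (y ∷ ys)) r bs)))
    (lemma₁ a (x r) (y r) (F bs) _ _)
  L-linear F r lin (c ∷ as) bs = trans
    (cong₂ (λ u v → c r ⊗ u ⊕ ⊖ v) (lin as bs) (L-linear (λ ys → F (c ∷ ys)) r (λ cs → lin (c ∷ cs)) as bs))
    (lemma₂ a (c r) _ _ _ _)
  linear : ∀ rs as bs → D rs (as ++ z ∷ bs) ≡ a ⊗ D rs (as ++ x ∷ bs) ⊕ D rs (as ++ y ∷ bs)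
  linear []  []  bs = lemma₀ a
  linear []  (_ ∷ _) bs = lemma₀ a
  linear (r ∷ rs) as  bs = L-linear (D rs) r (linear rs) as bs

D-sum : ∀ {n k} rs (x : Fin k → Vec n) (v : Fin k → ℤi) bs →
        D rs ((λ r → sum (λ j → v j ⊗ x j r)) ∷ bs) ≡ sum (λ j → v j ⊗ D rs (x j ∷ bs))
D-sum {k = zero}  rs x v bs = D-vanishing rs (λ _ → refl) [] bs
D-sum {k = suc k} rs x v bs = trans
  (D-linear rs (v zero) (x zero) (λ r → sum (λ j → v (suc j) ⊗ x (suc j) r)) bs)
  (cong (v zero ⊗ D rs (x zero ∷ bs) ⊕_) (D-sum rs (x ∘ suc) (v ∘ suc) bs))

dot : ∀ {n} → Vec n → Vec n → ℤi
dot b v = sum (λ j → b j ⊗ v j)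

infixr 7 _∙_
_∙_ : ∀ {n} → Mat n → Vec n → Vec n
(M ∙ v) i = dot (M i) v

comb : ∀ {n k} → (Fin k → Vec n) → (Fin k → ℤi) → Vec n
comb Q a i = sum (λ j → a j ⊗ Q j i)

unit : ∀ {n} → Fin n → Vec n
unit c i = if does (i FinP.≟ c) then 1i else 0i

sum-0 : ∀ {n} (f : Fin n → ℤi) → (∀ i → f i ≡ 0i) → sum f ≡ 0i
sum-0 {n} f f0 = trans (sum-cong-≗ f0) (sum-replicate-zero n)

dot-cong : ∀ {n} (b : Vec n) {v w : Vec n} → (∀ i → v i ≡ w i) → dot b v ≡ dot b w
dot-cong b v≗w = sum-cong-≗ (λ j → cong (b j ⊗_) (v≗w j))

dot-congˡ : ∀ {n} {b c : Vec n} (v : Vec n) → (∀ i → b i ≡ c i) → dot b v ≡ dot c v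
dot-congˡ v b≗c = sum-cong-≗ (λ j → cong (_⊗ v j) (b≗c j))

dot-comm : ∀ {n} (b v : Vec n) → dot b v ≡ dot v b
dot-comm b v = sum-cong-≗ (λ j → *-comm (b j) (v j))

dot-linear : ∀ {n} (b : Vec n) a (v w : Vec n) → dot b (λ i → a ⊗ v i ⊕ w i) ≡ a ⊗ dot b v ⊕ dot b w
dot-linear b a v w = trans (sum-cong-≗ (λ j → lemma (b j) a (v j) (w j)))
  (trans (∑-distrib-+ (λ j → a ⊗ (b j ⊗ v j)) (λ j → b j ⊗ w j))
         (cong (_⊕ dot b w) (sym (*-distribˡ-sum a (λ j → b j ⊗ v j)))))
  where
  lemma : ∀ b a v w → b ⊗ (a ⊗ v ⊕ w) ≡ a ⊗ (b ⊗ v) ⊕ b ⊗ w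
  lemma = solve-∀ ℤi-ring

dot-scale : ∀ {n} (b : Vec n) a (v : Vec n) → dot b (λ i → a ⊗ v i) ≡ a ⊗ dot b v
dot-scale b a v = trans (sum-cong-≗ (λ j → lemma (b j) a (v j))) (sym (*-distribˡ-sum a (λ j → b j ⊗ v j)))
  where
  lemma : ∀ b a v → b ⊗ (a ⊗ v) ≡ a ⊗ (b ⊗ v)
  lemma = solve-∀ ℤi-ring

dot-comb : ∀ {n k} (b : Vec n) (Q : Fin k → Vec n) a → dot b (comb Q a) ≡ dot (λ t → dot b (Q t)) a
dot-comb b Q a = trans (sum-cong-≗ (λ j → *-distribˡ-sum (b j) (λ t → a t ⊗ Q t j)))
  (trans (∑-comm (λ j t → b j ⊗ (a t ⊗ Q t j)))
  (sum-cong-≗ λ t → trans (sum-cong-≗ (λ j → lemma (b j) (a t) (Q t j))) (sym (*-distribʳ-sum (a t) (λ j → b j ⊗ Q t j)))))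
  where
  lemma : ∀ b a q → b ⊗ (a ⊗ q) ≡ b ⊗ q ⊗ a
  lemma = solve-∀ ℤi-ring

dot-unit : ∀ {n} (b : Vec n) c → dot b (unit c) ≡ b c
dot-unit {suc n} b zero  = trans (cong (b zero ⊗ 1i ⊕_) (sum-0 {n} _ (λ i → zeroʳ (b (suc i))))) (lemma (b zero))
  where
  lemma : ∀ x → x ⊗ 1i ⊕ 0i ≡ x
  lemma = solve-∀ ℤi-ring
dot-unit {suc n} b (suc c) = trans (cong (b zero ⊗ 0i ⊕_) (dot-unit (b ∘ suc) c)) (lemma (b zero) (b (suc c)))
  where
  lemma : ∀ x y → x ⊗ 0i ⊕ y ≡ y
  lemma = solve-∀ ℤi-ring

unit-refl : ∀ {n} (c : Fin n) → unit c c ≡ 1i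
unit-refl c with c FinP.≟ c
... | yes _ = refl
... | no ¬p = ⊥-elim (¬p refl)

unit-≢ : ∀ {n} {c i : Fin n} → i ≢ c → unit c i ≡ 0i
unit-≢ {c = c} {i} i≢c with i FinP.≟ c
... | yes p = ⊥-elim (i≢c p)
... | no _  = refl

record RankAtMost {n} (M : Mat n) (k : ℕ) : Set where
  constructor _,_
  field
    functional : Fin k → Vec n
    vanishing  : ∀ v → (∀ t → dot (functional t) v ≡ 0i) → ∀ i → (M ∙ v) i ≡ 0i

record RankAtLeast {n} (M : Mat n) (k : ℕ) : Set where
  constructor _,_
  field
    vector  : Fin k → Vec n
    independent : ∀ a → (∀ i → (M ∙ comb vector a) i ≡ 0i) → ∀ j → a j ≡ 0i

nontrivial-solution : ∀ {k l} (m : Fin k → Fin l → ℤi) → k < l →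
                      ∃ λ (a : Fin l → ℤi) → (∃ λ j → a j ≢ 0i) × (∀ t → dot (m t) a ≡ 0i)
nontrivial-solution {zero}  {suc l} m _ = unit zero , (zero , λ ()) , λ ()
nontrivial-solution {suc k} {suc l} m k<l with FinP.any? (λ j → ¬? (m zero j ≟0))
... | no ¬pivot =
  let a , nz , sol = nontrivial-solution (m ∘ suc) (ℕP.<-trans (ℕP.n<1+n k) k<l) in
  a , nz , λ { zero → sum-0 _ (λ j → trans (cong (_⊗ a j) (row0 j)) (zeroˡ (a j))) ; (suc t) → sol t }
  where
  row0 : ∀ j → m zero j ≡ 0i
  row0 j with m zero j ≟0
  ... | yes p = p
  ... | no ¬p = ⊥-elim (¬pivot (j , ¬p))
... | yes (j , pivot) = a , (punchIn j i₀ , a-nz) , sol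
  where
  p = m zero j
  m′ : Fin k → Fin l → ℤi
  m′ t i = p ⊗ m (suc t) (punchIn j i) ⊕ ⊖ (m (suc t) j ⊗ m zero (punchIn j i))
  IH = nontrivial-solution m′ (s≤s⁻¹ k<l)
  b = proj₁ IH
  i₀ = proj₁ (proj₁ (proj₂ IH))
  row0 : Fin l → ℤi
  row0 i = m zero (punchIn j i)
  a : Fin (suc l) → ℤi
  a i with j FinP.≟ i
  ... | yes _  = ⊖ dot row0 b
  ... | no j≢i = p ⊗ b (punchOut j≢i)
  a-j : a j ≡ ⊖ dot row0 b
  a-j with j FinP.≟ j
  ... | yes _ = refl
  ... | no ¬p = ⊥-elim (¬p refl)
  a-punchIn : ∀ i → a (punchIn j i) ≡ p ⊗ b i
  a-punchIn i with j FinP.≟ punchIn j i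
  ... | yes q  = ⊥-elim (FinP.punchInᵢ≢i j i (sym q))
  ... | no j≢i = cong (λ z → p ⊗ b z) (FinP.punchOut-punchIn j)
  a-nz : a (punchIn j i₀) ≢ 0i
  a-nz q = ⊗-≢0 pivot (proj₂ (proj₁ (proj₂ IH))) (trans (sym (a-punchIn i₀)) q)
  split : ∀ (f : Fin (suc l) → ℤi) → dot f a ≡ f j ⊗ (⊖ dot row0 b) ⊕ p ⊗ dot (λ i → f (punchIn j i)) b
  split f = trans (sum-remove {i = j} (λ i → f i ⊗ a i))
    (cong₂ _⊕_ (cong (f j ⊗_) a-j)
      (trans (dot-cong (λ i → f (punchIn j i)) a-punchIn) (dot-scale (λ i → f (punchIn j i)) p b)))
  lemma₀ : ∀ p s → p ⊗ (⊖ s) ⊕ p ⊗ s ≡ 0i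
  lemma₀ = solve-∀ ℤi-ring
  lemma₁ : ∀ p q s u → q ⊗ (⊖ s) ⊕ p ⊗ u ≡ (⊖ q) ⊗ s ⊕ p ⊗ u
  lemma₁ = solve-∀ ℤi-ring
  lemma₂ : ∀ p q x y → ⊖ q ⊗ x ⊕ p ⊗ y ≡ p ⊗ y ⊕ ⊖ (q ⊗ x)
  lemma₂ = solve-∀ ℤi-ring
  sol : ∀ t → dot (m t) a ≡ 0i
  sol zero  = trans (split (m zero)) (lemma₀ p (dot row0 b))
  sol (suc t) = trans (split (m (suc t))) (trans (lemma₁ p q (dot row0 b) (dot row b)) (trans (sym combine) (proj₂ (proj₂ IH) t)))
    where
    q = m (suc t) j
    row : Fin l → ℤi
    row i = m (suc t) (punchIn j i)
    combine : dot (m′ t) b ≡ (⊖ q) ⊗ dot row0 b ⊕ p ⊗ dot row b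
    combine = begin
      dot (m′ t) b  ≡⟨ dot-comm (m′ t) b ⟩
      dot b (m′ t)  ≡⟨ dot-cong b (λ i → sym (lemma₂ p q (row0 i) (row i))) ⟩
      dot b (λ i → ⊖ q ⊗ row0 i ⊕ p ⊗ row i)  ≡⟨ dot-linear b (⊖ q) row0 (λ i → p ⊗ row i) ⟩
      ⊖ q ⊗ dot b row0 ⊕ dot b (λ i → p ⊗ row i)  ≡⟨ cong₂ (λ u v → ⊖ q ⊗ u ⊕ v) (dot-comm b row0) (trans (dot-scale b p row) (cong (p ⊗_) (dot-comm b row))) ⟩
      ⊖ q ⊗ dot row0 b ⊕ p ⊗ dot row b  ∎
      where open ≡-Reasoning

rank-≤ : ∀ {n k l} {M : Mat n} → RankAtMost M k → RankAtLeast M l → l ≤ k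
rank-≤ {k = k} {l} {M} (B , atMost) (Q , atLeast) with l ℕP.≤? k
... | yes p = p
... | no ¬p with nontrivial-solution (λ t j → dot (B t) (Q j)) (ℕP.≰⇒> ¬p)
... | a , (j , aj≢0) , sol =
  ⊥-elim (aj≢0 (atLeast a (atMost (comb Q a) (λ t → trans (dot-comb (B t) Q a) (sol t))) j))

-- The determinantal rank

sublists-insert : ∀ {A : Set} (xs : List A) {rs r} → rs ∈ sublists xs → r ∈ xs →
  r ∈ rs ⊎ (∃[ as ] ∃[ bs ] (rs ≡ as ++ bs × (as ++ r ∷ bs) ∈ sublists xs))
sublists-insert (x ∷ xs) rs∈ (here refl) with ∈-++⁻ (map (x ∷_) (sublists xs)) rs∈
... | inj₂ rs∈′ = inj₂ ([] , _ , refl , ∈-++⁺ˡ (∈-map⁺ (x ∷_) rs∈′))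
... | inj₁ rs∈′ with ∈-map⁻ (x ∷_) rs∈′
... | _ , _ , refl = inj₁ (here refl)
sublists-insert (x ∷ xs) rs∈ (there r∈) with ∈-++⁻ (map (x ∷_) (sublists xs)) rs∈
... | inj₂ rs∈′ with sublists-insert xs rs∈′ r∈
... | inj₁ p = inj₁ p
... | inj₂ (as , bs , eq , p) = inj₂ (as , bs , eq , ∈-++⁺ʳ (map (x ∷_) (sublists xs)) p)
sublists-insert (x ∷ xs) rs∈ (there r∈) | inj₁ rs∈′ with ∈-map⁻ (x ∷_) rs∈′
... | ys , ys∈ , refl with sublists-insert xs ys∈ r∈
... | inj₁ p = inj₁ (there p)
... | inj₂ (as , bs , eq , p) = inj₂ (x ∷ as , bs , cong (x ∷_) eq , ∈-++⁺ˡ (∈-map⁺ (x ∷_) p))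

[]∈sublists : ∀ {A : Set} (xs : List A) → [] ∈ sublists xs
[]∈sublists []  = here refl
[]∈sublists (x ∷ xs) = ∈-++⁺ʳ (map (x ∷_) (sublists xs)) ([]∈sublists xs)

lookup-split : ∀ {A : Set} (xs : List A) j →
  ∃[ as ] ∃[ bs ] (xs ≡ as ++ lookup xs j ∷ bs × (∀ i → i ≢ j → lookup xs i ∈ as ++ bs))
lookup-split (x ∷ xs) zero  = [] , xs , refl ,
  λ { zero z≢z → ⊥-elim (z≢z refl) ; (suc i) _ → ∈-lookup i }
lookup-split (x ∷ xs) (suc j) with lookup-split xs j
... | as , bs , eq , others = x ∷ as , bs , cong (x ∷_) eq ,
  λ { zero _ → here refl ; (suc i) si≢sj → there (others i (si≢sj ∘ cong suc)) }

module _ {n} (M : Mat n) where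

  minor⇒RankAtLeast : ∀ rs cs → D rs (map (column M) cs) ≢ 0i → RankAtLeast M (length rs)
  minor⇒RankAtLeast rs cs D≢0 = subst (RankAtLeast M) (sym len) (Q , independent)
    where
    len : length rs ≡ length cs
    len = trans (D-length rs _ D≢0) (length-map (column M) cs)
    Q : Fin (length cs) → Vec n
    Q j = unit (lookup cs j)
    independent : ∀ a → (∀ i → (M ∙ comb Q a) i ≡ 0i) → ∀ j → a j ≡ 0i
    independent a Ma≡0 j with lookup-split cs j
    ... | as , bs , eq , others = ⊗-cancelˡ-0 (D rs (column M (lookup cs j) ∷ ys)) front
        (trans (*-comm _ (a j)) (trans (sym pick-j) (trans (sym (D-sum rs x a ys)) (D-vanishing rs w≡0 [] ys))))
      where
      ys = map (column M) as ++ map (column M) bs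
      x : Fin (length cs) → Vec n
      x i = column M (lookup cs i)
      w≡0 : ∀ {r} → r ∈ rs → sum (λ i → a i ⊗ x i r) ≡ 0i
      w≡0 {r} _ = trans (sum-cong-≗ (λ i → trans (*-comm (a i) (x i r)) (cong (_⊗ a i) (sym (dot-unit (M r) (lookup cs i))))))
                        (trans (sym (dot-comb (M r) Q a)) (Ma≡0 r))
      front : D rs (column M (lookup cs j) ∷ ys) ≢ 0i
      front p = D≢0 (trans (cong (D rs) (trans (cong (map (column M)) eq) (map-++ (column M) as (lookup cs j ∷ bs))))
                           (move-back (D rs) (D-alternating-columns rs) (map (column M) as) _ (map (column M) bs) p))
      rest : ∀ i → i ≢ j → D rs (x i ∷ ys) ≡ 0i
      rest i i≢j with ∈-∃++ (subst (x i ∈_) (map-++ (column M) as bs) (∈-map⁺ (column M) (others i i≢j)))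
      ... | us , vs , eq′ = trans (cong (λ zs → D rs (x i ∷ zs)) eq′) (repeated (D rs) (D-alternating-columns rs) us (x i) vs)
      pick-j : sum (λ i → a i ⊗ D rs (x i ∷ ys)) ≡ a j ⊗ D rs (x j ∷ ys)
      pick-j = trans (sum-cong-≗ step) (dot-unit (λ i → a i ⊗ D rs (x i ∷ ys)) j)
        where
        step : ∀ i → a i ⊗ D rs (x i ∷ ys) ≡ a i ⊗ D rs (x i ∷ ys) ⊗ unit j i
        step i with i FinP.≟ j
        ... | yes _  = lemma (a i ⊗ D rs (x i ∷ ys))
          where
          lemma : ∀ z → z ≡ z ⊗ 1i
          lemma = solve-∀ ℤi-ring
        ... | no i≢j = trans (cong (a i ⊗_) (rest i i≢j)) (lemma (a i) (D rs (x i ∷ ys)))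
          where
          lemma : ∀ a z → a ⊗ 0i ≡ a ⊗ z ⊗ 0i
          lemma = solve-∀ ℤi-ring

  bordering⇒RankAtMost : ∀ rs cs → D rs (map (column M) cs) ≢ 0i →
    (∀ r c → D (r ∷ rs) (column M c ∷ map (column M) cs) ≡ 0i) → RankAtMost M (length rs)
  bordering⇒RankAtMost rs cs D≢0 bordered = (λ t → M (lookup rs t)) , λ v vanish r → w≡0 v vanish r
    where
    xs = map (column M) cs
    w≡0 : ∀ v → (∀ t → (M ∙ v) (lookup rs t) ≡ 0i) → ∀ r → (M ∙ v) r ≡ 0i
    w≡0 v vanish r = ⊗-cancelˡ-0 (D rs xs) D≢0 (begin
      D rs xs ⊗ w r  ≡⟨ lemma (D rs xs) (w r) ⟩
      w r ⊗ D rs xs ⊕ ⊖ 0i  ≡⟨ cong (λ z → w r ⊗ D rs xs ⊕ ⊖ z) (sym L≡0) ⟩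
      D (r ∷ rs) (w ∷ xs)  ≡⟨ cong₂ (λ y z → y ⊗ D rs xs ⊕ ⊖ z) w≡w′ (L-cong w-swap r xs) ⟩
      D (r ∷ rs) (w′ ∷ xs)  ≡⟨ D-sum (r ∷ rs) (column M) v xs ⟩
      sum (λ j → v j ⊗ D (r ∷ rs) (column M j ∷ xs))  ≡⟨ sum-0 _ (λ j → trans (cong (v j ⊗_) (bordered r j)) (zeroʳ (v j))) ⟩
      0i  ∎)
      where
      open ≡-Reasoning
      w w′ : Vec n
      w = M ∙ v
      w′ i = sum (λ j → v j ⊗ column M j i)
      w≡w′ : ∀ {i} → w i ≡ w′ i
      w≡w′ {i} = dot-comm (M i) v
      lemma : ∀ a b → a ⊗ b ≡ b ⊗ a ⊕ ⊖ 0i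
      lemma = solve-∀ ℤi-ring
      w-vanish : ∀ {i} → i ∈ rs → w i ≡ 0i
      w-vanish i∈ = subst (λ i → w i ≡ 0i) (sym (lookup-index i∈)) (vanish (Any.index i∈))
      w-swap : ∀ ys → D rs (w ∷ ys) ≡ D rs (w′ ∷ ys)
      w-swap ys = trans (D-vanishing rs w-vanish [] ys) (sym (D-vanishing rs (λ i∈ → trans (sym w≡w′) (w-vanish i∈)) [] ys))
      L≡0 : L (λ ys → D rs (w ∷ ys)) r xs ≡ 0i
      L≡0 = L-zero (D-vanishing rs w-vanish []) r xs

foldr-⊔-∈ : ∀ xs → foldr _⊔_ 0 xs ≡ 0 ⊎ foldr _⊔_ 0 xs ∈ xs
foldr-⊔-∈ []  = inj₁ refl
foldr-⊔-∈ (x ∷ xs) with ℕP.⊔-sel x (foldr _⊔_ 0 xs)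
... | inj₁ eq = inj₂ (here eq)
... | inj₂ eq with foldr-⊔-∈ xs
... | inj₁ eq′ = inj₁ (trans eq eq′)
... | inj₂ p  = inj₂ (there (subst (_∈ xs) (sym eq) p))

foldr-⊔-≤ : ∀ {x} xs → x ∈ xs → x ≤ foldr _⊔_ 0 xs
foldr-⊔-≤ (x ∷ xs) (here refl) = ℕP.m≤m⊔n x _
foldr-⊔-≤ (x ∷ xs) (there p)   = ℕP.≤-trans (foldr-⊔-≤ xs p) (ℕP.m≤n⊔m x _)

module _ {n} (M : Mat n) where

  private
    subs = sublists (allFin n)
    size : List (Fin n) → List (Fin n) → ℕ
    size rs cs = if isZeroᵢ (detᵢ M rs cs) then 0 else length rs

  minor≤rank : ∀ {rs cs} → rs ∈ subs → cs ∈ subs → detᵢ M rs cs ≢ 0i → length rs ≤ rankᵢ M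
  minor≤rank {rs} {cs} rs∈ cs∈ det≢0 = foldr-⊔-≤ _ (∈-concatMap⁺ (λ rs → map (size rs) subs)
    (Any.map (λ { refl → subst (_∈ map (size rs) subs) size≡ (∈-map⁺ (size rs) cs∈) }) rs∈))
    where
    size≡ : size rs cs ≡ length rs
    size≡ = cong (λ b → if b then 0 else length rs) (isZero-≡0 det≢0)

  minor-of-rank : ∃[ rs ] ∃[ cs ] (rs ∈ subs × cs ∈ subs × detᵢ M rs cs ≢ 0i × length rs ≡ rankᵢ M)
  minor-of-rank with foldr-⊔-∈ (concatMap (λ rs → map (size rs) subs) subs)
  ... | inj₁ eq = [] , [] , []∈sublists (allFin n) , []∈sublists (allFin n) , (λ ()) , sym eq
  ... | inj₂ p with find (∈-concatMap⁻ (λ rs → map (size rs) subs) {xs = subs} p)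
  ... | rs , rs∈ , q with ∈-map⁻ (size rs) q
  ... | cs , cs∈ , eq with detᵢ M rs cs ≟0
  ... | no det≢0  = rs , cs , rs∈ , cs∈ , det≢0 , sym (trans eq (cong (λ b → if b then 0 else length rs) (isZero-≡0 det≢0)))
  ... | yes det≡0 = [] , [] , []∈sublists (allFin n) , []∈sublists (allFin n) , (λ ()) ,
                    sym (trans eq (cong (λ z → if isZeroᵢ z then 0 else length rs) det≡0))

  rank-atLeast : RankAtLeast M (rankᵢ M)
  rank-atLeast with minor-of-rank
  ... | rs , cs , rs∈ , cs∈ , det≢0 , eq = subst (RankAtLeast M) eq
    (minor⇒RankAtLeast M rs cs (λ p → det≢0 (trans (det≡D M rs cs) p)))

  rank-atMost : RankAtMost M (rankᵢ M)
  rank-atMost with minor-of-rank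
  ... | rs , cs , rs∈ , cs∈ , det≢0 , eq = subst (RankAtMost M) eq
    (bordering⇒RankAtMost M rs cs (λ p → det≢0 (trans (det≡D M rs cs) p)) bordered)
    where
    bordered : ∀ r c → D (r ∷ rs) (column M c ∷ map (column M) cs) ≡ 0i
    bordered r c with sublists-insert (allFin n) rs∈ (∈-allFin r) | sublists-insert (allFin n) cs∈ (∈-allFin c)
    ... | inj₁ r∈ | _ with ∈-∃++ r∈
    ... | as , bs , refl = repeated (λ rs → D rs (column M c ∷ map (column M) cs)) (D-alternating-rows _) as r bs
    bordered r c | inj₂ _ | inj₁ c∈ with ∈-∃++ (∈-map⁺ (column M) c∈)
    ... | as , bs , eq′ = trans (cong (λ ys → D (r ∷ rs) (column M c ∷ ys)) eq′)
                                (repeated (D (r ∷ rs)) (D-alternating-columns (r ∷ rs)) as (column M c) bs)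
    bordered r c | inj₂ (as , bs , refl , r∈) | inj₂ (as′ , bs′ , refl , c∈) with D (as ++ r ∷ bs) (map (column M) (as′ ++ c ∷ bs′)) ≟0
    ... | yes p = trans (cong (λ ys → D (r ∷ as ++ bs) (column M c ∷ ys)) (map-++ (column M) as′ bs′))
                  (move-front (D (r ∷ as ++ bs)) (D-alternating-columns (r ∷ as ++ bs)) (map (column M) as′) (column M c) (map (column M) bs′)
                  (trans (cong (D (r ∷ as ++ bs)) (sym (map-++ (column M) as′ (c ∷ bs′))))
                  (move-front (λ rs → D rs (map (column M) (as′ ++ c ∷ bs′))) (D-alternating-rows _) as r bs p)))
    ... | no ¬p = ⊥-elim (ℕP.<⇒≱ (ℕP.n<1+n (rankᵢ M)) (subst (_≤ rankᵢ M) len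
                    (minor≤rank r∈ c∈ (λ q → ¬p (trans (sym (det≡D M (as ++ r ∷ bs) (as′ ++ c ∷ bs′))) q)))))
      where
      len : length (as ++ r ∷ bs) ≡ suc (rankᵢ M)
      len = trans (length-++ as) (trans (ℕP.+-suc (length as) (length bs)) (cong suc (trans (sym (length-++ as)) eq)))

open MatrixRank (+ 0) (+ 1) ℤ._+_ ℤ._*_ ℤ.-_ isZeroℤ using () renaming (det to detℤ; rank to rankℤ; altSum to altSumℤ)

fromℤ : ℤ → ℤi
fromℤ a = gi a (+ 0)

module _ {n} (M : Fin n → Fin n → ℤ) (N : Mat n) (M≡N : ∀ u v → fromℤ (M u v) ≡ N u v) where

  fromℤ-⊗ : ∀ a b → fromℤ (a ℤ.* b) ≡ fromℤ a ⊗ fromℤ b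
  fromℤ-⊗ a b = cong-gi (ʳᵉ a b) (ⁱᵐ a b)
    where
    ʳᵉ : ∀ a b → a ℤ.* b ≡ a ℤ.* b ℤ.- + 0 ℤ.* + 0
    ʳᵉ = ℤ-solve-∀
    ⁱᵐ : ∀ a b → + 0 ≡ a ℤ.* + 0 ℤ.+ + 0 ℤ.* b
    ⁱᵐ = ℤ-solve-∀

  fromℤ-altSum : ∀ xs → fromℤ (altSumℤ xs) ≡ altSumᵢ (map fromℤ xs)
  fromℤ-altSum []  = refl
  fromℤ-altSum (x ∷ xs) = cong (λ z → fromℤ x ⊕ ⊖ z) (fromℤ-altSum xs)

  fromℤ-det : ∀ rs cs → fromℤ (detℤ M rs cs) ≡ detᵢ N rs cs
  fromℤ-det []  []  = refl
  fromℤ-det []  (_ ∷ _) = refl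
  fromℤ-det (r ∷ rs) cs  = trans (fromℤ-altSum (map _ (picks cs)))
    (cong altSumᵢ (trans (sym (map-∘ (picks cs)))
      (map-cong (λ { (c , cs′) → trans (fromℤ-⊗ (M r c) _) (cong₂ _⊗_ (M≡N r c) (fromℤ-det rs cs′)) }) (picks cs))))

  isZero-fromℤ : ∀ a → isZeroℤ a ≡ isZeroᵢ (fromℤ a)
  isZero-fromℤ (+ zero)  = refl
  isZero-fromℤ (+ suc _) = refl
  isZero-fromℤ -[1+ _ ]  = refl

  rank-fromℤ : rankℤ M ≡ rankᵢ N
  rank-fromℤ = cong (foldr _⊔_ 0) (concatMap-cong (λ rs → map-cong (λ cs →
    cong (λ b → if b then 0 else length rs) (trans (isZero-fromℤ (detℤ M rs cs)) (cong isZeroᵢ (fromℤ-det rs cs))))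
    (sublists (allFin n))) (sublists (allFin n)))

∙-cong : ∀ {n} {M N : Mat n} → (∀ i j → M i j ≡ N i j) → ∀ v i → (M ∙ v) i ≡ (N ∙ v) i
∙-cong M≗N v i = dot-congˡ v (M≗N i)

RankAtMost-resp : ∀ {n k} {M N : Mat n} → (∀ i j → M i j ≡ N i j) → RankAtMost M k → RankAtMost N k
RankAtMost-resp M≗N (B , atMost) = B , λ v Bv≡0 i → trans (sym (∙-cong M≗N v i)) (atMost v Bv≡0 i)

RankAtLeast-resp : ∀ {n k} {M N : Mat n} → (∀ i j → M i j ≡ N i j) → RankAtLeast M k → RankAtLeast N k
RankAtLeast-resp M≗N (Q , atLeast) = Q , λ a Na≡0 → atLeast a (λ i → trans (∙-cong M≗N (comb Q a) i) (Na≡0 i))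

by-cases : ∀ {n} {P : Fin n → Set} x → P x → (∀ i → i ≢ x → P i) → ∀ i → P i
by-cases {P = P} x Px Pi i with i FinP.≟ x
... | yes i≡x = subst P (sym i≡x) Px
... | no i≢x  = Pi i i≢x

mask : ∀ {n} → Fin n → Vec n → Vec n
mask x v i = if does (i FinP.≟ x) then 0i else v i

mask-self : ∀ {n} (x : Fin n) v → mask x v x ≡ 0i
mask-self x v with x FinP.≟ x
... | yes _ = refl
... | no ¬p = ⊥-elim (¬p refl)

mask-other : ∀ {n} {x : Fin n} {i} v → i ≢ x → mask x v i ≡ v i
mask-other {x = x} {i} v i≢x with i FinP.≟ x
... | yes p = ⊥-elim (i≢x p)
... | no _  = refl

delete : ∀ {n} → Fin n → Mat n → Mat n
delete x M i = mask x (λ j → mask x (λ i → M i j) i)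

delete-row : ∀ {n} (x : Fin n) M j → delete x M x j ≡ 0i
delete-row x M j with j FinP.≟ x
... | yes _ = refl
... | no _  = mask-self x (λ i → M i j)

delete-other : ∀ {n} {x : Fin n} M {i j} → i ≢ x → j ≢ x → delete x M i j ≡ M i j
delete-other M {i} {j} i≢x j≢x = trans (mask-other (λ j → mask _ (λ i → M i j) i) j≢x) (mask-other (λ i → M i j) i≢x)

delete-∙-row : ∀ {n} (x : Fin n) M v → (delete x M ∙ v) x ≡ 0i
delete-∙-row x M v = sum-0 _ (λ j → trans (cong (_⊗ v j) (delete-row x M j)) (zeroˡ (v j)))

delete-∙ : ∀ {n} {x : Fin n} M v {i} → i ≢ x → (delete x M ∙ v) i ≡ (M ∙ mask x v) i
delete-∙ {x = x} M v {i} i≢x = sum-cong-≗ step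
  where
  step : ∀ j → delete x M i j ⊗ v j ≡ M i j ⊗ mask x v j
  step j with j FinP.≟ x
  ... | yes _ = trans (zeroˡ (v j)) (sym (zeroʳ (M i j)))
  ... | no _  = cong (_⊗ v j) (mask-other (λ i → M i j) i≢x)

mask-id : ∀ {n} {x : Fin n} {v} → v x ≡ 0i → ∀ i → mask x v i ≡ v i
mask-id {x = x} {v} vx≡0 i with i FinP.≟ x
... | yes refl = sym vx≡0
... | no _  = refl

delete-∙-id : ∀ {n} {x : Fin n} M {v} → v x ≡ 0i → ∀ {i} → i ≢ x → (delete x M ∙ v) i ≡ (M ∙ v) i
delete-∙-id M vx≡0 {i} i≢x = trans (delete-∙ M _ i≢x) (dot-cong (M i) (mask-id vx≡0))

RankAtMost-undelete : ∀ {n k} (M : Mat n) x → RankAtMost (delete x M) k → RankAtMost M (suc (suc k))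
RankAtMost-undelete {n} {k} M x (B , atMost) = B′ , kernel
  where
  B′ : Fin (suc (suc k)) → Vec n
  B′ zero  = unit x
  B′ (suc zero)  = M x
  B′ (suc (suc t)) = B t
  kernel : ∀ v → (∀ t → dot (B′ t) v ≡ 0i) → ∀ i → (M ∙ v) i ≡ 0i
  kernel v B′v≡0 = by-cases x (B′v≡0 (suc zero)) λ i i≢x →
    trans (sym (delete-∙-id M vx≡0 i≢x)) (atMost v (λ t → B′v≡0 (suc (suc t))) i)
    where
    vx≡0 : v x ≡ 0i
    vx≡0 = trans (sym (dot-unit v x)) (trans (dot-comm v (unit x)) (B′v≡0 zero))

mask-comb : ∀ {n k} (x : Fin n) (Q : Fin k → Vec n) a i → comb (mask x ∘ Q) a i ≡ mask x (comb Q a) i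
mask-comb x Q a i with i FinP.≟ x
... | yes _ = sum-0 _ (λ j → zeroʳ (a j))
... | no _  = refl

masked-independent : ∀ {n k} (M : Mat n) x ((Q , _) : RankAtLeast (delete x M) k) a →
                     (∀ i → i ≢ x → (M ∙ comb (mask x ∘ Q) a) i ≡ 0i) → ∀ j → a j ≡ 0i
masked-independent M x (Q , atLeast) a Ma≡0 = atLeast a kernel
  where
  kernel : ∀ i → (delete x M ∙ comb Q a) i ≡ 0i
  kernel = by-cases x (delete-∙-row x M (comb Q a)) λ i i≢x → trans (delete-∙ M (comb Q a) i≢x) (trans (dot-cong (M i) (λ j → sym (mask-comb x Q a j))) (Ma≡0 i i≢x))

RankAtLeast-undelete : ∀ {n k} (M : Mat n) x → RankAtLeast (delete x M) k → RankAtLeast M k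
RankAtLeast-undelete M x atLeast@(Q , _) = mask x ∘ Q , λ a Ma≡0 → masked-independent M x atLeast a (λ i _ → Ma≡0 i)

kernel-vector : ∀ {n k} (M : Mat n) x → RankAtLeast (delete x M) k → RankAtMost M k →
                ∃[ z ] ((∀ i → (M ∙ z) i ≡ 0i) × z x ≢ 0i)
kernel-vector {n} {k} M x atLeast@(Q , _) (B , atMost) =
  comb Q′ a , Mz≡0 , λ zx≡0 → proj₂ nz (a≡0 (trans (sym z-x) zx≡0) (proj₁ nz))
  where
  Q′ : Fin (suc k) → Vec n
  Q′ zero  = unit x
  Q′ (suc j) = mask x (Q j)
  solution = nontrivial-solution (λ t j → dot (B t) (Q′ j)) (ℕP.n<1+n k)
  a  = proj₁ solution
  nz = proj₁ (proj₂ solution)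
  Mz≡0 : ∀ i → (M ∙ comb Q′ a) i ≡ 0i
  Mz≡0 = atMost (comb Q′ a) (λ t → trans (dot-comb (B t) Q′ a) (proj₂ (proj₂ solution) t))
  lemma : ∀ a → a ⊗ 1i ⊕ 0i ≡ a
  lemma = solve-∀ ℤi-ring
  z-x : comb Q′ a x ≡ a zero
  z-x = trans (cong₂ (λ u v → a zero ⊗ u ⊕ v) (unit-refl x)
                (sum-0 (λ j → a (suc j) ⊗ mask x (Q j) x) (λ j → trans (cong (a (suc j) ⊗_) (mask-self x (Q j))) (zeroʳ (a (suc j))))))
              (lemma (a zero))
  a≡0 : a zero ≡ 0i → ∀ j → a j ≡ 0i
  a≡0 a₀≡0 zero  = a₀≡0
  a≡0 a₀≡0 (suc j) = masked-independent M x atLeast (a ∘ suc) (λ i _ → trans (dot-cong (M i) drop) (Mz≡0 i)) j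
    where
    lemma′ : ∀ u v → v ≡ 0i ⊗ u ⊕ v
    lemma′ = solve-∀ ℤi-ring
    drop : ∀ i → comb (mask x ∘ Q) (a ∘ suc) i ≡ comb Q′ a i
    drop i = trans (lemma′ (unit x i) _) (cong (λ z → z ⊗ unit x i ⊕ comb (mask x ∘ Q) (a ∘ suc) i) (sym a₀≡0))

Hermitian : ∀ {n} → Mat n → Set
Hermitian M = ∀ i j → M j i ≡ conj (M i j)

conj-sum : ∀ {n} (f : Fin n → ℤi) → conj (sum f) ≡ sum (conj ∘ f)
conj-sum {zero}  f = refl
conj-sum {suc n} f = trans (conj-⊕ (f zero) _) (cong (conj (f zero) ⊕_) (conj-sum (f ∘ suc)))

adjoint : ∀ {n} {M : Mat n} → Hermitian M → ∀ y v → dot (conj ∘ y) (M ∙ v) ≡ dot (conj ∘ (M ∙ y)) v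
adjoint {M = M} herm y v = begin
  sum (λ i → conj (y i) ⊗ sum (λ j → M i j ⊗ v j))  ≡⟨ sum-cong-≗ (λ i → *-distribˡ-sum (conj (y i)) (λ j → M i j ⊗ v j)) ⟩
  sum (λ i → sum (λ j → conj (y i) ⊗ (M i j ⊗ v j)))  ≡⟨ ∑-comm (λ i j → conj (y i) ⊗ (M i j ⊗ v j)) ⟩
  sum (λ j → sum (λ i → conj (y i) ⊗ (M i j ⊗ v j)))  ≡⟨ sum-cong-≗ (λ j → trans (sum-cong-≗ (step j)) (sym (*-distribʳ-sum (v j) (λ i → conj (M j i ⊗ y i))))) ⟩
  sum (λ j → sum (λ i → conj (M j i ⊗ y i)) ⊗ v j)  ≡⟨ sum-cong-≗ (λ j → cong (_⊗ v j) (sym (conj-sum (λ i → M j i ⊗ y i)))) ⟩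
  dot (conj ∘ (M ∙ y)) v  ∎
  where
  open ≡-Reasoning
  lemma : ∀ y m v → y ⊗ (m ⊗ v) ≡ m ⊗ y ⊗ v
  lemma = solve-∀ ℤi-ring
  step : ∀ j i → conj (y i) ⊗ (M i j ⊗ v j) ≡ conj (M j i ⊗ y i) ⊗ v j
  step j i = trans (lemma (conj (y i)) (M i j) (v j))
    (cong (_⊗ v j) (trans (cong (_⊗ conj (y i)) (herm j i)) (sym (conj-⊗ (M j i) (y i)))))

dot-supported : ∀ {n} {x : Fin n} b v → (∀ i → i ≢ x → v i ≡ 0i) → dot b v ≡ b x ⊗ v x
dot-supported {x = x} b v supp = trans (dot-cong b step) (trans (dot-scale b (v x) (unit x)) (trans (cong (v x ⊗_) (dot-unit b x)) (*-comm (v x) (b x))))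
  where
  step : ∀ i → v i ≡ v x ⊗ unit x i
  step i with i FinP.≟ x
  ... | yes refl = lemma (v i)
    where
    lemma : ∀ a → a ≡ a ⊗ 1i
    lemma = solve-∀ ℤi-ring
  ... | no i≢x   = trans (supp i i≢x) (sym (zeroʳ (v x)))

RankAtMost-kernel : ∀ {n k} {M : Mat n} → Hermitian M → ∀ x y → (∀ i → (M ∙ y) i ≡ 0i) → y x ≢ 0i →
                    RankAtMost (delete x M) k → RankAtMost M k
RankAtMost-kernel {n} {k} {M} herm x y My≡0 yx≢0 (B , atMost) = B′ , kernel
  where
  B′ : Fin k → Vec n
  B′ t i = y x ⊗ B t i ⊕ ⊖ dot (B t) y ⊗ unit x i
  kernel : ∀ v → (∀ t → dot (B′ t) v ≡ 0i) → ∀ i → (M ∙ v) i ≡ 0i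
  kernel v B′v≡0 i = ⊗-cancelˡ-0 (y x) yx≢0 (trans (sym Mv′) Mv′≡0)
    where
    v′ : Vec n
    v′ i = y x ⊗ v i ⊕ ⊖ v x ⊗ y i
    lemma₁ : ∀ a b → a ⊗ b ⊕ ⊖ b ⊗ a ≡ 0i
    lemma₁ = solve-∀ ℤi-ring
    lemma₂ : ∀ a p q v → a ⊗ p ⊕ ⊖ v ⊗ q ≡ a ⊗ p ⊕ ⊖ q ⊗ v
    lemma₂ = solve-∀ ℤi-ring
    lemma₃ : ∀ a p v → a ⊗ p ⊕ ⊖ v ⊗ 0i ≡ a ⊗ p
    lemma₃ = solve-∀ ℤi-ring
    v′x≡0 : v′ x ≡ 0i
    v′x≡0 = lemma₁ (y x) (v x)
    dot-v′ : ∀ b → dot b v′ ≡ y x ⊗ dot b v ⊕ ⊖ v x ⊗ dot b y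
    dot-v′ b = trans (dot-linear b (y x) v (λ i → ⊖ v x ⊗ y i)) (cong (y x ⊗ dot b v ⊕_) (dot-scale b (⊖ v x) y))
    Bv′≡0 : ∀ t → dot (B t) v′ ≡ 0i
    Bv′≡0 t = begin
      dot (B t) v′  ≡⟨ dot-v′ (B t) ⟩
      y x ⊗ dot (B t) v ⊕ ⊖ v x ⊗ dot (B t) y  ≡⟨ lemma₂ (y x) _ (dot (B t) y) (v x) ⟩
      y x ⊗ dot (B t) v ⊕ ⊖ dot (B t) y ⊗ v x  ≡⟨ cong₂ (λ p q → y x ⊗ p ⊕ ⊖ dot (B t) y ⊗ q) (dot-comm (B t) v) (sym (dot-unit v x)) ⟩
      y x ⊗ dot v (B t) ⊕ ⊖ dot (B t) y ⊗ dot v (unit x)  ≡⟨ cong (y x ⊗ dot v (B t) ⊕_) (sym (dot-scale v (⊖ dot (B t) y) (unit x))) ⟩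
      y x ⊗ dot v (B t) ⊕ dot v (λ i → ⊖ dot (B t) y ⊗ unit x i)  ≡⟨ sym (dot-linear v (y x) (B t) (λ i → ⊖ dot (B t) y ⊗ unit x i)) ⟩
      dot v (B′ t)  ≡⟨ dot-comm v (B′ t) ⟩
      dot (B′ t) v  ≡⟨ B′v≡0 t ⟩
      0i  ∎
      where open ≡-Reasoning
    off-x : ∀ i → i ≢ x → (M ∙ v′) i ≡ 0i
    off-x i i≢x = trans (sym (delete-∙-id M v′x≡0 i≢x)) (atMost v′ Bv′≡0 i)
    at-x : (M ∙ v′) x ≡ 0i
    at-x = ⊗-cancelˡ-0 (conj (y x)) (conj-≢0 yx≢0) (trans (sym (dot-supported (conj ∘ y) (M ∙ v′) off-x))
      (trans (adjoint herm y v′) (sum-0 _ (λ j → trans (cong (λ z → conj z ⊗ v′ j) (My≡0 j)) (zeroˡ (v′ j))))))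
    Mv′≡0 : (M ∙ v′) i ≡ 0i
    Mv′≡0 = by-cases x at-x off-x i
    Mv′ : (M ∙ v′) i ≡ y x ⊗ (M ∙ v) i
    Mv′ = trans (dot-v′ (M i)) (trans (cong (λ z → y x ⊗ (M ∙ v) i ⊕ ⊖ v x ⊗ z) (My≡0 i)) (lemma₃ (y x) ((M ∙ v) i) (v x)))

RankAtLeast-undelete-2 : ∀ {n k} {M : Mat n} → Hermitian M → ∀ x y → (∀ i → i ≢ x → (M ∙ y) i ≡ 0i) → (M ∙ y) x ≢ 0i →
                         y x ≡ 0i → RankAtLeast (delete x M) k → RankAtLeast M (suc (suc k))
RankAtLeast-undelete-2 {n} {k} {M} herm x y My≡0 Myx≢0 yx≡0 atLeast@(Q , _) = Q′ , independent
  where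
  Q′ : Fin (suc (suc k)) → Vec n
  Q′ zero  = unit x
  Q′ (suc zero)  = y
  Q′ (suc (suc j)) = mask x (Q j)
  independent : ∀ a → (∀ i → (M ∙ comb Q′ a) i ≡ 0i) → ∀ j → a j ≡ 0i
  independent a MV≡0 = λ { zero → a₀≡0 ; (suc zero) → a₁≡0 ; (suc (suc j)) → rest j }
    where
    a₂ : Fin k → ℤi
    a₂ j = a (suc (suc j))
    V W : Vec n
    V = comb Q′ a
    W = comb (mask x ∘ Q) a₂
    p₀ = (M ∙ y) x
    lemma₀ : ∀ a b → a ⊗ 1i ⊕ (b ⊗ 0i ⊕ 0i) ≡ a
    lemma₀ = solve-∀ ℤi-ring
    lemma₁ : ∀ u w → 0i ⊗ u ⊕ w ≡ w
    lemma₁ = solve-∀ ℤi-ring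
    lemma₂ : ∀ a w → a ⊗ 0i ⊕ w ≡ w
    lemma₂ = solve-∀ ℤi-ring
    Wx≡0 : W x ≡ 0i
    Wx≡0 = trans (mask-comb x Q a₂ x) (mask-self x (comb Q a₂))
    Vx≡0 : V x ≡ 0i
    Vx≡0 = ⊗-cancelˡ-0 (conj p₀) (conj-≢0 Myx≢0) (begin
      conj p₀ ⊗ V x  ≡⟨ *-comm (conj p₀) (V x) ⟩
      V x ⊗ conj p₀  ≡⟨ sym (dot-supported V (conj ∘ (M ∙ y)) (λ i i≢x → cong conj (My≡0 i i≢x))) ⟩
      dot V (conj ∘ (M ∙ y))  ≡⟨ dot-comm V (conj ∘ (M ∙ y)) ⟩
      dot (conj ∘ (M ∙ y)) V  ≡⟨ sym (adjoint herm y V) ⟩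
      dot (conj ∘ y) (M ∙ V)  ≡⟨ sum-0 _ (λ i → trans (cong (conj (y i) ⊗_) (MV≡0 i)) (zeroʳ (conj (y i)))) ⟩
      0i  ∎)
      where open ≡-Reasoning
    a₀≡0 : a zero ≡ 0i
    a₀≡0 = trans (sym (lemma₀ (a zero) (a (suc zero))))
      (trans (cong₂ (λ p q → a zero ⊗ p ⊕ q) (sym (unit-refl x)) (cong₂ (λ p q → a (suc zero) ⊗ p ⊕ q) (sym yx≡0) (sym Wx≡0))) Vx≡0)
    MV : ∀ i → (M ∙ V) i ≡ a (suc zero) ⊗ (M ∙ y) i ⊕ (M ∙ W) i
    MV i = trans (dot-cong (M i) {V} {λ j → a (suc zero) ⊗ y j ⊕ W j}
                   (λ j → trans (cong (λ z → z ⊗ unit x j ⊕ (a (suc zero) ⊗ y j ⊕ W j)) a₀≡0) (lemma₁ (unit x j) _)))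
                 (dot-linear (M i) (a (suc zero)) y W)
    rest : ∀ j → a (suc (suc j)) ≡ 0i
    rest = masked-independent M x atLeast a₂ λ i i≢x →
      trans (sym (lemma₂ (a (suc zero)) _)) (trans (cong (λ z → a (suc zero) ⊗ z ⊕ (M ∙ W) i) (sym (My≡0 i i≢x))) (trans (sym (MV i)) (MV≡0 i)))
    a₁≡0 : a (suc zero) ≡ 0i
    a₁≡0 = ⊗-cancelˡ-0 p₀ Myx≢0 (begin
      p₀ ⊗ a (suc zero)  ≡⟨ lemma₃ p₀ (a (suc zero)) ⟩
      a (suc zero) ⊗ p₀ ⊕ 0i  ≡⟨ cong (a (suc zero) ⊗ p₀ ⊕_) (sym MWx≡0) ⟩
      a (suc zero) ⊗ (M ∙ y) x ⊕ (M ∙ W) x  ≡⟨ sym (MV x) ⟩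
      (M ∙ V) x  ≡⟨ MV≡0 x ⟩
      0i  ∎)
      where
      open ≡-Reasoning
      lemma₃ : ∀ p q → p ⊗ q ≡ q ⊗ p ⊕ 0i
      lemma₃ = solve-∀ ℤi-ring
      MWx≡0 : (M ∙ W) x ≡ 0i
      MWx≡0 = sum-0 _ (λ j → trans (cong (M x j ⊗_) (sum-0 (λ t → a (suc (suc t)) ⊗ mask x (Q t) j) (λ t → trans (cong (_⊗ mask x (Q t) j) (rest t)) (zeroˡ (mask x (Q t) j))))) (zeroʳ (M x j)))

infix 4 _∈?_
_∈?_ : ∀ {n} (x : Fin n) xs → Dec (x ∈ xs)
_∈?_ = DecMembership._∈?_ FinP._≟_

∧-true⁻ : ∀ {a b} → a ∧ b ≡ true → a ≡ true × b ≡ true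
∧-true⁻ {true} {true} _ = refl , refl

∧-true⁺ : ∀ {a b} → a ≡ true → b ≡ true → a ∧ b ≡ true
∧-true⁺ refl refl = refl

∨-true⁻ : ∀ {a b} → a ∨ b ≡ true → a ≡ true ⊎ b ≡ true
∨-true⁻ {true}  _ = inj₁ refl
∨-true⁻ {false} p = inj₂ p

Bool-≡ : ∀ {a b} → (a ≡ true → b ≡ true) → (b ≡ true → a ≡ true) → a ≡ b
Bool-≡ {true}  {true}  f g = refl
Bool-≡ {true}  {false} f g = sym (f refl)
Bool-≡ {false} {true}  f g = g refl
Bool-≡ {false} {false} f g = refl

true≢false : ∀ {b} → b ≡ true → b ≡ false → ⊥
true≢false refl ()

not-true⁺ : ∀ {b} → ¬ (b ≡ true) → not b ≡ true
not-true⁺ {true}  ¬b = ⊥-elim (¬b refl)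
not-true⁺ {false} ¬b = refl

not-true⁻ : ∀ {b} → not b ≡ true → ¬ (b ≡ true)
not-true⁻ p refl = case p
  where
  case : false ≡ true → ⊥
  case ()

does-≟⁻ : ∀ {n} {u v : Fin n} → does (u FinP.≟ v) ≡ true → u ≡ v
does-≟⁻ {u = u} {v} p with u FinP.≟ v
... | yes eq = eq

<ᵇ-true⁻ : ∀ {a b} → (a <ᵇ b) ≡ true → a < b
<ᵇ-true⁻ {a} {b} p = ℕP.<ᵇ⇒< a b (subst T (sym p) _)

<ᵇ-true⁺ : ∀ {a b} → a < b → (a <ᵇ b) ≡ true
<ᵇ-true⁺ {a} {b} a<b with a <ᵇ b in eq
... | true  = refl
... | false = ⊥-elim (subst T eq (ℕP.<⇒<ᵇ a<b))

any-true⁻ : ∀ {A : Set} (p : A → Bool) xs → any p xs ≡ true → ∃[ x ] p x ≡ true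
any-true⁻ p (x ∷ xs) q with ∨-true⁻ {p x} q
... | inj₁ px = x , px
... | inj₂ q′ = any-true⁻ p xs q′

any-true⁺ : ∀ {A : Set} (p : A → Bool) {xs x} → x ∈ xs → p x ≡ true → any p xs ≡ true
any-true⁺ p {x ∷ xs} (here refl) px = cong (_∨ any p xs) px
any-true⁺ p {x ∷ xs} (there x∈)  py = trans (cong (p x ∨_) (any-true⁺ p x∈ py)) (∨-zeroʳ (p x))

module _ {A : Set} where

  count : (A → Bool) → List A → ℕ
  count p = foldr (λ x k → if p x then suc k else k) 0

  count-cong : ∀ {p q : A → Bool} xs → (∀ {x} → x ∈ xs → p x ≡ q x) → count p xs ≡ count q xs
  count-cong []  p≗q = refl
  count-cong (x ∷ xs) p≗q = cong₂ (λ b k → if b then suc k else k) (p≗q (here refl)) (count-cong xs (p≗q ∘ there))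

  count-flip : ∀ {p q : A → Bool} {x xs} → Unique xs → x ∈ xs → p x ≡ true → q x ≡ false →
               (∀ y → y ≢ x → p y ≡ q y) → count p xs ≡ suc (count q xs)
  count-flip {xs = x ∷ xs} (x∉ ∷ _) (here refl) px qx p≗q rewrite px | qx =
    cong suc (count-cong xs (λ {y} y∈ → p≗q y (λ { refl → All¬⇒¬Any x∉ y∈ })))
  count-flip {p} {q} {xs = y ∷ xs} (y∉ ∷ u) (there x∈) px qx p≗q
    rewrite p≗q y (λ { refl → All¬⇒¬Any y∉ x∈ }) with q y
  ... | true  = cong suc (count-flip u x∈ px qx p≗q)
  ... | false = count-flip u x∈ px qx p≗q

  sum-flip : ∀ {f g : A → ℕ} {x xs} → Unique xs → x ∈ xs → f x ≡ suc (g x) →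
             (∀ y → y ≢ x → f y ≡ g y) → foldr _+_ 0 (map f xs) ≡ suc (foldr _+_ 0 (map g xs))
  sum-flip {f} {g} {xs = x ∷ xs} (x∉ ∷ _) (here refl) fx f≗g = cong₂ _+_ fx (rest x∉)
    where
    rest : ∀ {ys} → All (x ≢_) ys → foldr _+_ 0 (map f ys) ≡ foldr _+_ 0 (map g ys)
    rest []  = refl
    rest (x≢y ∷ x∉ys) = cong₂ _+_ (f≗g _ (x≢y ∘ sym)) (rest x∉ys)
  sum-flip {f} {g} {xs = y ∷ xs} (y∉ ∷ u) (there x∈) fx f≗g =
    trans (cong₂ _+_ (f≗g y (λ { refl → All¬⇒¬Any y∉ x∈ })) (sum-flip u x∈ fx f≗g)) (ℕP.+-suc (g y) _)

  count-false : ∀ xs → count (λ (_ : A) → false) xs ≡ 0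
  count-false []  = refl
  count-false (_ ∷ xs) = count-false xs

  count-true : ∀ xs → count (λ (_ : A) → true) xs ≡ length xs
  count-true []  = refl
  count-true (_ ∷ xs) = cong suc (count-true xs)

  count-∃ : ∀ (p : A → Bool) xs → count p xs ≢ 0 → ∃[ x ] p x ≡ true
  count-∃ p []  c≢0 = ⊥-elim (c≢0 refl)
  count-∃ p (x ∷ xs) c≢0 with p x in px
  ... | true  = x , px
  ... | false = count-∃ p xs c≢0

module _ {n : ℕ} where

  countFin-flip : ∀ {p q : Fin n → Bool} x → p x ≡ true → q x ≡ false → (∀ y → y ≢ x → p y ≡ q y) →
                  countFin p ≡ suc (countFin q)
  countFin-flip x = count-flip (allFin-unique n) (∈-allFin x)

  countFin-cong : ∀ {p q : Fin n → Bool} → (∀ x → p x ≡ q x) → countFin p ≡ countFin q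
  countFin-cong p≗q = count-cong (allFin n) (λ {x} _ → p≗q x)

  infixl 5 _∖_
  _∖_ : VSet n → Fin n → VSet n
  (S ∖ x) v = S v ∧ not (does (v FinP.≟ x))

  ∖-self : ∀ (S : VSet n) x → (S ∖ x) x ≡ false
  ∖-self S x rewrite dec-true (x FinP.≟ x) refl = ∧-zeroʳ (S x)

  ∖-other : ∀ (S : VSet n) {x v} → v ≢ x → (S ∖ x) v ≡ S v
  ∖-other S {x} {v} v≢x rewrite dec-false (v FinP.≟ x) v≢x = ∧-identityʳ (S v)

  countFin-∖ : ∀ (p : VSet n) x → p x ≡ true → countFin p ≡ suc (countFin (p ∖ x))
  countFin-∖ p x px = countFin-flip x px (∖-self p x) (λ y y≢x → sym (∖-other p y≢x))

  countFin-1⁺ : ∀ (p : Fin n → Bool) x → p x ≡ true → (∀ y → p y ≡ true → y ≡ x) → countFin p ≡ 1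
  countFin-1⁺ p x px unique = trans (countFin-flip x px refl (λ y y≢x → ¬-not (λ py → y≢x (unique y py))))
                                    (cong suc (count-false (allFin n)))

  countFin-1⁻ : ∀ (p : Fin n → Bool) → countFin p ≡ 1 → ∃[ x ] (p x ≡ true × (∀ y → p y ≡ true → y ≡ x))
  countFin-1⁻ p c≡1 with count-∃ p (allFin n) (λ c≡0 → case (trans (sym c≡0) c≡1))
    where
    case : 0 ≡ 1 → ⊥
    case ()
  ... | x , px = x , px , unique
    where
    unique : ∀ y → p y ≡ true → y ≡ x
    unique y py with y FinP.≟ x
    ... | yes y≡x = y≡x
    ... | no y≢x  = ⊥-elim (absurd (trans (sym c≡1) (trans (countFin-∖ p x px)
                      (cong suc (countFin-∖ (p ∖ x) y (trans (∖-other p y≢x) py))))))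
      where
      absurd : ∀ {k} → 1 ≡ suc (suc k) → ⊥
      absurd ()

lookup-injective : ∀ {A : Set} {xs : List A} → Unique xs → ∀ i j → lookup xs i ≡ lookup xs j → i ≡ j
lookup-injective (x∉ ∷ u) zero  zero  eq = refl
lookup-injective (x∉ ∷ u) zero  (suc j) eq = ⊥-elim (All.lookup x∉ (∈-lookup j) eq)
lookup-injective (x∉ ∷ u) (suc i) zero  eq = ⊥-elim (All.lookup x∉ (∈-lookup i) (sym eq))
lookup-injective (x∉ ∷ u) (suc i) (suc j) eq = cong suc (lookup-injective u i j eq)

-- Connectivity

module _ {n} (G : MixedGraph n) where

  Adj-sym : ∀ {u v} → Adj G u v → Adj G v u
  Adj-sym {u} {v} uv = trans (cong (not ∘ isO) (herm G u v)) (trans (conj-isO (h G u v)) uv)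
    where
    conj-isO : ∀ l → not (isO (conjLab l)) ≡ not (isO l)
    conj-isO o  = refl
    conj-isO e  = refl
    conj-isO ar = refl
    conj-isO ra = refl

  Adj-irrefl : ∀ {v} → ¬ Adj G v v
  Adj-irrefl {v} vv = true≢false vv (cong (not ∘ isO) (loopless G v))

  Adj⇒≢ : ∀ {u v} → Adj G u v → u ≢ v
  Adj⇒≢ uv refl = Adj-irrefl uv

  Conn : Fin n → Fin n → Set
  Conn = Star (Adj G)

  Conn-sym : ∀ {u v} → Conn u v → Conn v u
  Conn-sym = Star.reverse Adj-sym

  infixr 5 _∷_
  data Chain : Fin n → List (Fin n) → Fin n → Set where
    []  : ∀ {u} → Chain u [] u
    _∷_ : ∀ {u w v xs} → Adj G u w → Chain w xs v → Chain u (w ∷ xs) v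

  Chain-suffix : ∀ {u w xs v} → u ∈ w ∷ xs → Chain w xs v → Unique (w ∷ xs) → ∃[ ys ] (Chain u ys v × Unique (u ∷ ys))
  Chain-suffix (here refl) c  uniq  = _ , c , uniq
  Chain-suffix (there u∈)  (_ ∷ c) (_ ∷ uniq) = Chain-suffix u∈ c uniq

  Conn⇒Chain : ∀ {u v} → Conn u v → ∃[ xs ] (Chain u xs v × Unique (u ∷ xs))
  Conn⇒Chain ε = [] , [] , [] ∷ []
  Conn⇒Chain {u} (_◅_ {j = w} uw c) with Conn⇒Chain c
  ... | xs , chain , uniq with u ∈? w ∷ xs
  ... | yes u∈ = Chain-suffix u∈ chain uniq
  ... | no u∉  = w ∷ xs , uw ∷ chain , ¬Any⇒All¬ (w ∷ xs) u∉ ∷ uniq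

  Unique-length : ∀ {xs : List (Fin n)} → Unique xs → length xs ≤ n
  Unique-length {xs} uniq = FinP.injective⇒≤ {f = lookup xs} (lookup-injective uniq _ _)

  reachK⇒Conn : ∀ k {u v} → reachK G k u v ≡ true → Conn u v
  reachK⇒Conn zero  {u} p = subst (Conn u) (does-≟⁻ {u = u} p) ε
  reachK⇒Conn (suc k) {u} {v} p with ∨-true⁻ {reachK G k u v} p
  ... | inj₁ q = reachK⇒Conn k q
  ... | inj₂ q with any-true⁻ (λ w → reachK G k u w ∧ adjB G w v) (allFin n) q
  ... | w , q′ = reachK⇒Conn k (proj₁ (∧-true⁻ q′)) ◅◅ (proj₂ (∧-true⁻ {reachK G k u w} q′) ◅ ε)

  reachK-suc : ∀ k {u v} → reachK G k u v ≡ true → reachK G (suc k) u v ≡ true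
  reachK-suc k {u} {v} p = cong (_∨ any (λ w → reachK G k u w ∧ adjB G w v) (allFin n)) p

  reachK-step : ∀ k {u w v} → reachK G k u w ≡ true → Adj G w v → reachK G (suc k) u v ≡ true
  reachK-step k {u} {w} {v} p wv = trans
    (cong (reachK G k u v ∨_) (any-true⁺ (λ w → reachK G k u w ∧ adjB G w v) (∈-allFin w) (∧-true⁺ p wv)))
    (∨-zeroʳ (reachK G k u v))

  reachK-cons : ∀ k {u w v} → Adj G u w → reachK G k w v ≡ true → reachK G (suc k) u v ≡ true
  reachK-cons zero  {u} {w} uw p = reachK-step 0 {u} (dec-true (u FinP.≟ u) refl) (subst (Adj G u) (does-≟⁻ {u = w} p) uw)
  reachK-cons (suc k) {u} {w} {v} uw p with ∨-true⁻ {reachK G k w v} p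
  ... | inj₁ q = reachK-suc (suc k) (reachK-cons k uw q)
  ... | inj₂ q with any-true⁻ (λ x → reachK G k w x ∧ adjB G x v) (allFin n) q
  ... | x , q′ = reachK-step (suc k) (reachK-cons k uw (proj₁ (∧-true⁻ q′))) (proj₂ (∧-true⁻ {reachK G k w x} q′))

  Chain⇒reachK : ∀ {u xs v} → Chain u xs v → reachK G (length xs) u v ≡ true
  Chain⇒reachK {u} []  = dec-true (u FinP.≟ u) refl
  Chain⇒reachK {u} {_ ∷ xs} (uw ∷ c) = reachK-cons (length xs) {u} uw (Chain⇒reachK c)

  reachK-≤ : ∀ {k l} → k ≤ l → ∀ {u v} → reachK G k u v ≡ true → reachK G l u v ≡ true
  reachK-≤ {k} {l} k≤l p = go (ℕP.≤⇒≤′ k≤l)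
    where
    go : ∀ {l} → k ≤′ l → reachK G l _ _ ≡ true
    go ≤′-refl  = p
    go (≤′-step {l} k≤′l) = reachK-suc l (go k≤′l)

  reach⇒Conn : ∀ {u v} → reach G u v ≡ true → Conn u v
  reach⇒Conn = reachK⇒Conn n

  Conn⇒reach : ∀ {u v} → Conn u v → reach G u v ≡ true
  Conn⇒reach c with Conn⇒Chain c
  ... | xs , chain , uniq = reachK-≤ (ℕP.≤-trans (ℕP.n≤1+n (length xs)) (Unique-length uniq)) (Chain⇒reachK chain)

  Conn? : ∀ u v → Dec (Conn u v)
  Conn? u v with reach G u v in eq
  ... | true  = yes (reach⇒Conn eq)
  ... | false = no (λ c → true≢false (Conn⇒reach c) eq)

  leastB : Fin n → Bool
  leastB v = not (any (λ u → (toℕ u <ᵇ toℕ v) ∧ reach G u v) (allFin n))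

  leastB⁺ : ∀ {v} → (∀ u → toℕ u < toℕ v → ¬ Conn u v) → leastB v ≡ true
  leastB⁺ {v} least = not-true⁺ case
    where
    case : any (λ u → (toℕ u <ᵇ toℕ v) ∧ reach G u v) (allFin n) ≡ true → ⊥
    case p with any-true⁻ (λ u → (toℕ u <ᵇ toℕ v) ∧ reach G u v) (allFin n) p
    ... | u , q = least u (<ᵇ-true⁻ (proj₁ (∧-true⁻ q))) (reach⇒Conn (proj₂ (∧-true⁻ {toℕ u <ᵇ toℕ v} q)))

  leastB⁻ : ∀ {v} → leastB v ≡ true → ∀ u → toℕ u < toℕ v → ¬ Conn u v
  leastB⁻ {v} p u u<v c = not-true⁻ p (any-true⁺ (λ u → (toℕ u <ᵇ toℕ v) ∧ reach G u v) (∈-allFin u)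
                                     (∧-true⁺ (<ᵇ-true⁺ u<v) (Conn⇒reach c)))

  least-of-component : ∀ v → ∃[ m ] (Conn m v × leastB m ≡ true)
  least-of-component v = go v ε (<-wellFounded (toℕ v))
    where
    go : ∀ u → Conn u v → Acc _<_ (toℕ u) → ∃[ m ] (Conn m v × leastB m ≡ true)
    go u c (acc rec) with leastB u in eq
    ... | true  = u , c , eq
    ... | false with any-true⁻ (λ w → (toℕ w <ᵇ toℕ u) ∧ reach G w u) (allFin n) (not-false eq)
      where
      not-false : ∀ {b} → not b ≡ false → b ≡ true
      not-false {true} _ = refl
    ... | w , q = go w (reach⇒Conn (proj₂ (∧-true⁻ {toℕ w <ᵇ toℕ u} q)) ◅◅ c) (rec (<ᵇ-true⁻ (proj₁ (∧-true⁻ q))))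

_⊑_ : ∀ {n} → MixedGraph n → MixedGraph n → Set
H ⊑ G = ∀ {u v} → Adj H u v → Adj G u v

-- d G + n, which avoids subtraction.
cyclo : ∀ {n} → MixedGraph n → ℕ
cyclo G = numEdges G + ω G

module _ {n} (G H : MixedGraph n) where

  Conn-mono : H ⊑ G → ∀ {u v} → Conn H u v → Conn G u v
  Conn-mono H⊑G = Star.map H⊑G

  numEdges-cong : (∀ u v → adjB G u v ≡ adjB H u v) → numEdges G ≡ numEdges H
  numEdges-cong G≗H = cong (foldr _+_ 0) (map-cong (λ u → countFin-cong (λ v → cong ((toℕ u <ᵇ toℕ v) ∧_) (G≗H u v))) (allFin n))

  ω-cong : (∀ {u v} → Conn G u v → Conn H u v) → (∀ {u v} → Conn H u v → Conn G u v) → ω G ≡ ω H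
  ω-cong G⇒H H⇒G = countFin-cong {p = leastB G} {leastB H} λ v → Bool-≡
    (λ p → leastB⁺ H (λ u u<v c → leastB⁻ G p u u<v (H⇒G c)))
    (λ p → leastB⁺ G (λ u u<v c → leastB⁻ H p u u<v (G⇒H c)))

cyclo-cong : ∀ {n} (G H : MixedGraph n) → (∀ u v → adjB G u v ≡ adjB H u v) → cyclo G ≡ cyclo H
cyclo-cong G H G≗H = cong₂ _+_ (numEdges-cong G H G≗H)
  (ω-cong G H (Conn-mono H G (λ {u} {v} → trans (sym (G≗H u v)))) (Conn-mono G H (λ {u} {v} → trans (G≗H u v))))

joins : ∀ {n} (a b u v : Fin n) → Bool
joins a b u v = (does (u FinP.≟ a) ∧ does (v FinP.≟ b)) ∨ (does (u FinP.≟ b) ∧ does (v FinP.≟ a))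

Joins : ∀ {n} (a b u v : Fin n) → Set
Joins a b u v = (u ≡ a × v ≡ b) ⊎ (u ≡ b × v ≡ a)

joins⇒Joins : ∀ {n} {a b u v : Fin n} → joins a b u v ≡ true → Joins a b u v
joins⇒Joins {a = a} {b} {u} {v} p with ∨-true⁻ {does (u FinP.≟ a) ∧ does (v FinP.≟ b)} p
... | inj₁ q = inj₁ (does-≟⁻ (proj₁ (∧-true⁻ q)) , does-≟⁻ (proj₂ (∧-true⁻ {does (u FinP.≟ a)} q)))
... | inj₂ q = inj₂ (does-≟⁻ (proj₁ (∧-true⁻ q)) , does-≟⁻ (proj₂ (∧-true⁻ {does (u FinP.≟ b)} q)))

Joins⇒joins : ∀ {n} {a b u v : Fin n} → Joins a b u v → joins a b u v ≡ true
Joins⇒joins {u = u} {v} (inj₁ (refl , refl)) rewrite dec-true (u FinP.≟ u) refl | dec-true (v FinP.≟ v) refl = refl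
Joins⇒joins {u = u} {v} (inj₂ (refl , refl)) rewrite dec-true (u FinP.≟ u) refl | dec-true (v FinP.≟ v) refl = ∨-zeroʳ _

deleteEdge : ∀ {n} → MixedGraph n → Fin n → Fin n → MixedGraph n
deleteEdge G a b = record
  { h  = λ u v → if joins a b u v then o else h G u v
  ; loopless = λ v → if-o (joins a b v v) (loopless G v)
  ; herm  = λ u v → trans (cong (λ j → if j then o else h G v u) (joins-sym u v)) (if-conj (joins a b u v) (herm G u v))
  }
  where
  if-o : ∀ j {l} → l ≡ o → (if j then o else l) ≡ o
  if-o true  _ = refl
  if-o false p = p
  if-conj : ∀ j {l m} → m ≡ conjLab l → (if j then o else m) ≡ conjLab (if j then o else l)
  if-conj true  _ = refl
  if-conj false p = p
  joins-sym : ∀ u v → joins a b v u ≡ joins a b u v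
  joins-sym u v = trans (∨-comm _ (does (v FinP.≟ b) ∧ does (u FinP.≟ a)))
    (cong₂ _∨_ (∧-comm (does (v FinP.≟ b)) _) (∧-comm (does (v FinP.≟ a)) _))

module _ {n} (G : MixedGraph n) where

  deleteEdge-Joins : ∀ {a b u v} → Joins a b u v → adjB (deleteEdge G a b) u v ≡ false
  deleteEdge-Joins j rewrite Joins⇒joins j = refl

  deleteEdge-other : ∀ {a b u v} → ¬ Joins a b u v → adjB (deleteEdge G a b) u v ≡ adjB G u v
  deleteEdge-other {a} {b} {u} {v} ¬j with joins a b u v in eq
  ... | true  = ⊥-elim (¬j (joins⇒Joins {a = a} eq))
  ... | false = refl

  Joins? : ∀ (a b u v : Fin n) → Dec (Joins a b u v)
  Joins? a b u v = ((u FinP.≟ a) ×-dec (v FinP.≟ b)) ⊎-dec ((u FinP.≟ b) ×-dec (v FinP.≟ a))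

  deleteEdge-Adj⁻ : ∀ {a b u v} → Adj (deleteEdge G a b) u v → Adj G u v × ¬ Joins a b u v
  deleteEdge-Adj⁻ {a} {b} {u} {v} uv with Joins? a b u v
  ... | yes j = ⊥-elim (true≢false uv (deleteEdge-Joins j))
  ... | no ¬j = trans (sym (deleteEdge-other ¬j)) uv , ¬j

  deleteEdge-Adj⁺ : ∀ {a b u v} → Adj G u v → ¬ Joins a b u v → Adj (deleteEdge G a b) u v
  deleteEdge-Adj⁺ uv ¬j = trans (deleteEdge-other ¬j) uv

  deleteEdge-⊑ : ∀ {a b} → deleteEdge G a b ⊑ G
  deleteEdge-⊑ = proj₁ ∘ deleteEdge-Adj⁻

  deleteEdge-swap : ∀ a b u v → adjB (deleteEdge G a b) u v ≡ adjB (deleteEdge G b a) u v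
  deleteEdge-swap a b u v = cong (λ j → not (isO (if j then o else h G u v))) (∨-comm (does (u FinP.≟ a) ∧ does (v FinP.≟ b)) _)

  numEdges-deleteEdge-< : ∀ {a b} → Adj G a b → toℕ a < toℕ b → numEdges G ≡ suc (numEdges (deleteEdge G a b))
  numEdges-deleteEdge-< {a} {b} ab a<b = sum-flip {x = a} (allFin-unique n) (∈-allFin a)
    (countFin-flip b (∧-true⁺ (<ᵇ-true⁺ a<b) ab)
      (trans (cong ((toℕ a <ᵇ toℕ b) ∧_) (deleteEdge-Joins (inj₁ (refl , refl)))) (∧-zeroʳ _))
      (λ y y≢b → cong ((toℕ a <ᵇ toℕ y) ∧_) (sym (deleteEdge-other
        λ { (inj₁ (_ , y≡b)) → y≢b y≡b ; (inj₂ (a≡b , _)) → Adj⇒≢ G ab a≡b }))))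
    (λ u u≢a → countFin-cong (row u u≢a))
    where
    row : ∀ u → u ≢ a → ∀ v → (toℕ u <ᵇ toℕ v) ∧ adjB G u v ≡ (toℕ u <ᵇ toℕ v) ∧ adjB (deleteEdge G a b) u v
    row u u≢a v with Joins? a b u v
    ... | no ¬j  = cong ((toℕ u <ᵇ toℕ v) ∧_) (sym (deleteEdge-other ¬j))
    ... | yes (inj₁ (u≡a , _))  = ⊥-elim (u≢a u≡a)
    ... | yes (inj₂ (refl , refl)) = trans (cong (_∧ adjB G b a) b≮a) (sym (cong (_∧ adjB (deleteEdge G a b) b a) b≮a))
      where
      open import Function using (_⟨_⟩_)
      b≮a : (toℕ b <ᵇ toℕ a) ≡ false
      b≮a = ¬-not (λ p → ℕP.<-asym a<b (<ᵇ-true⁻ p))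

module _ {n} (G : MixedGraph n) where

  numEdges-deleteEdge : ∀ {a b} → Adj G a b → numEdges G ≡ suc (numEdges (deleteEdge G a b))
  numEdges-deleteEdge {a} {b} ab with ℕP.<-cmp (toℕ a) (toℕ b)
  ... | tri< a<b _ _ = numEdges-deleteEdge-< G ab a<b
  ... | tri≈ _ a≡b _ = ⊥-elim (Adj⇒≢ G ab (FinP.toℕ-injective a≡b))
  ... | tri> _ _ b<a = trans (numEdges-deleteEdge-< G (Adj-sym G ab) b<a)
                             (cong suc (numEdges-cong (deleteEdge G b a) (deleteEdge G a b) (deleteEdge-swap G b a)))

  Conn-deleteEdge : ∀ {a b u v} → Adj G a b → Conn G u v → let H = deleteEdge G a b in
    Conn H u v ⊎ ((Conn H u a × Conn H b v) ⊎ (Conn H u b × Conn H a v))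
  Conn-deleteEdge ab ε = inj₁ ε
  Conn-deleteEdge {a} {b} ab (_◅_ {i = u} {j = w} uw c) with Conn-deleteEdge ab c | Joins? G a b u w
  ... | inj₁ wv  | yes (inj₁ (refl , refl)) = inj₂ (inj₁ (ε , wv))
  ... | inj₂ (inj₁ (_ , bv)) | yes (inj₁ (refl , refl)) = inj₂ (inj₁ (ε , bv))
  ... | inj₂ (inj₂ (_ , av)) | yes (inj₁ (refl , refl)) = inj₁ av
  ... | inj₁ wv  | yes (inj₂ (refl , refl)) = inj₂ (inj₂ (ε , wv))
  ... | inj₂ (inj₁ (_ , bv)) | yes (inj₂ (refl , refl)) = inj₁ bv
  ... | inj₂ (inj₂ (_ , av)) | yes (inj₂ (refl , refl)) = inj₂ (inj₂ (ε , av))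
  ... | inj₁ wv  | no ¬j = inj₁ (deleteEdge-Adj⁺ G uw ¬j ◅ wv)
  ... | inj₂ (inj₁ (wa , bv)) | no ¬j = inj₂ (inj₁ (deleteEdge-Adj⁺ G uw ¬j ◅ wa , bv))
  ... | inj₂ (inj₂ (wb , av)) | no ¬j = inj₂ (inj₂ (deleteEdge-Adj⁺ G uw ¬j ◅ wb , av))

  cyclo-deleteEdge-cycle : ∀ {a b} → Adj G a b → Conn (deleteEdge G a b) a b → cyclo G ≡ suc (cyclo (deleteEdge G a b))
  cyclo-deleteEdge-cycle {a} {b} ab c = cong₂ _+_ (numEdges-deleteEdge ab)
    (ω-cong G (deleteEdge G a b) join (Conn-mono G (deleteEdge G a b) (deleteEdge-⊑ G)))
    where
    join : ∀ {u v} → Conn G u v → Conn (deleteEdge G a b) u v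
    join uv with Conn-deleteEdge ab uv
    ... | inj₁ uv′  = uv′
    ... | inj₂ (inj₁ (ua , bv)) = ua ◅◅ c ◅◅ bv
    ... | inj₂ (inj₂ (ub , av)) = ub ◅◅ Conn-sym (deleteEdge G a b) c ◅◅ av

  -- The larger of the two least representatives of the separated components is the new one.
  ω-bridge : ∀ {H : MixedGraph n} → H ⊑ G → ∀ {a b} → Conn G a b → ¬ Conn H a b →
             (∀ {u v} → Conn G u v → Conn H u v ⊎ ((Conn H u a × Conn H b v) ⊎ (Conn H u b × Conn H a v))) →
             ω H ≡ suc (ω G)
  ω-bridge {H} H⊑G {a} {b} ab ¬ab split with least-of-component H a | least-of-component H b
  ... | p , pa , lp | q , qb , lq = compare (ℕP.<-cmp (toℕ p) (toℕ q))
    where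
    least-unique : ∀ {x y} → leastB H x ≡ true → leastB H y ≡ true → Conn H x y → x ≡ y
    least-unique {x} {y} lx ly xy with ℕP.<-cmp (toℕ x) (toℕ y)
    ... | tri< x<y _ _ = ⊥-elim (leastB⁻ H ly x x<y xy)
    ... | tri≈ _ x≡y _ = FinP.toℕ-injective x≡y
    ... | tri> _ _ y<x = ⊥-elim (leastB⁻ H lx y y<x (Conn-sym H xy))
    H⇒G : ∀ {u v} → Conn H u v → Conn G u v
    H⇒G = Conn-mono G H H⊑G
    Separates : Fin n → Fin n → Set
    Separates p q = ∀ {u v} → Conn G u v → Conn H u v ⊎ ((Conn H u p × Conn H q v) ⊎ (Conn H u q × Conn H p v))
    flip-at : ∀ p q → leastB H p ≡ true → leastB H q ≡ true → Conn G p q → Separates p q → toℕ p < toℕ q → ω H ≡ suc (ω G)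
    flip-at p q lp lq pq sep p<q = countFin-flip q lq (¬-not (λ l → leastB⁻ G l p p<q pq)) (λ v v≢q → Bool-≡
      (λ l → leastB⁺ G λ u u<v uv → new v v≢q l u u<v (sep uv))
      (λ l → leastB⁺ H λ u u<v uv → leastB⁻ G l u u<v (H⇒G uv)))
      where
      new : ∀ v → v ≢ q → leastB H v ≡ true → ∀ u → toℕ u < toℕ v →
            Conn H u v ⊎ ((Conn H u p × Conn H q v) ⊎ (Conn H u q × Conn H p v)) → ⊥
      new v v≢q l u u<v (inj₁ uv)  = leastB⁻ H l u u<v uv
      new v v≢q l u u<v (inj₂ (inj₁ (_ , qv))) = v≢q (sym (least-unique lq l qv))
      new v v≢q l u u<v (inj₂ (inj₂ (uq , pv))) with least-unique lp l pv
      ... | refl = leastB⁻ H lq u (ℕP.<-trans u<v p<q) uq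
    sep : Separates p q
    sep uv = ⊎-map id (⊎-map (λ (ua , bv) → ua ◅◅ Conn-sym H pa , qb ◅◅ bv) (λ (ub , av) → ub ◅◅ Conn-sym H qb , pa ◅◅ av)) (split uv)
    pq : Conn G p q
    pq = H⇒G pa ◅◅ ab ◅◅ H⇒G (Conn-sym H qb)
    compare : _ → ω H ≡ suc (ω G)
    compare (tri< p<q _ _) = flip-at p q lp lq pq sep p<q
    compare (tri≈ _ p≡q _) = ⊥-elim (¬ab (Conn-sym H pa ◅◅ subst (λ x → Conn H x b) (sym (FinP.toℕ-injective p≡q)) qb))
    compare (tri> _ _ q<p) = flip-at q p lq lp (Conn-sym G pq) (⊎-map id ⊎-swap ∘ sep) q<p

  cyclo-deleteEdge-bridge : ∀ {a b} → Adj G a b → ¬ Conn (deleteEdge G a b) a b → cyclo G ≡ cyclo (deleteEdge G a b)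
  cyclo-deleteEdge-bridge {a} {b} ab ¬c = trans (cong (_+ ω G) (numEdges-deleteEdge ab))
    (trans (sym (ℕP.+-suc (numEdges (deleteEdge G a b)) (ω G)))
           (cong (λ t → numEdges (deleteEdge G a b) + t) (sym (ω-bridge (deleteEdge-⊑ G) (ab ◅ ε) ¬c (Conn-deleteEdge ab)))))

  cyclo-deleteEdge-≤ : ∀ {a b} → Adj G a b → cyclo (deleteEdge G a b) ≤ cyclo G
  cyclo-deleteEdge-≤ {a} {b} ab with Conn? (deleteEdge G a b) a b
  ... | yes c = ℕP.≤-trans (ℕP.n≤1+n _) (ℕP.≤-reflexive (sym (cyclo-deleteEdge-cycle ab c)))
  ... | no ¬c = ℕP.≤-reflexive (sym (cyclo-deleteEdge-bridge ab ¬c))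

  cyclo-edgeless : (∀ u v → ¬ Adj G u v) → cyclo G ≡ n
  cyclo-edgeless ¬adj = cong₂ _+_ edges components
    where
    zeros : ∀ xs → foldr _+_ 0 (map (λ u → countFin (λ v → (toℕ u <ᵇ toℕ v) ∧ adjB G u v)) xs) ≡ 0
    zeros []  = refl
    zeros (u ∷ xs) = cong₂ _+_ (trans (countFin-cong (λ v → trans (cong ((toℕ u <ᵇ toℕ v) ∧_) (¬-not (¬adj u v))) (∧-zeroʳ _))) (count-false (allFin n))) (zeros xs)
    edges : numEdges G ≡ 0
    edges = zeros (allFin n)
    conn⇒≡ : ∀ {u v} → Conn G u v → u ≡ v
    conn⇒≡ ε  = refl
    conn⇒≡ (uw ◅ _) = ⊥-elim (¬adj _ _ uw)
    components : ω G ≡ n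
    components = trans (countFin-cong {p = leastB G} {q = λ _ → true}
                         (λ v → leastB⁺ G (λ u u<v c → ℕP.<⇒≢ u<v (cong toℕ (conn⇒≡ c)))))
                       (trans (count-true (allFin n)) (length-tabulate id))

edge-induction : ∀ {n} (P : MixedGraph n → Set) →
                 (∀ G → (∀ {a b} → Adj G a b → P (deleteEdge G a b)) → P G) → ∀ G → P G
edge-induction P step G = go G (<-wellFounded (numEdges G))
  where
  go : ∀ G → Acc _<_ (numEdges G) → P G
  go G (acc rec) = step G λ {a} {b} ab → go (deleteEdge G a b) (rec (ℕP.≤-reflexive (sym (numEdges-deleteEdge G ab))))

cyclo-mono : ∀ {n} (G : MixedGraph n) {H : MixedGraph n} → H ⊑ G → cyclo H ≤ cyclo G
cyclo-mono {n} G {H} = edge-induction (λ G → H ⊑ G → cyclo H ≤ cyclo G) step G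
  where
  step : ∀ G → (∀ {a b} → Adj G a b → H ⊑ deleteEdge G a b → cyclo H ≤ cyclo (deleteEdge G a b)) → H ⊑ G → cyclo H ≤ cyclo G
  step G IH H⊑G with FinP.any? (λ a → FinP.any? (λ b → (adjB G a b ≟ᴮ true) ×-dec ¬? (adjB H a b ≟ᴮ true)))
  ... | no ¬ab = ℕP.≤-reflexive (cyclo-cong H G (λ u v → Bool-≡ H⊑G (λ uv → same u v uv)))
    where
    same : ∀ u v → Adj G u v → Adj H u v
    same u v uv with adjB H u v ≟ᴮ true
    ... | yes p = p
    ... | no ¬p = ⊥-elim (¬ab (u , v , uv , ¬p))
  ... | yes (a , b , ab , ¬ab) = ℕP.≤-trans (IH ab H⊑) (cyclo-deleteEdge-≤ G ab)
    where
    H⊑ : H ⊑ deleteEdge G a b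
    H⊑ uv = deleteEdge-Adj⁺ G (H⊑G uv) λ { (inj₁ (refl , refl)) → ¬ab uv ; (inj₂ (refl , refl)) → ¬ab (Adj-sym H uv) }

cyclo-drop : ∀ {n} (G : MixedGraph n) {H : MixedGraph n} → H ⊑ G → ∀ {x y} → Adj G x y → ¬ Adj H x y →
             Conn (deleteEdge G x y) x y → cyclo H < cyclo G
cyclo-drop G {H} H⊑G {x} {y} xy ¬xy c = ℕP.≤-trans (s≤s (cyclo-mono (deleteEdge G x y) H⊑))
  (ℕP.≤-reflexive (sym (cyclo-deleteEdge-cycle G xy c)))
  where
  H⊑ : H ⊑ deleteEdge G x y
  H⊑ uv = deleteEdge-Adj⁺ G (H⊑G uv) λ { (inj₁ (refl , refl)) → ¬xy uv ; (inj₂ (refl , refl)) → ¬xy (Adj-sym H uv) }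

links : {A : Set} → A → List A → A → List (A × A)
links x xs z = zip (x ∷ xs) (xs ++ [ z ])

links-++ : ∀ {A : Set} (a : A) as x bs z → links a (as ++ x ∷ bs) z ≡ links a as x ++ links x bs z
links-++ a []  x bs z = refl
links-++ a (a′ ∷ as) x bs z = cong ((a , a′) ∷_) (links-++ a′ as x bs z)

links-∈ˡ : ∀ {A : Set} {a : A} {as z p q} → (p , q) ∈ links a as z → p ∈ a ∷ as
links-∈ˡ {as = []}  (here refl) = here refl
links-∈ˡ {as = _ ∷ as} (here refl) = here refl
links-∈ˡ {as = _ ∷ as} (there pq)  = there (links-∈ˡ pq)

links-∈ʳ : ∀ {A : Set} {a : A} {as z p q} → (p , q) ∈ links a as z → q ∈ as ++ [ z ]
links-∈ʳ {as = []}  (here refl) = here refl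
links-∈ʳ {as = _ ∷ as} (here refl) = here refl
links-∈ʳ {as = _ ∷ as} (there pq)  = there (links-∈ʳ pq)

∈-snoc : ∀ {A : Set} {x z : A} {xs} → x ∈ xs ++ [ z ] → x ∈ z ∷ xs
∈-snoc {xs = xs} x∈ with ∈-++⁻ xs x∈
... | inj₁ x∈xs  = there x∈xs
... | inj₂ (here eq) = here eq

cyclicPairs-∈ˡ : ∀ {A : Set} {c : List A} {p q} → (p , q) ∈ cyclicPairs c → p ∈ c
cyclicPairs-∈ˡ {c = x ∷ xs} pq = links-∈ˡ pq

cyclicPairs-∈ʳ : ∀ {A : Set} {c : List A} {p q} → (p , q) ∈ cyclicPairs c → q ∈ c
cyclicPairs-∈ʳ {c = x ∷ xs} pq = ∈-snoc (links-∈ʳ pq)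

Unique-++⁻ : ∀ {A : Set} (as : List A) {bs} → Unique (as ++ bs) → Unique as × Unique bs × (∀ {x} → x ∈ as → x ∈ bs → ⊥)
Unique-++⁻ []  u  = [] , u , λ ()
Unique-++⁻ (a ∷ as) (a∉ ∷ u) with Unique-++⁻ as u
... | ua , ub , disjoint = All-++⁻ˡ as a∉ ∷ ua , ub ,
  λ { (here refl) x∈ → All¬⇒¬Any (All-++⁻ʳ as a∉) x∈ ; (there x∈as) x∈ → disjoint x∈as x∈ }

Unique-++-comm : ∀ {A : Set} (as : List A) {bs} → Unique (as ++ bs) → Unique (bs ++ as)
Unique-++-comm as u with Unique-++⁻ as u
... | ua , ub , disjoint = Unique-++⁺ ub ua (λ (x∈bs , x∈as) → disjoint x∈as x∈bs)

∈-++-comm : ∀ {A : Set} {x : A} as {bs} → x ∈ as ++ bs → x ∈ bs ++ as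
∈-++-comm as {bs} x∈ with ∈-++⁻ as x∈
... | inj₁ x∈as = ∈-++⁺ʳ bs x∈as
... | inj₂ x∈bs = ∈-++⁺ˡ x∈bs

∉-head : ∀ {A : Set} {x : A} {xs} → Unique (x ∷ xs) → x ∉ xs
∉-head (x∉ ∷ _) = All¬⇒¬Any x∉

-- Cycles

module _ {n} (G : MixedGraph n) where

  cycle-length : ∀ {c} → IsCycle G c → 3 ≤ length c
  cycle-length = proj₁

  cycle-unique : ∀ {c} → IsCycle G c → Unique c
  cycle-unique = proj₁ ∘ proj₂

  cycle-Adj : ∀ {c u v} → IsCycle G c → (u , v) ∈ cyclicPairs c → Adj G u v
  cycle-Adj (_ , _ , adj) uv = All.lookup adj uv

  mkIsCycle : ∀ {c} → 3 ≤ length c → Unique c → (∀ {u v} → (u , v) ∈ cyclicPairs c → Adj G u v) → IsCycle G c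
  mkIsCycle len uniq adj = len , uniq , All.tabulate (λ { {u , v} uv → adj uv })

  CycleEdge-Adj : ∀ {c u v} → IsCycle G c → CycleEdge c u v → Adj G u v
  CycleEdge-Adj cyc (inj₁ uv) = cycle-Adj cyc uv
  CycleEdge-Adj cyc (inj₂ vu) = Adj-sym G (cycle-Adj cyc vu)

CycleEdge-sym : ∀ {n} {c : List (Fin n)} {u v} → CycleEdge c u v → CycleEdge c v u
CycleEdge-sym = ⊎-swap

CycleEdge-∈ˡ : ∀ {n} {c : List (Fin n)} {u v} → CycleEdge c u v → u ∈ c
CycleEdge-∈ˡ (inj₁ uv) = cyclicPairs-∈ˡ uv
CycleEdge-∈ˡ (inj₂ vu) = cyclicPairs-∈ʳ vu

CycleEdge? : ∀ {n} (c : List (Fin n)) u v → Dec (CycleEdge c u v)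
CycleEdge? c u v = ((u , v) ∈?′ cyclicPairs c) ⊎-dec ((v , u) ∈?′ cyclicPairs c)
  where open DecMembership (×-≡-dec FinP._≟_ FinP._≟_) using () renaming (_∈?_ to _∈?′_)

IsCycle-resp : ∀ {n} (G H : MixedGraph n) {c} → (∀ {u v} → (u , v) ∈ cyclicPairs c → Adj G u v → Adj H u v) →
               IsCycle G c → IsCycle H c
IsCycle-resp G H G⇒H cyc = mkIsCycle H (cycle-length G cyc) (cycle-unique G cyc)
  (λ uv → G⇒H uv (cycle-Adj G cyc uv))

record Rotation {n} (G : MixedGraph n) (c : List (Fin n)) (x : Fin n) : Set where
  constructor rotation
  field
    tail  : List (Fin n)
    isCycle : IsCycle G (x ∷ tail)
    pairs⇒  : ∀ {p} → p ∈ cyclicPairs c → p ∈ cyclicPairs (x ∷ tail)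
    pairs⇐  : ∀ {p} → p ∈ cyclicPairs (x ∷ tail) → p ∈ cyclicPairs c
    verts⇒  : ∀ {v} → v ∈ c → v ∈ x ∷ tail

rotate : ∀ {n} (G : MixedGraph n) {c x} → IsCycle G c → x ∈ c → Rotation G c x
rotate G {c} {x} cyc x∈ with ∈-∃++ x∈
... | [] , bs , refl = rotation bs cyc id id id
... | a ∷ as , bs , refl = rotation (bs ++ a ∷ as)
  (mkIsCycle G (subst (3 ≤_) len (cycle-length G cyc)) (Unique-++-comm (a ∷ as) (cycle-unique G cyc))
             (cycle-Adj G cyc ∘ pairs⇐))
  pairs⇒ pairs⇐ (∈-++-comm (a ∷ as))
  where
  len : length (a ∷ as ++ x ∷ bs) ≡ length (x ∷ bs ++ a ∷ as)
  len = trans (length-++ (a ∷ as)) (trans (ℕP.+-comm (suc (length as)) _) (sym (length-++ (x ∷ bs))))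
  pairs⇒ : ∀ {p} → p ∈ cyclicPairs (a ∷ as ++ x ∷ bs) → p ∈ cyclicPairs (x ∷ bs ++ a ∷ as)
  pairs⇒ {p} p∈ = subst (p ∈_) (sym (links-++ x bs a as x)) (∈-++-comm (links a as x) (subst (p ∈_) (links-++ a as x bs a) p∈))
  pairs⇐ : ∀ {p} → p ∈ cyclicPairs (x ∷ bs ++ a ∷ as) → p ∈ cyclicPairs (a ∷ as ++ x ∷ bs)
  pairs⇐ {p} p∈ = subst (p ∈_) (sym (links-++ a as x bs a)) (∈-++-comm (links x bs a) (subst (p ∈_) (links-++ x bs a as x) p∈))

Conn-avoiding : ∀ {n} (G : MixedGraph n) {x y} w ws → x ∉ w ∷ ws → y ∉ w ∷ ws →
                (∀ {p q} → (p , q) ∈ links w ws x → Adj G p q) → Conn (deleteEdge G x y) w x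
Conn-avoiding G w []  x∉ y∉ adj = deleteEdge-Adj⁺ G (adj (here refl))
  (λ { (inj₁ (refl , _)) → x∉ (here refl) ; (inj₂ (refl , _)) → y∉ (here refl) }) ◅ ε
Conn-avoiding G w (w′ ∷ ws) x∉ y∉ adj = deleteEdge-Adj⁺ G (adj (here refl))
  (λ { (inj₁ (refl , _)) → x∉ (here refl) ; (inj₂ (refl , _)) → y∉ (here refl) })
  ◅ Conn-avoiding G w′ ws (x∉ ∘ there) (y∉ ∘ there) (adj ∘ there)

cycle-edge-redundant : ∀ {n} (G : MixedGraph n) {x y ys} → IsCycle G (x ∷ y ∷ ys) → Conn (deleteEdge G x y) x y
cycle-edge-redundant G {x} {y} {[]}  (s≤s (s≤s ()) , _)
cycle-edge-redundant G {x} {y} {y′ ∷ ys} cyc with cycle-unique G cyc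
... | x∉ ∷ y∉ ∷ _ = Conn-sym (deleteEdge G x y)
  (deleteEdge-Adj⁺ G (cycle-Adj G cyc (there (here refl)))
    (λ { (inj₁ (_ , refl)) → All¬⇒¬Any y∉ (here refl) ; (inj₂ (_ , refl)) → All¬⇒¬Any x∉ (there (here refl)) })
  ◅ Conn-avoiding G y′ ys (All¬⇒¬Any x∉ ∘ there) (All¬⇒¬Any y∉) (cycle-Adj G cyc ∘ there ∘ there))

cycle-pair-redundant : ∀ {n} (G : MixedGraph n) {c u v} → IsCycle G c → (u , v) ∈ cyclicPairs c → Conn (deleteEdge G u v) u v
cycle-pair-redundant G {c} cyc uv with rotate G cyc (cyclicPairs-∈ˡ uv)
... | rotation [] (s≤s () , _) _ _ _
... | rotation (w ∷ ws) cyc′ pairs⇒ _ _ with pairs⇒ uv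
... | here refl = cycle-edge-redundant G cyc′
... | there uv′ = ⊥-elim (∉-head (cycle-unique G cyc′) (links-∈ˡ uv′))

CycleEdge-redundant : ∀ {n} (G : MixedGraph n) {c u v} → IsCycle G c → CycleEdge c u v → Conn (deleteEdge G u v) u v
CycleEdge-redundant G cyc (inj₁ uv) = cycle-pair-redundant G cyc uv
CycleEdge-redundant G {u = u} {v} cyc (inj₂ vu) = Conn-sym (deleteEdge G u v)
  (Conn-mono (deleteEdge G u v) (deleteEdge G v u) (λ {p} {q} → trans (deleteEdge-swap G u v p q)) (cycle-pair-redundant G cyc vu))

cycle-neighbour : ∀ {n} (G : MixedGraph n) {c x} → IsCycle G c → x ∈ c → ∃[ y ] CycleEdge c x y
cycle-neighbour G cyc x∈ with rotate G cyc x∈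
... | rotation []  (s≤s () , _) _ _ _
... | rotation (y ∷ _) _ _ pairs⇐ _ = y , inj₁ (pairs⇐ (here refl))

cyclo-drop-cycle : ∀ {n} (G : MixedGraph n) {H : MixedGraph n} {c x} → H ⊑ G → IsCycle G c → x ∈ c →
                   (∀ y → ¬ Adj H x y) → cyclo H < cyclo G
cyclo-drop-cycle G {H} H⊑G cyc x∈ isolated with cycle-neighbour G cyc x∈
... | y , xy = cyclo-drop G H⊑G (CycleEdge-Adj G cyc xy) (isolated y) (CycleEdge-redundant G cyc xy)

CycleEdge-shared : ∀ {n} (G : MixedGraph n) {H : MixedGraph n} {c₁ c₂ x y} → H ⊑ G → IsCycle G c₁ → IsCycle G c₂ →
                   x ∈ c₂ → (∀ y → ¬ Adj H x y) → cyclo G ≤ suc (cyclo H) → CycleEdge c₁ x y → CycleEdge c₂ x y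
CycleEdge-shared G {H} {c₁} {c₂} {x} {y} H⊑G cyc₁ cyc₂ x∈ isolated G≤ xy with CycleEdge? c₂ x y
... | yes xy′ = xy′
... | no ¬xy′ = ⊥-elim (ℕP.<-irrefl refl (ℕP.≤-trans (s≤s G≤)
        (ℕP.≤-trans (s≤s drop₂) (ℕP.≤-reflexive (sym drop₁)))))
  where
  K = deleteEdge G x y
  drop₁ : cyclo G ≡ suc (cyclo K)
  drop₁ = cyclo-deleteEdge-cycle G (CycleEdge-Adj G cyc₁ xy) (CycleEdge-redundant G cyc₁ xy)
  cyc₂′ : IsCycle K c₂
  cyc₂′ = IsCycle-resp G K (λ uv adj → deleteEdge-Adj⁺ G adj
    λ { (inj₁ (refl , refl)) → ¬xy′ (inj₁ uv) ; (inj₂ (refl , refl)) → ¬xy′ (inj₂ uv) }) cyc₂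
  H⊑K : H ⊑ K
  H⊑K uv = deleteEdge-Adj⁺ G (H⊑G uv)
    λ { (inj₁ (refl , refl)) → isolated _ uv ; (inj₂ (refl , refl)) → isolated _ (Adj-sym H uv) }
  drop₂ : cyclo H < cyclo K
  drop₂ = cyclo-drop-cycle K H⊑K cyc₂′ x∈ isolated

cycles-agree : ∀ {n} (G : MixedGraph n) {c₁ c₂ v₀} → IsCycle G c₁ → v₀ ∈ c₁ → v₀ ∈ c₂ →
               (∀ {x y} → x ∈ c₂ → CycleEdge c₁ x y → CycleEdge c₂ x y) → ∀ {u v} → CycleEdge c₁ u v → CycleEdge c₂ u v
cycles-agree G {c₁} {c₂} {v₀} cyc₁ v₀∈c₁ v₀∈c₂ local {u} uv = local (covers (CycleEdge-∈ˡ uv)) uv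
  where
  R = rotate G cyc₁ v₀∈c₁
  open Rotation R
  walk : ∀ w ws {z} → w ∈ c₂ → (∀ {p} → p ∈ links w ws z → p ∈ cyclicPairs c₁) → ∀ {x} → x ∈ w ∷ ws → x ∈ c₂
  walk w ws  w∈ sub (here refl) = w∈
  walk w (w′ ∷ ws) w∈ sub (there x∈)  =
    walk w′ ws (CycleEdge-∈ˡ {c = c₂} (CycleEdge-sym {c = c₂} (local w∈ (inj₁ (sub (here refl)))))) (sub ∘ there) x∈
  covers : ∀ {x} → x ∈ c₁ → x ∈ c₂
  covers x∈ = walk v₀ tail v₀∈c₂ pairs⇐ (verts⇒ x∈)

module _ {n} (G : MixedGraph n) where

  chain-links : ∀ {u xs v z} → Chain G u xs v → Adj G v z → ∀ {p q} → (p , q) ∈ links u xs z → Adj G p q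
  chain-links []  vz (here refl) = vz
  chain-links (uw ∷ c) vz (here refl) = uw
  chain-links (uw ∷ c) vz (there pq)  = chain-links c vz pq

  chain-end : ∀ {u xs v} → Chain G u xs v → v ∈ u ∷ xs
  chain-end []  = here refl
  chain-end (_ ∷ c) = there (chain-end c)

  close-chain : ∀ {u xs v} → Chain G u xs v → Unique (u ∷ xs) → Adj G v u → 2 ≤ length xs → IsCycle G (u ∷ xs)
  close-chain c uniq vu len = mkIsCycle G (s≤s len) uniq (chain-links c vu)

  chain-prefix : ∀ {u v} as {t bs} → Chain G u (as ++ t ∷ bs) v → Chain G u (as ++ [ t ]) t
  chain-prefix []  (ut ∷ _) = ut ∷ []
  chain-prefix (a ∷ as) (ua ∷ c) = ua ∷ chain-prefix as c

  chain-step : ∀ {u v} as {t b bs} → Chain G u (as ++ t ∷ b ∷ bs) v → Adj G t b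
  chain-step []  (_ ∷ tb ∷ _) = tb
  chain-step (a ∷ as) (_ ∷ c)  = chain-step as c

cycle-or-forest : ∀ {n} (G : MixedGraph n) → (∃[ c ] IsCycle G c) ⊎ cyclo G ≡ n
cycle-or-forest {n} = edge-induction (λ G → (∃[ c ] IsCycle G c) ⊎ cyclo G ≡ n) step
  where
  step : ∀ G → (∀ {a b} → Adj G a b → (∃[ c ] IsCycle (deleteEdge G a b) c) ⊎ cyclo (deleteEdge G a b) ≡ n) →
         (∃[ c ] IsCycle G c) ⊎ cyclo G ≡ n
  step G IH with FinP.any? (λ a → FinP.any? (λ b → adjB G a b ≟ᴮ true))
  ... | no ¬adj = inj₂ (cyclo-edgeless G (λ u v uv → ¬adj (u , v , uv)))
  ... | yes (a , b , ab) with Conn? (deleteEdge G a b) a b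
  ... | no ¬c = ⊎-map (λ (c , cyc) → c , IsCycle-resp (deleteEdge G a b) G (λ _ → deleteEdge-⊑ G) cyc)
                      (trans (cyclo-deleteEdge-bridge G ab ¬c)) (IH ab)
  ... | yes c with Conn⇒Chain (deleteEdge G a b) c
  ... | []  , []  , _  = ⊥-elim (Adj-irrefl G ab)
  ... | _ ∷ []  , (ab′ ∷ [])   , _  = ⊥-elim (proj₂ (deleteEdge-Adj⁻ G ab′) (inj₁ (refl , refl)))
  ... | w ∷ w′ ∷ ws  , chain  , uniq = inj₁ (a ∷ w ∷ w′ ∷ ws ,
        close-chain G (chain-mono chain) uniq (Adj-sym G ab) (s≤s (s≤s z≤n)))
    where
    chain-mono : ∀ {u xs v} → Chain (deleteEdge G a b) u xs v → Chain G u xs v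
    chain-mono []  = []
    chain-mono (uw ∷ c) = deleteEdge-⊑ G uw ∷ chain-mono c

-- The walk from a is extended backwards until it closes up: it ends in a lollipop.
lollipop : ∀ {n} (G : MixedGraph n) → (∀ {v w} → Adj G v w → ∃[ t ] (Adj G v t × t ≢ w)) → ∀ {a b} → Adj G a b →
           ∃[ c ] (IsCycle G c × (a ∈ c ⊎ (∃[ p ] ∃[ q ] (p ∈ c × q ∉ c × Adj G p q))))
lollipop {n} G branching {a} {b} ab = extend n b [] (Adj-sym G ab ∷ []) (uniq ∷ [] ∷ []) (ℕP.≤-trans (ℕP.n≤1+n n) (ℕP.≤-trans (ℕP.n≤1+n _) (ℕP.≤-reflexive (ℕP.+-comm 2 n))))
  where
  uniq : All (b ≢_) [ a ]
  uniq = (λ { refl → Adj-irrefl G ab }) ∷ []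
  Result = ∃[ c ] (IsCycle G c × (a ∈ c ⊎ (∃[ p ] ∃[ q ] (p ∈ c × q ∉ c × Adj G p q))))
  extend : ∀ k u {w} ws → Chain G u (w ∷ ws) a → Unique (u ∷ w ∷ ws) → n ≤ k + suc (suc (length ws)) → Result
  extend k u {w} ws chain@(uw ∷ _) uniq fuel with branching uw
  ... | t , ut , t≢w with t ∈? u ∷ w ∷ ws
  ... | yes (here refl)  = ⊥-elim (Adj-irrefl G ut)
  ... | yes (there (here refl)) = ⊥-elim (t≢w refl)
  ... | yes (there (there t∈)) with ∈-∃++ t∈
  ... | as , bs , refl = u ∷ w ∷ as ++ [ t ] , cyc , end bs chain uniq
    where
    uniq′ : ∀ bs → Unique ((u ∷ w ∷ as) ++ t ∷ bs) → Unique ((u ∷ w ∷ as) ++ [ t ])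
    uniq′ bs u′ = proj₁ (Unique-++⁻ ((u ∷ w ∷ as) ++ [ t ]) (subst Unique (sym (++-assoc (u ∷ w ∷ as) [ t ] bs)) u′))
    cyc : IsCycle G (u ∷ w ∷ as ++ [ t ])
    cyc = close-chain G (chain-prefix G (w ∷ as) chain) (uniq′ bs uniq) (Adj-sym G ut)
            (s≤s (subst (1 ≤_) (sym (trans (length-++ as) (ℕP.+-comm (length as) 1))) (s≤s z≤n)))
    end : ∀ bs → Chain G u (w ∷ as ++ t ∷ bs) a → Unique (u ∷ w ∷ as ++ t ∷ bs) →
          a ∈ u ∷ w ∷ as ++ [ t ] ⊎ (∃[ p ] ∃[ q ] (p ∈ u ∷ w ∷ as ++ [ t ] × q ∉ u ∷ w ∷ as ++ [ t ] × Adj G p q))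
    end []  c u′ = inj₁ (chain-end G c)
    end (b ∷ bs) c u′ = inj₂ (t , b , ∈-++⁺ʳ (u ∷ w ∷ as) (here refl) ,
      (λ b∈ → proj₂ (proj₂ (Unique-++⁻ ((u ∷ w ∷ as) ++ [ t ]) (subst Unique (sym (++-assoc (u ∷ w ∷ as) [ t ] (b ∷ bs))) u′))) b∈ (here refl)) ,
      chain-step G (w ∷ as) c)
  extend zero u {w} ws chain uniq fuel | t , ut , t≢w | no t∉ =
    ⊥-elim (ℕP.<⇒≱ (Unique-length G (¬Any⇒All¬ (u ∷ w ∷ ws) t∉ ∷ uniq)) fuel)
  extend (suc k) u {w} ws chain uniq fuel | t , ut , t≢w | no t∉ =
    extend k t (w ∷ ws) (Adj-sym G ut ∷ chain) (¬Any⇒All¬ (u ∷ w ∷ ws) t∉ ∷ uniq) (subst (n ≤_) (sym (ℕP.+-suc k _)) fuel)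

-- Induced subgraphs and their ranks

und : ∀ {n} → MixedGraph n → MixedGraph n
und G = record
  { h  = λ u v → if adjB G u v then e else o
  ; loopless = λ v → cong (λ l → if not (isO l) then e else o) (loopless G v)
  ; herm  = λ u v → trans (cong (λ l → if not (isO l) then e else o) (herm G u v)) (conj-e (h G u v))
  }
  where
  conj-e : ∀ l → (if not (isO (conjLab l)) then e else o) ≡ conjLab (if not (isO l) then e else o)
  conj-e o  = refl
  conj-e e  = refl
  conj-e ar = refl
  conj-e ra = refl

und-adjB : ∀ {n} (G : MixedGraph n) u v → adjB G u v ≡ adjB (und G) u v
und-adjB G u v with adjB G u v
... | true  = refl
... | false = refl

r-und : ∀ {n} (G : MixedGraph n) → r G ≡ rk (und G)
r-und G = rank-fromℤ _ _ λ u v → entry (adjB G u v)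
  where
  entry : ∀ b → fromℤ (if b then + 1 else + 0) ≡ labℤi (if b then e else o)
  entry true  = refl
  entry false = refl

-- Deleted vertices stay as isolated vertices, which changes neither the ranks nor d.
sub : ∀ {n} → MixedGraph n → VSet n → MixedGraph n
sub G S = record
  { h  = λ u v → if S u ∧ S v then h G u v else o
  ; loopless = λ v → if-o (S v ∧ S v) (loopless G v)
  ; herm  = λ u v → trans (cong (λ b → if b then h G v u else o) (∧-comm (S v) (S u))) (if-conj (S u ∧ S v) (herm G u v))
  }
  where
  if-o : ∀ b {l} → l ≡ o → (if b then l else o) ≡ o
  if-o true  p = p
  if-o false _ = refl
  if-conj : ∀ b {l m} → m ≡ conjLab l → (if b then m else o) ≡ conjLab (if b then l else o)
  if-conj true  p = p
  if-conj false _ = refl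

mat : ∀ {n} → MixedGraph n → Mat n
mat G u v = labℤi (h G u v)

mat-hermitian : ∀ {n} (G : MixedGraph n) → Hermitian (mat G)
mat-hermitian G i j = trans (cong labℤi (herm G i j)) (labℤi-conj (h G i j))

mat-≢0 : ∀ {n} (G : MixedGraph n) {u v} → Adj G u v → mat G u v ≢ 0i
mat-≢0 G {u} {v} uv m≡0 with h G u v
mat-≢0 G () m≡0 | o
mat-≢0 G uv ()  | e
mat-≢0 G uv ()  | ar
mat-≢0 G uv ()  | ra

mat-≡0 : ∀ {n} (G : MixedGraph n) {u v} → ¬ Adj G u v → mat G u v ≡ 0i
mat-≡0 G {u} {v} ¬uv with h G u v
... | o  = refl
... | e  = ⊥-elim (¬uv refl)
... | ar = ⊥-elim (¬uv refl)
... | ra = ⊥-elim (¬uv refl)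

module _ {n} (G : MixedGraph n) where

  sub-Adj⁻ : ∀ (S : VSet n) {u v} → Adj (sub G S) u v → S u ≡ true × S v ≡ true × Adj G u v
  sub-Adj⁻ S {u} {v} uv with S u | S v
  ... | true | true = refl , refl , uv

  sub-Adj⁺ : ∀ (S : VSet n) {u v} → S u ≡ true → S v ≡ true → Adj G u v → Adj (sub G S) u v
  sub-Adj⁺ S {u} {v} su sv uv rewrite su | sv = uv

  sub-mono : ∀ (S T : VSet n) → (∀ {x} → S x ≡ true → T x ≡ true) → sub G S ⊑ sub G T
  sub-mono S T S⊆T uv with sub-Adj⁻ S uv
  ... | su , sv , uv′ = sub-Adj⁺ T (S⊆T su) (S⊆T sv) uv′

  ∖-⊑ : ∀ (S : VSet n) x → sub G (S ∖ x) ⊑ sub G S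
  ∖-⊑ S x = sub-mono (S ∖ x) S (proj₁ ∘ ∧-true⁻)

  ∖-isolated : ∀ (S : VSet n) x y → ¬ Adj (sub G (S ∖ x)) x y
  ∖-isolated S x y xy = true≢false (proj₁ (sub-Adj⁻ (S ∖ x) xy)) (∖-self S x)

  ∖-Adj⁺ : ∀ {S : VSet n} {x u v} → u ≢ x → v ≢ x → Adj (sub G S) u v → Adj (sub G (S ∖ x)) u v
  ∖-Adj⁺ {S} u≢x v≢x uv with sub-Adj⁻ S uv
  ... | su , sv , uv′ = sub-Adj⁺ (S ∖ _) (trans (∖-other S u≢x) su) (trans (∖-other S v≢x) sv) uv′

  mat-∖ : ∀ (S : VSet n) x i j → delete x (mat (sub G S)) i j ≡ mat (sub G (S ∖ x)) i j
  mat-∖ S x = by-cases x (λ j → trans (delete-row x M j) (sym (mat-≡0 H (∖-isolated S x j)))) λ i i≢x →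
    by-cases x (trans (mask-self x (λ j → mask x (λ i → M i j) i)) (sym (mat-≡0 H (∖-isolated S x i ∘ Adj-sym H)))) λ j j≢x →
    trans (delete-other M i≢x j≢x)
          (cong labℤi (sym (cong₂ (λ a b → if a ∧ b then h G i j else o) (∖-other S i≢x) (∖-other S j≢x))))
    where
    H = sub G (S ∖ x)
    M = mat (sub G S)

  removeTwo-true⁻ : ∀ {S : VSet n} {v w x} → removeTwo S v w x ≡ true → S x ≡ true × x ≢ v × x ≢ w
  removeTwo-true⁻ {S} {v} {w} {x} p with ∧-true⁻ {S x} p
  ... | sx , q with ∧-true⁻ {not (does (x FinP.≟ v))} q
  ... | q₁ , q₂ = sx , (λ { refl → not-true⁻ q₁ (dec-true (x FinP.≟ x) refl) }) , (λ { refl → not-true⁻ q₂ (dec-true (x FinP.≟ x) refl) })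

  removeTwo-true⁺ : ∀ {S : VSet n} {v w x} → S x ≡ true → x ≢ v → x ≢ w → removeTwo S v w x ≡ true
  removeTwo-true⁺ {S} {v} {w} {x} sx x≢v x≢w rewrite sx | dec-false (x FinP.≟ v) x≢v | dec-false (x FinP.≟ w) x≢w = refl

  record Leaf (S : VSet n) (v w : Fin n) : Set where
    constructor leaf
    field
      edge : Adj (sub G S) v w
      only : ∀ y → Adj (sub G S) v y → y ≡ w

  Pendant⇒Leaf : ∀ {S v} → Pendant G S v → ∃[ w ] Leaf S v w
  Pendant⇒Leaf {S} {v} (sv , deg≡1) with countFin-1⁻ (λ w → S w ∧ adjB G v w) deg≡1
  ... | w , p , unique = w , leaf (sub-Adj⁺ S sv (proj₁ (∧-true⁻ p)) (proj₂ (∧-true⁻ {S w} p)))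
        (λ y vy → let _ , sy , vy′ = sub-Adj⁻ S vy in unique y (∧-true⁺ sy vy′))

  Leaf⇒Pendant : ∀ {S v w} → Leaf S v w → Pendant G S v
  Leaf⇒Pendant {S} {v} {w} (leaf vw unique) with sub-Adj⁻ S vw
  ... | sv , sw , vw′ = sv , countFin-1⁺ (λ w → S w ∧ adjB G v w) w (∧-true⁺ sw vw′)
        (λ y p → unique y (sub-Adj⁺ S sv (proj₁ (∧-true⁻ p)) (proj₂ (∧-true⁻ {S y} p))))

  Pendant? : ∀ S v → Dec (Pendant G S v)
  Pendant? S v = (S v ≟ᴮ true) ×-dec (degIn G S v ℕP.≟ 1)

  branching : ∀ {S v w} → Adj (sub G S) v w → ¬ Pendant G S v → ∃[ t ] (Adj (sub G S) v t × t ≢ w)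
  branching {S} {v} {w} vw ¬pendant with FinP.any? (λ t → (adjB (sub G S) v t ≟ᴮ true) ×-dec ¬? (t FinP.≟ w))
  ... | yes (t , vt , t≢w) = t , vt , t≢w
  ... | no ¬other = ⊥-elim (¬pendant (Leaf⇒Pendant (leaf vw only)))
    where
    only : ∀ y → Adj (sub G S) v y → y ≡ w
    only y vy with y FinP.≟ w
    ... | yes y≡w = y≡w
    ... | no y≢w  = ⊥-elim (¬other (y , vy , y≢w))

  removeTwo-⊑ : ∀ S v w → sub G (removeTwo S v w) ⊑ sub G S
  removeTwo-⊑ S v w = sub-mono (removeTwo S v w) S (λ {x} p → proj₁ (removeTwo-true⁻ {S} {v} {w} {x} p))

  removeTwo-Adj⁺ : ∀ {S v w x y} → x ≢ v → x ≢ w → y ≢ v → y ≢ w → Adj (sub G S) x y → Adj (sub G (removeTwo S v w)) x y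
  removeTwo-Adj⁺ {S} x≢v x≢w y≢v y≢w xy with sub-Adj⁻ S xy
  ... | sx , sy , xy′ = sub-Adj⁺ (removeTwo S _ _) (removeTwo-true⁺ {S} sx x≢v x≢w) (removeTwo-true⁺ {S} sy y≢v y≢w) xy′

  removeTwo-isolated : ∀ S v w y → ¬ Adj (sub G (removeTwo S v w)) w y
  removeTwo-isolated S v w y wy = proj₂ (proj₂ (removeTwo-true⁻ {S} {v} {w} {w} (proj₁ (sub-Adj⁻ (removeTwo S v w) wy)))) refl

  removeTwo-isolated′ : ∀ S v w y → ¬ Adj (sub G (removeTwo S v w)) v y
  removeTwo-isolated′ S v w y vy = proj₁ (proj₂ (removeTwo-true⁻ {S} {v} {w} {v} (proj₁ (sub-Adj⁻ (removeTwo S v w) vy)))) refl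

  -- Once its neighbour is deleted, a pendant vertex contributes only zero entries.
  mat-removeTwo : ∀ {S v w} → Leaf S v w → ∀ i j → delete w (mat (sub G S)) i j ≡ mat (sub G (removeTwo S v w)) i j
  mat-removeTwo {S} {v} {w} (leaf vw unique) i j = trans (mat-∖ S w i j) (same i j)
    where
    v-isolated : ∀ y → ¬ Adj (sub G (S ∖ w)) v y
    v-isolated y vy with unique y (∖-⊑ S w vy)
    ... | refl = ∖-isolated S w v (Adj-sym (sub G (S ∖ w)) vy)
    same : ∀ i j → mat (sub G (S ∖ w)) i j ≡ mat (sub G (removeTwo S v w)) i j
    same = by-cases v
      (λ j → trans (mat-≡0 (sub G (S ∖ w)) (v-isolated j)) (sym (mat-≡0 H (removeTwo-isolated′ S v w j)))) λ i i≢v →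
      by-cases v
        (trans (mat-≡0 (sub G (S ∖ w)) (v-isolated i ∘ Adj-sym (sub G (S ∖ w)))) (sym (mat-≡0 H (removeTwo-isolated′ S v w i ∘ Adj-sym H))))
        λ j j≢v → cong labℤi (cong₂ (λ a b → if a ∧ b then h G i j else o) (vanish i i≢v) (vanish j j≢v))
      where
      H = sub G (removeTwo S v w)
      vanish : ∀ i → i ≢ v → (S ∖ w) i ≡ removeTwo S v w i
      vanish i i≢v rewrite dec-false (i FinP.≟ v) i≢v = refl

  ∖-atMost : ∀ S x → RankAtMost (delete x (mat (sub G S))) (rk (sub G (S ∖ x)))
  ∖-atMost S x = RankAtMost-resp (λ i j → sym (mat-∖ S x i j)) (rank-atMost (mat (sub G (S ∖ x))))

  ∖-atLeast : ∀ S x → RankAtLeast (delete x (mat (sub G S))) (rk (sub G (S ∖ x)))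
  ∖-atLeast S x = RankAtLeast-resp (λ i j → sym (mat-∖ S x i j)) (rank-atLeast (mat (sub G (S ∖ x))))

  rank-∖-≤ : ∀ S x → rk (sub G (S ∖ x)) ≤ rk (sub G S)
  rank-∖-≤ S x = rank-≤ (rank-atMost (mat (sub G S)))
    (RankAtLeast-undelete (mat (sub G S)) x (∖-atLeast S x))

  rank-≤-∖+2 : ∀ S x → rk (sub G S) ≤ suc (suc (rk (sub G (S ∖ x))))
  rank-≤-∖+2 S x = rank-≤ (RankAtMost-undelete (mat (sub G S)) x
    (∖-atMost S x)) (rank-atLeast (mat (sub G S)))

  InKernel : VSet n → Vec n → Set
  InKernel S z = ∀ i → (mat (sub G S) ∙ z) i ≡ 0i

  rank-kernel : ∀ S {x y} → InKernel S y → y x ≢ 0i → rk (sub G S) ≤ rk (sub G (S ∖ x))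
  rank-kernel S {x} {y} My≡0 yx≢0 = rank-≤ (RankAtMost-kernel (mat-hermitian (sub G S)) x y My≡0 yx≢0
    (∖-atMost S x)) (rank-atLeast (mat (sub G S)))

  rank-kernel⁻¹ : ∀ S {x} → rk (sub G S) ≡ rk (sub G (S ∖ x)) → ∃[ z ] (InKernel S z × z x ≢ 0i)
  rank-kernel⁻¹ S {x} eq = kernel-vector (mat (sub G S)) x
    (∖-atLeast S x)
    (subst (RankAtMost (mat (sub G S))) eq (rank-atMost (mat (sub G S))))

  rank-∖+2 : ∀ S {x y} → (∀ i → i ≢ x → (mat (sub G S) ∙ y) i ≡ 0i) → (mat (sub G S) ∙ y) x ≢ 0i → y x ≡ 0i →
             suc (suc (rk (sub G (S ∖ x)))) ≤ rk (sub G S)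
  rank-∖+2 S {x} {y} My≡0 Myx≢0 yx≡0 = rank-≤ (rank-atMost (mat (sub G S)))
    (RankAtLeast-undelete-2 (mat-hermitian (sub G S)) x y My≡0 Myx≢0 yx≡0
      (∖-atLeast S x))

  rank-pendant : ∀ {S v w} → Leaf S v w → rk (sub G S) ≡ suc (suc (rk (sub G (removeTwo S v w))))
  rank-pendant {S} {v} {w} ℓ@(leaf vw unique) = ℕP.≤-antisym
    (rank-≤ (RankAtMost-undelete M w (RankAtMost-resp (λ i j → sym (mat-removeTwo ℓ i j)) (rank-atMost M′))) (rank-atLeast M))
    (rank-≤ (rank-atMost M) (RankAtLeast-undelete-2 (mat-hermitian (sub G S)) w (unit v) off-w at-w
      (unit-≢ (Adj⇒≢ (sub G S) vw ∘ sym)) (RankAtLeast-resp (λ i j → sym (mat-removeTwo ℓ i j)) (rank-atLeast M′))))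
    where
    M = mat (sub G S)
    M′ = mat (sub G (removeTwo S v w))
    off-w : ∀ i → i ≢ w → (M ∙ unit v) i ≡ 0i
    off-w i i≢w = trans (dot-unit (M i) v) (mat-≡0 (sub G S) (λ iv → i≢w (unique i (Adj-sym (sub G S) iv))))
    at-w : (M ∙ unit v) w ≢ 0i
    at-w p = mat-≢0 (sub G S) (Adj-sym (sub G S) vw) (trans (sym (dot-unit (M w) v)) p)

  rank-edgeless : ∀ S → (∀ u v → ¬ Adj (sub G S) u v) → rk (sub G S) ≡ 0
  rank-edgeless S ¬adj = ℕP.n≤0⇒n≡0 (rank-≤ ((λ ()) , λ v _ i → sum-0 _ (λ j →
    trans (cong (_⊗ v j) (mat-≡0 (sub G S) (¬adj i j))) (zeroˡ (v j)))) (rank-atLeast (mat (sub G S))))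

countFin-removeTwo : ∀ {n} (S : VSet n) {v w} → S v ≡ true → countFin (removeTwo S v w) < countFin S
countFin-removeTwo {n} S {v} {w} sv = subst (countFin (removeTwo S v w) <_) (sym (countFin-∖ S v sv)) (s≤s (mono (allFin n)))
  where
  mono : ∀ xs → count (removeTwo S v w) xs ≤ count (S ∖ v) xs
  mono [] = z≤n
  mono (x ∷ xs) with S x | does (x FinP.≟ v) | does (x FinP.≟ w)
  ... | false | _  | _  = mono xs
  ... | true  | true  | _  = mono xs
  ... | true  | false | true  = ℕP.≤-trans (mono xs) (ℕP.n≤1+n _)
  ... | true  | false | false = s≤s (mono xs)

countFin-∖-< : ∀ {n} (S : VSet n) {x} → S x ≡ true → countFin (S ∖ x) < countFin S
countFin-∖-< S {x} sx = ℕP.≤-reflexive (sym (countFin-∖ S x sx))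

SameAdj : ∀ {n} → MixedGraph n → MixedGraph n → Set
SameAdj G₁ G₂ = ∀ u v → adjB G₁ u v ≡ adjB G₂ u v

sub-SameAdj : ∀ {n} (G₁ G₂ : MixedGraph n) → SameAdj G₁ G₂ → ∀ S → SameAdj (sub G₁ S) (sub G₂ S)
sub-SameAdj G₁ G₂ same S u v with S u ∧ S v
... | true  = same u v
... | false = refl

Leaf-SameAdj : ∀ {n} (G₁ G₂ : MixedGraph n) → SameAdj G₁ G₂ → ∀ {S v w} → Leaf G₁ S v w → Leaf G₂ S v w
Leaf-SameAdj G₁ G₂ same {S} {v} {w} (leaf vw unique) = leaf (trans (sym (sub-SameAdj G₁ G₂ same S v w)) vw)
  (λ y vy → unique y (trans (sub-SameAdj G₁ G₂ same S v y) vy))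

∈-cycle-sub : ∀ {n} (G : MixedGraph n) S {c x} → IsCycle (sub G S) c → x ∈ c → S x ≡ true
∈-cycle-sub G S cyc x∈ with cycle-neighbour (sub G S) cyc x∈
... | y , xy = proj₁ (sub-Adj⁻ G S (CycleEdge-Adj (sub G S) cyc xy))

cycle-or-edgeless : ∀ {n} (G : MixedGraph n) S → NoPendant G S → (∃[ c ] ∃[ x ] (IsCycle (sub G S) c × x ∈ c)) ⊎ (∀ u v → ¬ Adj (sub G S) u v)
cycle-or-edgeless G S noPendant with FinP.any? (λ a → FinP.any? (λ b → adjB (sub G S) a b ≟ᴮ true))
... | no ¬adj = inj₂ (λ u v uv → ¬adj (u , v , uv))
... | yes (a , b , ab) with lollipop (sub G S) (λ vw → branching G vw (noPendant _)) ab
... | x ∷ c , cyc , _ = inj₁ (x ∷ c , x , cyc , here refl)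

module Extremality {n} (G₁ G₂ : MixedGraph n) (same : SameAdj G₁ G₂) where

  twice-cyclo : VSet n → ℕ
  twice-cyclo S = cyclo (sub G₁ S) + cyclo (sub G₁ S)

  rank-bound : ∀ S → rk (sub G₁ S) + (n + n) ≤ rk (sub G₂ S) + twice-cyclo S
  rank-bound S = go S (<-wellFounded (countFin S))
    where
    lemma : ∀ b c → suc (suc b) + (c + c) ≡ b + (suc c + suc c)
    lemma = ℕ-solve-∀
    go : ∀ S → Acc _<_ (countFin S) → rk (sub G₁ S) + (n + n) ≤ rk (sub G₂ S) + twice-cyclo S
    go S (acc rec) with FinP.any? (Pendant? G₁ S)
    ... | yes (v , pendant) with Pendant⇒Leaf G₁ pendant
    ... | w , ℓ = begin
      rk (sub G₁ S) + (n + n)  ≡⟨ cong (_+ (n + n)) (rank-pendant G₁ ℓ) ⟩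
      suc (suc (rk (sub G₁ S′) + (n + n)))  ≤⟨ s≤s (s≤s (go S′ (rec (countFin-removeTwo S (proj₁ pendant))))) ⟩
      suc (suc (rk (sub G₂ S′))) + twice-cyclo S′ ≤⟨ ℕP.+-mono-≤ (ℕP.≤-reflexive (sym (rank-pendant G₂ (Leaf-SameAdj G₁ G₂ same ℓ)))) (ℕP.+-mono-≤ mono mono) ⟩
      rk (sub G₂ S) + twice-cyclo S  ∎
      where
      open ℕP.≤-Reasoning
      S′ = removeTwo S v w
      mono : cyclo (sub G₁ S′) ≤ cyclo (sub G₁ S)
      mono = cyclo-mono (sub G₁ S) (removeTwo-⊑ G₁ S v w)
    go S (acc rec) | no ¬pendant with cycle-or-edgeless G₁ S (λ v p → ¬pendant (v , p))
    ... | inj₂ ¬adj = subst₂ _≤_ (sym (cong (_+ (n + n)) (rank-edgeless G₁ S ¬adj)))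
                        (sym (cong (λ k → rk (sub G₂ S) + (k + k)) (cyclo-edgeless (sub G₁ S) ¬adj))) (ℕP.m≤n+m (n + n) (rk (sub G₂ S)))
    ... | inj₁ (c , x , cyc , x∈) = begin
      rk (sub G₁ S) + (n + n)  ≤⟨ ℕP.+-monoˡ-≤ (n + n) (rank-≤-∖+2 G₁ S x) ⟩
      suc (suc (rk (sub G₁ S′) + (n + n)))  ≤⟨ s≤s (s≤s (go S′ (rec (countFin-∖-< S (∈-cycle-sub G₁ S cyc x∈))))) ⟩
      suc (suc (rk (sub G₂ S′))) + twice-cyclo S′ ≡⟨ lemma (rk (sub G₂ S′)) (cyclo (sub G₁ S′)) ⟩
      rk (sub G₂ S′) + (suc (cyclo (sub G₁ S′)) + suc (cyclo (sub G₁ S′))) ≤⟨ ℕP.+-mono-≤ (rank-∖-≤ G₂ S x) (ℕP.+-mono-≤ drop drop) ⟩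
      rk (sub G₂ S) + twice-cyclo S  ∎
      where
      open ℕP.≤-Reasoning
      S′ = S ∖ x
      drop : suc (cyclo (sub G₁ S′)) ≤ cyclo (sub G₁ S)
      drop = cyclo-drop-cycle (sub G₁ S) (∖-⊑ G₁ S x) cyc x∈ (∖-isolated G₁ S x)

  -- rk − r = 2d, with 2n added to both sides.
  record Extremal (S : VSet n) : Set where
    constructor extremal
    field
      balance : rk (sub G₁ S) + (n + n) ≡ rk (sub G₂ S) + twice-cyclo S
  open Extremal public

  private
    squeeze : ∀ {p p′ q q′} → p ≤ p′ → q ≤ q′ → p′ + q′ ≤ p + q → p ≡ p′ × q ≡ q′
    squeeze {p} {p′} {q} {q′} p≤ q≤ le =
      ℕP.≤-antisym p≤ (ℕP.+-cancelʳ-≤ q′ p′ p (ℕP.≤-trans le (ℕP.+-monoʳ-≤ p q≤))) ,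
      ℕP.≤-antisym q≤ (ℕP.+-cancelˡ-≤ p′ q′ q (ℕP.≤-trans le (ℕP.+-monoˡ-≤ q p≤)))

    half : ∀ {p q} → p ≤ q → q + q ≤ p + p → p ≡ q
    half p≤q le = proj₁ (squeeze p≤q p≤q le)

    cycle-arithmetic : ∀ {N a a′ b b′ c c′} → a + N ≡ b + (c + c) → a′ + N ≤ b′ + (c′ + c′) →
      a ≤ suc (suc a′) → b′ ≤ b → suc c′ ≤ c →
      a ≡ suc (suc a′) × b ≡ b′ × c ≡ suc c′ × a′ + N ≡ b′ + (c′ + c′)
    cycle-arithmetic {N} {a} {a′} {b} {b′} {c} {c′} bal bound a≤ b′≤ c′< =
      a≡ , sym b′≡b , sym c′≡c , ext′
      where
      lemma : ∀ b c → suc (suc b) + (c + c) ≡ b + (suc c + suc c)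
      lemma = ℕ-solve-∀
      upper : a + N ≤ suc (suc (b′ + (c′ + c′)))
      upper = ℕP.≤-trans (ℕP.+-monoˡ-≤ N a≤) (s≤s (s≤s bound))
      sq = squeeze b′≤ (ℕP.+-mono-≤ c′< c′<) (subst₂ _≤_ bal (lemma b′ c′) upper)
      b′≡b = proj₁ sq
      c′≡c = half c′< (ℕP.≤-reflexive (sym (proj₂ sq)))
      lower : suc (suc (b′ + (c′ + c′))) ≡ a + N
      lower = trans (lemma b′ c′) (trans (cong₂ (λ x y → x + (y + y)) b′≡b c′≡c) (sym bal))
      a≡ : a ≡ suc (suc a′)
      a≡ = ℕP.≤-antisym a≤ (ℕP.+-cancelʳ-≤ N _ a (ℕP.≤-trans (s≤s (s≤s bound)) (ℕP.≤-reflexive lower)))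
      ext′ : a′ + N ≡ b′ + (c′ + c′)
      ext′ = ℕP.suc-injective (ℕP.suc-injective (trans (cong (_+ N) (sym a≡)) (sym lower)))

    pendant-arithmetic : ∀ {N a a′ b b′ c c′} → a + N ≡ b + (c + c) → a′ + N ≤ b′ + (c′ + c′) →
      a ≡ suc (suc a′) → b ≡ suc (suc b′) → c′ ≤ c → c′ ≡ c × a′ + N ≡ b′ + (c′ + c′)
    pendant-arithmetic {N} {a′ = a′} {b′ = b′} {c} {c′} bal bound refl refl c′≤ =
      c′≡c , trans ext (cong (λ y → b′ + (y + y)) (sym c′≡c))
      where
      ext : a′ + N ≡ b′ + (c + c)
      ext = ℕP.suc-injective (ℕP.suc-injective bal)
      c′≡c : c′ ≡ c
      c′≡c = half c′≤ (ℕP.+-cancelˡ-≤ b′ _ _ (subst (_≤ b′ + (c′ + c′)) ext bound))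

  record CycleVertexRemoval (S : VSet n) (x : Fin n) : Set where
    field
      rank₁  : rk (sub G₁ S) ≡ suc (suc (rk (sub G₁ (S ∖ x))))
      rank₂  : rk (sub G₂ S) ≡ rk (sub G₂ (S ∖ x))
      cyclo≡   : cyclo (sub G₁ S) ≡ suc (cyclo (sub G₁ (S ∖ x)))
      residual : Extremal (S ∖ x)

  extremal-cycle : ∀ {S c x} → Extremal S → IsCycle (sub G₁ S) c → x ∈ c → CycleVertexRemoval S x
  extremal-cycle {S} {c} {x} ext cyc x∈ = record
    { rank₁ = proj₁ solved ; rank₂ = proj₁ (proj₂ solved) ; cyclo≡ = proj₁ (proj₂ (proj₂ solved))
    ; residual = extremal (proj₂ (proj₂ (proj₂ solved))) }
    where
    solved = cycle-arithmetic (balance ext) (rank-bound (S ∖ x)) (rank-≤-∖+2 G₁ S x) (rank-∖-≤ G₂ S x)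
      (cyclo-drop-cycle (sub G₁ S) (∖-⊑ G₁ S x) cyc x∈ (∖-isolated G₁ S x))

  extremal-pendant : ∀ {S v w} → Extremal S → Leaf G₁ S v w →
                     Extremal (removeTwo S v w) × cyclo (sub G₁ (removeTwo S v w)) ≡ cyclo (sub G₁ S)
  extremal-pendant {S} {v} {w} ext ℓ = extremal (proj₂ solved) , proj₁ solved
    where
    solved = pendant-arithmetic (balance ext) (rank-bound (removeTwo S v w)) (rank-pendant G₁ ℓ)
      (rank-pendant G₂ (Leaf-SameAdj G₁ G₂ same ℓ)) (cyclo-mono (sub G₁ S) (removeTwo-⊑ G₁ S v w))

  extremal-pendant-acyclic : ∀ {S v w c} → Extremal S → Leaf G₁ S v w → IsCycle (sub G₁ S) c → w ∉ c
  extremal-pendant-acyclic {S} {v} {w} ext ℓ cyc w∈ = ℕP.<⇒≢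
    (cyclo-drop-cycle (sub G₁ S) (removeTwo-⊑ G₁ S v w) cyc w∈ (removeTwo-isolated G₁ S v w))
    (proj₂ (extremal-pendant ext ℓ))


dot-single : ∀ {n} {w : Fin n} b v → (∀ j → j ≢ w → b j ⊗ v j ≡ 0i) → dot b v ≡ b w ⊗ v w
dot-single {w = w} b v off = trans (sum-cong-≗ (by-cases w (at w) λ j j≢w → trans (off j j≢w) (away j j≢w))) (dot-unit (λ j → b j ⊗ v j) w)
  where
  lemma : ∀ x → x ≡ x ⊗ 1i
  lemma = solve-∀ ℤi-ring
  at : ∀ j → b j ⊗ v j ≡ b j ⊗ v j ⊗ unit j j
  at j = trans (lemma (b j ⊗ v j)) (cong (b j ⊗ v j ⊗_) (sym (unit-refl j)))
  away : ∀ j → j ≢ w → 0i ≡ b j ⊗ v j ⊗ unit w j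
  away j j≢w = sym (trans (cong (b j ⊗ v j ⊗_) (unit-≢ j≢w)) (zeroʳ (b j ⊗ v j)))

no-pole : ∀ {n} {M : Mat n} → Hermitian M → ∀ {x z y} → (∀ i → (M ∙ z) i ≡ 0i) → z x ≢ 0i →
          (∀ i → i ≢ x → (M ∙ y) i ≡ 0i) → (M ∙ y) x ≢ 0i → ⊥
no-pole {M = M} herm {x} {z} {y} Mz≡0 zx≢0 My≡0 Myx≢0 = ⊗-≢0 (conj-≢0 zx≢0) Myx≢0
  (trans (sym (dot-supported (conj ∘ z) (M ∙ y) My≡0))
    (trans (adjoint herm z y) (sum-0 _ (λ j → trans (cong (λ a → conj a ⊗ y j) (Mz≡0 j)) (zeroˡ (y j))))))

cycle-through : ∀ {n} (G H : MixedGraph n) → H ⊑ G → ∀ {u w v} → (∀ y → ¬ Adj H u y) → Adj G u w → Adj G u v →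
                Conn H w v → v ≢ w → ∃[ c ] (IsCycle G c × CycleEdge c u w)
cycle-through G H H⊑G {u} {w} {v} isolated uw uv wv v≢w with Conn⇒Chain H wv
... | []  , []  , uniq = ⊥-elim (v≢w refl)
... | x ∷ xs , chain , uniq = u ∷ w ∷ x ∷ xs ,
      close-chain G (uw ∷ lift chain) (¬Any⇒All¬ _ (avoid (λ { refl → Adj-irrefl G uw }) chain) ∷ uniq) (Adj-sym G uv) (s≤s (s≤s z≤n)) ,
      inj₁ (here refl)
  where
  lift : ∀ {a as b} → Chain H a as b → Chain G a as b
  lift []  = []
  lift (ab ∷ c) = H⊑G ab ∷ lift c
  avoid : ∀ {a as b} → u ≢ a → Chain H a as b → u ∉ a ∷ as
  avoid u≢a c  (here refl) = u≢a refl
  avoid u≢a (ab ∷ c) (there u∈)  = avoid (λ { refl → isolated _ (Adj-sym H ab) }) c u∈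

module _ {n} (G : MixedGraph n) where

  record Free (S : VSet n) (w : Fin n) : Set where
    constructor free
    field
      vector  : Vec n
      kernel  : InKernel G S vector
      nonzero : vector w ≢ 0i

  isolated-free : ∀ S {w} → (∀ y → ¬ Adj (sub G S) w y) → Free S w
  isolated-free S {w} isolated = free (unit w)
    (λ i → trans (dot-unit (mat (sub G S) i) w) (mat-≡0 (sub G S) (isolated i ∘ Adj-sym (sub G S))))
    λ p → case (trans (sym (unit-refl w)) p)
    where
    case : 1i ≢ 0i
    case ()

  module _ {S a b} (ℓ : Leaf G S a b) where

    private
      M = mat (sub G S)
      open Leaf ℓ

    leaf-correction : Vec n → Vec n
    leaf-correction y i = M b a ⊗ y i ⊕ ⊖ (M ∙ y) b ⊗ unit a i

    leaf-correction-kernel : ∀ {y} → (∀ i → i ≢ b → (M ∙ y) i ≡ 0i) → InKernel G S (leaf-correction y)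
    leaf-correction-kernel {y} off i = trans (expand i) (by-cases {P = λ i → M b a ⊗ (M ∙ y) i ⊕ ⊖ (M ∙ y) b ⊗ M i a ≡ 0i} b
        (lemma₁ (M b a) ((M ∙ y) b))
        (λ i i≢b → trans (cong₂ (λ p q → M b a ⊗ p ⊕ ⊖ (M ∙ y) b ⊗ q) (off i i≢b)
                            (mat-≡0 (sub G S) (λ ia → i≢b (only i (Adj-sym (sub G S) ia)))))
                         (lemma₂ (M b a) ((M ∙ y) b))) i)
      where
      lemma₁ : ∀ p q → p ⊗ q ⊕ ⊖ q ⊗ p ≡ 0i
      lemma₁ = solve-∀ ℤi-ring
      lemma₂ : ∀ p q → p ⊗ 0i ⊕ ⊖ q ⊗ 0i ≡ 0i
      lemma₂ = solve-∀ ℤi-ring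
      expand : ∀ i → (M ∙ leaf-correction y) i ≡ M b a ⊗ (M ∙ y) i ⊕ ⊖ (M ∙ y) b ⊗ M i a
      expand i = trans (dot-linear (M i) (M b a) y (λ j → ⊖ (M ∙ y) b ⊗ unit a j))
        (cong (M b a ⊗ (M ∙ y) i ⊕_) (trans (dot-scale (M i) (⊖ (M ∙ y) b) (unit a)) (cong (⊖ (M ∙ y) b ⊗_) (dot-unit (M i) a))))

    leaf-correction-other : ∀ {y i} → i ≢ a → y i ≢ 0i → leaf-correction y i ≢ 0i
    leaf-correction-other {y} {i} i≢a yi≢0 p = ⊗-≢0 (mat-≢0 (sub G S) (Adj-sym (sub G S) edge)) yi≢0
      (trans (lemma (M b a ⊗ y i) ((M ∙ y) b)) (trans (cong (λ u → M b a ⊗ y i ⊕ ⊖ (M ∙ y) b ⊗ u) (sym (unit-≢ i≢a))) p))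
      where
      lemma : ∀ p q → p ≡ p ⊕ ⊖ q ⊗ 0i
      lemma = solve-∀ ℤi-ring

    leaf-correction-self : ∀ {y} → y a ≡ 0i → (M ∙ y) b ≢ 0i → leaf-correction y a ≢ 0i
    leaf-correction-self {y} ya≡0 Myb≢0 p = Myb≢0 (⊖-≡0⁻¹ (trans (lemma (M b a) ((M ∙ y) b))
      (trans (cong₂ (λ u v → M b a ⊗ u ⊕ ⊖ (M ∙ y) b ⊗ v) (sym ya≡0) (sym (unit-refl a))) p)))
      where
      lemma : ∀ p q → ⊖ q ≡ p ⊗ 0i ⊕ ⊖ q ⊗ 1i
      lemma = solve-∀ ℤi-ring

    free-removeTwo : ∀ {w} → w ≢ a → w ≢ b → Free (removeTwo S a b) w → Free S w
    free-removeTwo {w} w≢a w≢b (free z ker zw≢0) = free (leaf-correction (mask b z)) (leaf-correction-kernel off)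
      (leaf-correction-other w≢a (λ p → zw≢0 (trans (sym (mask-other z w≢b)) p)))
      where
      off : ∀ i → i ≢ b → (M ∙ mask b z) i ≡ 0i
      off i i≢b = trans (sym (delete-∙ M z i≢b)) (trans (∙-cong (mat-removeTwo G ℓ) z i) (ker i))

    leaf-removeTwo : ∀ {v t} → Leaf G (removeTwo S a b) v t → ¬ Adj (sub G S) v b → Leaf G S v t
    leaf-removeTwo {v} {t} (leaf vt only′) ¬vb = leaf (removeTwo-⊑ G S a b vt) λ y vy →
      only′ y (removeTwo-Adj⁺ G {S} v≢a v≢b (λ { refl → v≢b (only v (Adj-sym (sub G S) vy)) }) (λ { refl → ¬vb vy }) vy)
      where
      v∈ = removeTwo-true⁻ G {S} {a} {b} {v} (proj₁ (sub-Adj⁻ G (removeTwo S a b) vt))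
      v≢a = proj₁ (proj₂ v∈)
      v≢b = proj₂ (proj₂ v∈)

  -- Cut a kernel vector down to the component of w in K: seen in S, its image is concentrated at u.
  component-pole : ∀ {S K u w} → (∀ i j → delete u (mat (sub G S)) i j ≡ mat (sub G K) i j) → (∀ y → ¬ Adj (sub G K) u y) →
    Adj (sub G S) u w → (∀ v → Adj (sub G S) u v → Conn (sub G K) w v → v ≡ w) → Free K w →
    ∃[ y ] ((∀ i → i ≢ u → (mat (sub G S) ∙ y) i ≡ 0i) × (mat (sub G S) ∙ y) u ≢ 0i × (∀ v → ¬ Conn (sub G K) w v → y v ≡ 0i))
  component-pole {S} {K} {u} {w} del isolated uw no-return (free z ker zw≢0) = y , off , at , outside
    where
    H = sub G K
    M = mat (sub G S)
    y : Vec n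
    y v = if reach H w v then z v else 0i
    inside : ∀ {v} → Conn H w v → y v ≡ z v
    inside {v} c = cong (λ b → if b then z v else 0i) (Conn⇒reach H c)
    outside : ∀ v → ¬ Conn H w v → y v ≡ 0i
    outside v ¬c = cong (λ b → if b then z v else 0i) (¬-not (¬c ∘ reach⇒Conn H))
    Conn-isolated : ∀ {x y} → Conn H x y → y ≡ u → x ≡ u
    Conn-isolated ε  eq = eq
    Conn-isolated (xy ◅ c) eq with Conn-isolated c eq
    ... | refl = ⊥-elim (isolated _ (Adj-sym H xy))
    yu≡0 : y u ≡ 0i
    yu≡0 = outside u (λ c → Adj⇒≢ (sub G S) uw (sym (Conn-isolated c refl)))
    row : ∀ i → (mat H ∙ y) i ≡ 0i
    row i with Conn? H w i
    ... | yes c = trans (sum-cong-≗ term) (ker i)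
      where
      term : ∀ j → mat H i j ⊗ y j ≡ mat H i j ⊗ z j
      term j with adjB H i j ≟ᴮ true
      ... | yes ij = cong (mat H i j ⊗_) (inside (c ◅◅ (ij ◅ ε)))
      ... | no ¬ij = trans (cong (_⊗ y j) (mat-≡0 H ¬ij)) (trans (trans (zeroˡ (y j)) (sym (zeroˡ (z j)))) (cong (_⊗ z j) (sym (mat-≡0 H ¬ij))))
    ... | no ¬c = sum-0 _ term
      where
      term : ∀ j → mat H i j ⊗ y j ≡ 0i
      term j with adjB H i j ≟ᴮ true
      ... | yes ij = trans (cong (mat H i j ⊗_) (outside j (λ c → ¬c (c ◅◅ (Adj-sym H ij ◅ ε))))) (zeroʳ (mat H i j))
      ... | no ¬ij = trans (cong (_⊗ y j) (mat-≡0 H ¬ij)) (zeroˡ (y j))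
    off : ∀ i → i ≢ u → (M ∙ y) i ≡ 0i
    off i i≢u = trans (sym (delete-∙-id M yu≡0 i≢u)) (trans (∙-cong del y i) (row i))
    term-u : ∀ j → j ≢ w → M u j ⊗ y j ≡ 0i
    term-u j j≢w with adjB (sub G S) u j ≟ᴮ true
    ... | yes uj = trans (cong (M u j ⊗_) (outside j (λ c → j≢w (no-return j uj c)))) (zeroʳ (M u j))
    ... | no ¬uj = trans (cong (_⊗ y j) (mat-≡0 (sub G S) ¬uj)) (zeroˡ (y j))
    at : (M ∙ y) u ≢ 0i
    at p = ⊗-≢0 (mat-≢0 (sub G S) uw) (λ q → zw≢0 (trans (sym (inside ε)) q)) (trans (sym (dot-single (M u) y term-u)) p)


module Terminality {n} (G₁ G₂ : MixedGraph n) (same : SameAdj G₁ G₂) where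

  open Extremality G₁ G₂ same

  private
    Adj₁ Adj₂ : VSet n → Fin n → Fin n → Set
    Adj₁ S = Adj (sub G₁ S)
    Adj₂ S = Adj (sub G₂ S)

    to₂ : ∀ S {u v} → Adj₁ S u v → Adj₂ S u v
    to₂ S {u} {v} uv = trans (sym (sub-SameAdj G₁ G₂ same S u v)) uv

    to₁ : ∀ S {u v} → Adj₂ S u v → Adj₁ S u v
    to₁ S {u} {v} uv = trans (sub-SameAdj G₁ G₂ same S u v) uv

    Conn₁ : ∀ S {u v} → Conn (sub G₂ S) u v → Conn (sub G₁ S) u v
    Conn₁ S = Star.map (to₁ S)

  extremal-CycleEdge : ∀ {S c₁ c₂ v₀} → Extremal S → IsCycle (sub G₁ S) c₁ → IsCycle (sub G₁ S) c₂ →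
                       v₀ ∈ c₁ → v₀ ∈ c₂ → ∀ {u v} → CycleEdge c₁ u v → CycleEdge c₂ u v
  extremal-CycleEdge {S} {c₁} {c₂} ext cyc₁ cyc₂ v₀∈c₁ v₀∈c₂ = cycles-agree (sub G₁ S) {c₁} {c₂} cyc₁ v₀∈c₁ v₀∈c₂ λ {x} x∈ →
    CycleEdge-shared (sub G₁ S) {sub G₁ (S ∖ x)} (∖-⊑ G₁ S x) cyc₁ cyc₂ x∈ (∖-isolated G₁ S x)
      (ℕP.≤-reflexive (CycleVertexRemoval.cyclo≡ (extremal-cycle ext cyc₂ x∈)))

  extremal-cycle-free : ∀ {S c x} → Extremal S → IsCycle (sub G₁ S) c → x ∈ c → Free G₂ S x
  extremal-cycle-free {S} ext cyc x∈ =
    let z , ker , zx≢0 = rank-kernel⁻¹ G₂ S (CycleVertexRemoval.rank₂ (extremal-cycle ext cyc x∈)) in free z ker zx≢0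

  record PendantBeyond (K : VSet n) (w : Fin n) : Set where
    constructor beyond
    field
      vertex  : Fin n
      pendant   : Pendant G₁ K vertex
      distinct  : vertex ≢ w
      connected : Conn (sub G₁ K) w vertex

  LeafLemma : VSet n → Set
  LeafLemma K = Extremal K → ∀ {w} → ¬ Free G₂ K w → PendantBeyond K w

  terminal-CycleEdge : ∀ {S} → (∀ {u} → S u ≡ true → LeafLemma (S ∖ u)) → Extremal S → NoPendant G₁ S →
                       ∀ {c u w} → IsCycle (sub G₁ S) c → u ∈ c → Adj₁ S u w → CycleEdge c u w
  terminal-CycleEdge {S} IH ext noPendant {c} {u} {w} cyc u∈ uw with CycleEdge? c u w
  ... | yes uw∈ = uw∈
  ... | no ¬uw∈ = ⊥-elim contradict
    where
    no-return : ∀ v → Adj₁ S u v → Conn (sub G₁ (S ∖ u)) w v → v ≡ w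
    no-return v uv wv with v FinP.≟ w
    ... | yes v≡w = v≡w
    ... | no v≢w  = let c′ , cyc′ , uw∈ = cycle-through (sub G₁ S) (sub G₁ (S ∖ u)) (∖-⊑ G₁ S u) (∖-isolated G₁ S u) uw uv wv v≢w
                    in ⊥-elim (¬uw∈ (extremal-CycleEdge ext cyc′ cyc (CycleEdge-∈ˡ uw∈) u∈ uw∈))
    ¬free : ¬ Free G₂ (S ∖ u) w
    ¬free fr = let u-free = extremal-cycle-free ext cyc u∈
                   y , off , at , _ = component-pole G₂ {S} {S ∖ u} {u} {w} (mat-∖ G₂ S u) (∖-isolated G₂ S u) (to₂ S uw)
                                        (λ v uv wv → no-return v (to₁ S uv) (Conn₁ (S ∖ u) wv)) fr
               in no-pole {M = mat (sub G₂ S)} (mat-hermitian (sub G₂ S)) {u} {Free.vector u-free} {y} (Free.kernel u-free) (Free.nonzero u-free) off at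
    finish : PendantBeyond (S ∖ u) w → ⊥
    finish (beyond v pendant v≢w wv) with Pendant⇒Leaf G₁ pendant
    ... | t , leaf vt only = noPendant v (Leaf⇒Pendant G₁ (leaf (∖-⊑ G₁ S u vt) λ y vy → only y (∖-Adj⁺ G₁ {S} v≢u (y≢u vy) vy)))
      where
      v≢u : v ≢ u
      v≢u refl = ∖-isolated G₁ S u t vt
      y≢u : ∀ {y} → Adj₁ S v y → y ≢ u
      y≢u vu refl = v≢w (no-return v (Adj-sym (sub G₁ S) vu) wv)
    contradict : ⊥
    contradict = finish (IH (∈-cycle-sub G₁ S cyc u∈) (CycleVertexRemoval.residual (extremal-cycle ext cyc u∈)) ¬free)

  terminal-on-cycle : ∀ {S} → (∀ {u} → S u ≡ true → LeafLemma (S ∖ u)) → Extremal S → NoPendant G₁ S →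
                      ∀ {a b} → Adj₁ S a b → ∃[ c ] (IsCycle (sub G₁ S) c × a ∈ c)
  terminal-on-cycle {S} IH ext noPendant ab with lollipop (sub G₁ S) (λ vw → branching G₁ {S} vw (noPendant _)) ab
  ... | c , cyc , inj₁ a∈ = c , cyc , a∈
  ... | c , cyc , inj₂ (p , q , p∈ , q∉ , pq) =
    ⊥-elim (q∉ (CycleEdge-∈ˡ {c = c} (CycleEdge-sym {c = c} (terminal-CycleEdge IH ext noPendant cyc p∈ pq))))

  leaf-lemma : ∀ K → LeafLemma K
  leaf-lemma K = go K (<-wellFounded (countFin K))
    where
    go : ∀ K → Acc _<_ (countFin K) → LeafLemma K
    go K (acc rec) ext {w} ¬free with FinP.any? (λ v → Pendant? G₁ K v ×-dec ¬? (v FinP.≟ w))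
    ... | yes (v , pendant , v≢w) with Pendant⇒Leaf G₁ pendant
    ... | v′ , ℓ with v′ FinP.≟ w
    ... | yes refl = beyond v pendant v≢w (Adj-sym (sub G₁ K) (Leaf.edge ℓ) ◅ ε)
    ... | no v′≢w = extend (go K″ (rec (countFin-removeTwo K (proj₁ pendant))) (proj₁ (extremal-pendant ext ℓ))
                        (λ fr → ¬free (free-removeTwo G₂ (Leaf-SameAdj G₁ G₂ same ℓ) (v≢w ∘ sym) (v′≢w ∘ sym) fr)))
      where
      K″ = removeTwo K v v′
      lift : ∀ {x} → Conn (sub G₁ K″) w x → Conn (sub G₁ K) w x
      lift = Conn-mono (sub G₁ K) (sub G₁ K″) (removeTwo-⊑ G₁ K v v′)
      extend : PendantBeyond K″ w → PendantBeyond K w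
      extend (beyond v₂ pendant₂ v₂≢w wv₂) with adjB (sub G₁ K) v₂ v′ ≟ᴮ true
      ... | yes v₂v′ = beyond v pendant v≢w (lift wv₂ ◅◅ (v₂v′ ◅ Adj-sym (sub G₁ K) (Leaf.edge ℓ) ◅ ε))
      ... | no ¬v₂v′ = beyond v₂ (Leaf⇒Pendant G₁ (leaf-removeTwo G₁ ℓ (proj₂ (Pendant⇒Leaf G₁ pendant₂)) ¬v₂v′)) v₂≢w (lift wv₂)
    go K (acc rec) ext {w} ¬free | no ¬other with Pendant? G₁ K w
    ... | no ¬pendant-w = ⊥-elim (¬free fr)
      where
      noPendant : NoPendant G₁ K
      noPendant v pendant with v FinP.≟ w
      ... | yes refl = ¬pendant-w pendant
      ... | no v≢w   = ¬other (v , pendant , v≢w)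
      fr : Free G₂ K w
      fr with FinP.any? (λ b → adjB (sub G₁ K) w b ≟ᴮ true)
      ... | no ¬wb = isolated-free G₂ K (λ y wy → ¬wb (y , to₁ K wy))
      ... | yes (b , wb) = let c , cyc , w∈ = terminal-on-cycle (λ {u} ku → go (K ∖ u) (rec (countFin-∖-< K ku))) ext noPendant wb
                           in extremal-cycle-free ext cyc w∈
    ... | yes pendant-w with Pendant⇒Leaf G₁ pendant-w
    ... | p , ℓ with branching G₁ {K} (Adj-sym (sub G₁ K) (Leaf.edge ℓ)) (λ pendant-p → ¬other (p , pendant-p , Adj⇒≢ (sub G₁ K) (Leaf.edge ℓ) ∘ sym))
    ... | q , pq , q≢w = ⊥-elim contradict
      where
      K′ = removeTwo K w p
      ℓ₂ : Leaf G₂ K w p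
      ℓ₂ = Leaf-SameAdj G₁ G₂ same ℓ
      no-return : ∀ v → Adj₁ K p v → Conn (sub G₁ K′) q v → v ≡ q
      no-return v pv qv with v FinP.≟ q
      ... | yes v≡q = v≡q
      ... | no v≢q  = let c , cyc , pq∈ = cycle-through (sub G₁ K) (sub G₁ K′) (removeTwo-⊑ G₁ K w p) (removeTwo-isolated G₁ K w p) pq pv qv v≢q
                      in ⊥-elim (extremal-pendant-acyclic ext ℓ cyc (CycleEdge-∈ˡ pq∈))
      isolated-end : ∀ {x y} → Conn (sub G₂ K′) x y → y ≡ w → x ≡ w
      isolated-end ε  eq = eq
      isolated-end (xy ◅ c) eq with isolated-end c eq
      ... | refl = ⊥-elim (removeTwo-isolated′ G₂ K w p _ (Adj-sym (sub G₂ K′) xy))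
      ¬free-q : ¬ Free G₂ K′ q
      ¬free-q free-q =
        let y , off , at , outside = component-pole G₂ {K} {K′} {p} {q} (mat-removeTwo G₂ ℓ₂) (removeTwo-isolated G₂ K w p) (to₂ K pq)
                                       (λ v pv qv → no-return v (to₁ K pv) (Conn₁ K′ qv)) free-q
        in ¬free (free (leaf-correction G₂ ℓ₂ y) (leaf-correction-kernel G₂ ℓ₂ {y} off)
                  (leaf-correction-self G₂ ℓ₂ {y} (outside w (λ c → q≢w (isolated-end c refl))) at))
      finish : PendantBeyond K′ q → ⊥
      finish (beyond v pendant v≢q qv) with Pendant⇒Leaf G₁ pendant
      ... | t , ℓ′ = ¬other (v , Leaf⇒Pendant G₁ (leaf-removeTwo G₁ ℓ ℓ′ (λ vp → v≢q (no-return v (Adj-sym (sub G₁ K) vp) qv))) ,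
                     (λ { refl → removeTwo-isolated′ G₁ K w p t (Leaf.edge ℓ′) }))
      contradict : ⊥
      contradict = finish (go K′ (rec (countFin-removeTwo K (proj₁ pendant-w))) (proj₁ (extremal-pendant ext ℓ)) ¬free-q)


-- Kernel vectors along a cycle

sgn : ℕ → ℤi
sgn zero  = 1i
sgn (suc k) = ⊖ sgn k

sgn-even : ∀ k → sgn (k + k) ≡ 1i
sgn-even zero  = refl
sgn-even (suc k) = trans (cong (⊖_ ∘ sgn) (ℕP.+-suc k k)) (trans (⊖-involutive (sgn (k + k))) (sgn-even k))

-1⊗ : ∀ a → ⊖ 1i ⊗ a ≡ ⊖ a
-1⊗ = solve-∀ ℤi-ring

parity : ∀ l → ∃[ k ] (l ≡ k + k ⊎ l ≡ suc (k + k))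
parity zero = 0 , inj₁ refl
parity (suc l) with parity l
... | k , inj₁ refl = k , inj₂ refl
... | k , inj₂ refl = suc k , inj₁ (cong suc (sym (ℕP.+-suc k k)))

sgn-period : ∀ {l a} → a ≢ 0i → (∀ k → l ≡ k + k → a ≡ sgn k ⊗ a) → a ≡ sgn l ⊗ a → l % 4 ≡ 0
sgn-period {l} {a} a≢0 half full with parity l
... | k , inj₂ refl = ⊥-elim (a≢0 (≡⊖⇒≡0 (trans full (trans (cong (λ s → ⊖ s ⊗ a) (sgn-even k)) (-1⊗ a)))))
... | k , inj₁ refl with parity k
... | m , inj₁ refl = trans (cong (_% 4) (lemma m)) (m*n%n≡0 m 4)
  where
  lemma : ∀ m → m + m + (m + m) ≡ m ℕ.* 4
  lemma = ℕ-solve-∀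
... | m , inj₂ refl = ⊥-elim (a≢0 (≡⊖⇒≡0 (trans (half k refl) (trans (cong (λ s → ⊖ s ⊗ a) (sgn-even m)) (-1⊗ a)))))

dot-pair : ∀ {n} {a b : Fin n} f v → a ≢ b → (∀ j → j ≢ a → j ≢ b → f j ⊗ v j ≡ 0i) → dot f v ≡ f a ⊗ v a ⊕ f b ⊗ v b
dot-pair {a = a} {b} f v a≢b off = begin
  dot f v  ≡⟨ dot-cong f split ⟩
  dot f (λ i → v a ⊗ unit a i ⊕ mask a v i)  ≡⟨ dot-linear f (v a) (unit a) (mask a v) ⟩
  v a ⊗ dot f (unit a) ⊕ dot f (mask a v)  ≡⟨ cong₂ _⊕_ (trans (cong (v a ⊗_) (dot-unit f a)) (*-comm (v a) (f a)))
                                                       (trans (dot-single f (mask a v) masked) (cong (f b ⊗_) (mask-other v (a≢b ∘ sym)))) ⟩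
  f a ⊗ v a ⊕ f b ⊗ v b  ∎
  where
  open ≡-Reasoning
  lemma₁ : ∀ x → x ≡ x ⊗ 1i ⊕ 0i
  lemma₁ = solve-∀ ℤi-ring
  lemma₂ : ∀ x y → x ≡ y ⊗ 0i ⊕ x
  lemma₂ = solve-∀ ℤi-ring
  split : ∀ i → v i ≡ v a ⊗ unit a i ⊕ mask a v i
  split = by-cases a (trans (lemma₁ (v a)) (cong₂ (λ p q → v a ⊗ p ⊕ q) (sym (unit-refl a)) (sym (mask-self a v))))
    λ i i≢a → trans (lemma₂ (v i) (v a)) (cong₂ (λ p q → v a ⊗ p ⊕ q) (sym (unit-≢ i≢a)) (sym (mask-other v i≢a)))
  masked : ∀ j → j ≢ b → f j ⊗ mask a v j ≡ 0i
  masked = by-cases {P = λ j → j ≢ b → f j ⊗ mask a v j ≡ 0i} a (λ _ → trans (cong (f a ⊗_) (mask-self a v)) (zeroʳ (f a)))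
    λ j j≢a j≢b → trans (cong (f j ⊗_) (mask-other v j≢a)) (off j j≢a j≢b)

links-succ-unique : ∀ {A : Set} {x : A} {xs z b s t} → Unique (x ∷ xs) → (b , s) ∈ links x xs z → (b , t) ∈ links x xs z → s ≡ t
links-succ-unique {xs = []}  u (here refl) (here refl) = refl
links-succ-unique {xs = _ ∷ _}  u (here refl) (here refl) = refl
links-succ-unique {xs = _ ∷ _}  u (here refl) (there bt)  = ⊥-elim (∉-head u (links-∈ˡ bt))
links-succ-unique {xs = _ ∷ _}  u (there bs)  (here refl) = ⊥-elim (∉-head u (links-∈ˡ bs))
links-succ-unique {xs = _ ∷ _}  (_ ∷ u) (there bs) (there bt) = links-succ-unique u bs bt

links-pred-unique : ∀ {A : Set} {x : A} {xs z b s t} → Unique (xs ++ [ z ]) → (s , b) ∈ links x xs z → (t , b) ∈ links x xs z → s ≡ t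
links-pred-unique {xs = []}  u (here refl) (here refl) = refl
links-pred-unique {xs = _ ∷ _}  u (here refl) (here refl) = refl
links-pred-unique {xs = _ ∷ _}  u (here refl) (there tb)  = ⊥-elim (∉-head u (links-∈ʳ tb))
links-pred-unique {xs = _ ∷ _}  u (there sb)  (here refl) = ⊥-elim (∉-head u (links-∈ʳ sb))
links-pred-unique {xs = _ ∷ _}  (_ ∷ u) (there sb) (there tb) = links-pred-unique u sb tb

label-norm : ∀ l → l ≢ o → labℤi l ⊗ conj (labℤi l) ≡ 1i
label-norm o  l≢o = ⊥-elim (l≢o refl)
label-norm e  _   = refl
label-norm ar _   = refl
label-norm ra _   = refl

mat-norm : ∀ {n} (H : MixedGraph n) {u v} → Adj H u v → mat H u v ⊗ conj (mat H u v) ≡ 1i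
mat-norm H {u} {v} uv = label-norm (h H u v) (λ p → true≢false uv (cong (not ∘ isO) p))

phase : ℕ → ℤi → ℤi → ℤi
phase zero  p q = p
phase (suc k) p q = phase k q (⊖ p)

phase-period : ∀ k p q → k % 4 ≡ 0 → phase k p q ≡ p
phase-period 0 p q _ = refl
phase-period 1 p q ()
phase-period 2 p q ()
phase-period 3 p q ()
phase-period (suc (suc (suc (suc k)))) p q eq = trans
  (cong₂ (phase k) (⊖-involutive p) (⊖-involutive q))
  (phase-period k p q (trans (sym ([m+n]%n≡m%n k 4)) (trans (cong (_% 4) (ℕP.+-comm k 4)) eq)))

phase-before-period : ∀ k p q → suc k % 4 ≡ 0 → phase k p q ≡ ⊖ q
phase-before-period k p q eq = trans (cong (phase k p) (sym (⊖-involutive q))) (phase-period (suc k) (⊖ q) p eq)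

module CycleVectors {n} (H : MixedGraph n) {x : Fin n} {xs} (cyc : IsCycle H (x ∷ xs))
                    (closed : ∀ {u w} → u ∈ x ∷ xs → Adj H u w → CycleEdge (x ∷ xs) u w) where

  private
    M = mat H
    uniq = cycle-unique H cyc

  Succ : Fin n → Fin n → Set
  Succ a b = (a , b) ∈ cyclicPairs (x ∷ xs)

  pred≢succ : ∀ {a b} → Succ a b → ¬ Succ b a
  pred≢succ {a} {b} ab ba with rotate H cyc (cyclicPairs-∈ˡ ab)
  ... | rotation [] (s≤s () , _) _ _ _
  ... | rotation (_ ∷ []) (s≤s (s≤s ()) , _) _ _ _
  ... | rotation (b′ ∷ t ∷ ts) cyc′ pairs⇒ _ _ with links-succ-unique (cycle-unique H cyc′) (pairs⇒ ab) (here refl)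
  ... | refl with links-succ-unique (cycle-unique H cyc′) (pairs⇒ ba) (there (here refl))
  ... | refl = ∉-head (cycle-unique H cyc′) (there (here refl))

  row : ∀ {a b c} → Succ a b → Succ b c → ∀ v → (M ∙ v) b ≡ M b a ⊗ v a ⊕ M b c ⊗ v c
  row {a} {b} {c} ab bc v = dot-pair (M b) v (λ { refl → pred≢succ ab bc }) off
    where
    off : ∀ j → j ≢ a → j ≢ c → M b j ⊗ v j ≡ 0i
    off j j≢a j≢c with adjB H b j ≟ᴮ true
    ... | no ¬bj = trans (cong (_⊗ v j) (mat-≡0 H ¬bj)) (zeroˡ (v j))
    ... | yes bj with closed (cyclicPairs-∈ʳ {c = x ∷ xs} ab) bj
    ... | inj₁ b→j = ⊥-elim (j≢c (links-succ-unique uniq b→j bc))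
    ... | inj₂ j→b = ⊥-elim (j≢a (links-pred-unique (Unique-++-comm [ x ] uniq) j→b ab))

  data Steps : ℕ → Fin n → Fin n → Set where
    done : ∀ {a} → Steps 0 a a
    step : ∀ {k a b c} → Succ a b → Steps k b c → Steps (suc k) a c

  _++ˢ_ : ∀ {k l a b c} → Steps k a b → Steps l b c → Steps (k + l) a c
  done  ++ˢ t = t
  step ab s ++ˢ t = step ab (s ++ˢ t)

  full-turn : Steps (length (x ∷ xs)) x x
  full-turn = along x xs id
    where
    along : ∀ a as → (∀ {p} → p ∈ links a as x → p ∈ cyclicPairs (x ∷ xs)) → Steps (suc (length as)) a x
    along a []  sub = step (sub (here refl)) done
    along a (b ∷ as) sub = step (sub (here refl)) (along b as (sub ∘ there))

  module _ (all-ones : ∀ {u v} → Adj H u v → M u v ≡ 1i) where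

    Steps-sgn : ∀ {z} → (∀ i → (M ∙ z) i ≡ 0i) → ∀ k {a b} → Steps (k + k) a b → z b ≡ sgn k ⊗ z a
    Steps-sgn {z} ker zero  {a} done = lemma (z a)
      where
      lemma : ∀ p → p ≡ 1i ⊗ p
      lemma = solve-∀ ℤi-ring
    Steps-sgn {z} ker (suc k) {a} {b} s = two (subst (λ m → Steps (suc m) a b) (ℕP.+-suc k k) s)
      where
      lemma₁ : ∀ p q → q ≡ 1i ⊗ p ⊕ 1i ⊗ q ⊕ ⊖ p
      lemma₁ = solve-∀ ℤi-ring
      lemma₂ : ∀ s p → s ⊗ (0i ⊕ ⊖ p) ≡ ⊖ s ⊗ p
      lemma₂ = solve-∀ ℤi-ring
      two : ∀ {t} → Steps (suc (suc (k + k))) a t → z t ≡ sgn (suc k) ⊗ z a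
      two (step {b = b} ab (step {b = c} bc rest)) = trans (Steps-sgn {z} ker k rest) (trans (cong (sgn k ⊗_) zc) (lemma₂ (sgn k) (z a)))
        where
        zc : z c ≡ 0i ⊕ ⊖ z a
        zc = trans (lemma₁ (z a) (z c)) (cong (_⊕ ⊖ z a) (trans
          (cong₂ (λ p q → p ⊗ z a ⊕ q ⊗ z c) (sym (all-ones (Adj-sym H (cycle-Adj H cyc ab)))) (sym (all-ones (cycle-Adj H cyc bc))))
          (trans (sym (row ab bc z)) (ker b))))

    kernel⇒length%4 : ∀ {z} → (∀ i → (M ∙ z) i ≡ 0i) → z x ≢ 0i → length (x ∷ xs) % 4 ≡ 0
    kernel⇒length%4 {z} ker zx≢0 = sgn-period zx≢0
      (λ k eq → Steps-sgn {z} ker k (subst (λ l → Steps l x x) eq full-turn))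
      (Steps-sgn {z} ker (length (x ∷ xs)) (full-turn ++ˢ full-turn))

  data Along (V : Vec n) : Fin n → List (Fin n) → ℤi → ℤi → ℤi → Set where
    end  : ∀ {a P p q} → V a ≡ conj P ⊗ p → Along V a [] P p q
    _∷_  : ∀ {a b bs P p q} → V a ≡ conj P ⊗ p → Along V b bs (P ⊗ M a b) q (⊖ p) → Along V a (b ∷ bs) P p q

  Along-head : ∀ {V a as P p q} → Along V a as P p q → V a ≡ conj P ⊗ p
  Along-head (end eq) = eq
  Along-head (eq ∷ _) = eq

  Along-cong : ∀ {V W a as P p q} → (∀ {u} → u ∈ a ∷ as → V u ≡ W u) → Along V a as P p q → Along W a as P p q
  Along-cong V≗W (end eq) = end (trans (sym (V≗W (here refl))) eq)
  Along-cong V≗W (eq ∷ al) = trans (sym (V≗W (here refl))) eq ∷ Along-cong (V≗W ∘ there) al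

  -- Position i of the traversal carries conj (product of the first i labels) times the i-th term of p, q, -p, -q, p, ...
  trace : Fin n → List (Fin n) → ℤi → ℤi → ℤi → Vec n
  trace a []  P p q u = if does (u FinP.≟ a) then conj P ⊗ p else 0i
  trace a (b ∷ bs) P p q u = if does (u FinP.≟ a) then conj P ⊗ p else trace b bs (P ⊗ M a b) q (⊖ p) u

  trace-head : ∀ a as P p q → trace a as P p q a ≡ conj P ⊗ p
  trace-head a []  P p q rewrite dec-true (a FinP.≟ a) refl = refl
  trace-head a (b ∷ bs) P p q rewrite dec-true (a FinP.≟ a) refl = refl

  trace-tail : ∀ {a b bs P p q u} → u ≢ a → trace a (b ∷ bs) P p q u ≡ trace b bs (P ⊗ M a b) q (⊖ p) u
  trace-tail {a} {u = u} u≢a rewrite dec-false (u FinP.≟ a) u≢a = refl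

  trace-outside : ∀ a as P p q {u} → u ∉ a ∷ as → trace a as P p q u ≡ 0i
  trace-outside a []  P p q {u} u∉ rewrite dec-false (u FinP.≟ a) (u∉ ∘ here) = refl
  trace-outside a (b ∷ bs) P p q u∉ = trans (trace-tail {a} {b} {bs} {P} {p} {q} (u∉ ∘ here)) (trace-outside b bs (P ⊗ M a b) q (⊖ p) (u∉ ∘ there))

  trace-Along : ∀ a as P p q → Unique (a ∷ as) → Along (trace a as P p q) a as P p q
  trace-Along a []  P p q u = end (trace-head a [] P p q)
  trace-Along a (b ∷ bs) P p q u@(_ ∷ u′) = trace-head a (b ∷ bs) P p q ∷
    Along-cong (λ v∈ → sym (trace-tail {a} {b} {bs} {P} {p} {q} (λ { refl → ∉-head u v∈ }))) (trace-Along b bs (P ⊗ M a b) q (⊖ p) u′)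

  walkProduct : Fin n → List (Fin n) → Fin n → ℤi → ℤi
  walkProduct a []  z P = P ⊗ M a z
  walkProduct a (b ∷ bs) z P = walkProduct b bs z (P ⊗ M a b)

  Along-snoc : ∀ {V a as P p q} z → Along V a as P p q → V z ≡ conj (walkProduct a as z P) ⊗ phase (suc (length as)) p q →
               Along V a (as ++ [ z ]) P p q
  Along-snoc z (end eq)  Vz = eq ∷ end Vz
  Along-snoc z (eq ∷ al) Vz = eq ∷ Along-snoc z al Vz

  balanced : ∀ {a b c P p} (V : Vec n) → Adj H a b → Adj H b c → V a ≡ conj P ⊗ p → V c ≡ conj (P ⊗ M a b ⊗ M b c) ⊗ (⊖ p) →
             M b a ⊗ V a ⊕ M b c ⊗ V c ≡ 0i
  balanced {a} {b} {c} {P} {p} V ab bc Va Vc = begin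
    M b a ⊗ V a ⊕ M b c ⊗ V c
      ≡⟨ cong₂ _⊕_ (cong₂ _⊗_ (mat-hermitian H a b) Va) (cong (M b c ⊗_) (trans Vc (cong (_⊗ (⊖ p))
           (trans (conj-⊗ (P ⊗ M a b) (M b c)) (cong (_⊗ conj (M b c)) (conj-⊗ P (M a b))))))) ⟩
    conj (M a b) ⊗ (conj P ⊗ p) ⊕ M b c ⊗ (conj P ⊗ conj (M a b) ⊗ conj (M b c) ⊗ (⊖ p))
      ≡⟨ lemma (conj (M a b)) (conj P) p (M b c) (conj (M b c)) ⟩
    conj (M a b) ⊗ conj P ⊗ p ⊗ (1i ⊕ ⊖ (M b c ⊗ conj (M b c)))
      ≡⟨ cong (λ t → conj (M a b) ⊗ conj P ⊗ p ⊗ (1i ⊕ ⊖ t)) (mat-norm H bc) ⟩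
    conj (M a b) ⊗ conj P ⊗ p ⊗ 0i
      ≡⟨ zeroʳ (conj (M a b) ⊗ conj P ⊗ p) ⟩
    0i ∎
    where
    open ≡-Reasoning
    lemma : ∀ A B p m m̄ → A ⊗ (B ⊗ p) ⊕ m ⊗ (B ⊗ A ⊗ m̄ ⊗ (⊖ p)) ≡ A ⊗ B ⊗ p ⊗ (1i ⊕ ⊖ (m ⊗ m̄))
    lemma = solve-∀ ℤi-ring

  interior : ∀ {V : Vec n} {a P p q} as {z} → Along V a (as ++ [ z ]) P p q → (∀ {s} → s ∈ links a as z → s ∈ cyclicPairs (x ∷ xs)) →
             ∀ {b} → b ∈ as → (M ∙ V) b ≡ 0i
  interior {V} {a} {P} {p} (b ∷ [])  (Va ∷ (_ ∷ al)) sub (here refl) = trans (row (sub (here refl)) (sub (there (here refl))) V)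
    (balanced {a} {P = P} {p} V (cycle-Adj H cyc (sub (here refl))) (cycle-Adj H cyc (sub (there (here refl)))) Va (Along-head al))
  interior {V} {a} {P} {p} (b ∷ c ∷ as) (Va ∷ (_ ∷ al)) sub (here refl) = trans (row (sub (here refl)) (sub (there (here refl))) V)
    (balanced {a} {P = P} {p} V (cycle-Adj H cyc (sub (here refl))) (cycle-Adj H cyc (sub (there (here refl)))) Va (Along-head al))
  interior {V} {a} {P} {p} {q} (b ∷ as) (_ ∷ al) sub (there b∈) = interior {V} {b} {P ⊗ M a b} {q} {⊖ p} as al (sub ∘ there) b∈

  holonomy : ℤi
  holonomy = walkProduct x xs x 1i

  outside-row : ∀ {V : Vec n} → (∀ {u} → u ∉ x ∷ xs → V u ≡ 0i) → ∀ {b} → b ∉ x ∷ xs → (M ∙ V) b ≡ 0i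
  outside-row {V} V-out {b} b∉ = sum-0 _ term
    where
    term : ∀ j → M b j ⊗ V j ≡ 0i
    term j with j ∈? x ∷ xs | adjB H b j ≟ᴮ true
    ... | no j∉ | _  = trans (cong (M b j ⊗_) (V-out j∉)) (zeroʳ (M b j))
    ... | yes _ | no ¬bj = trans (cong (_⊗ V j) (mat-≡0 H ¬bj)) (zeroˡ (V j))
    ... | yes j∈ | yes bj = ⊥-elim (b∉ (CycleEdge-∈ˡ {c = x ∷ xs} (CycleEdge-sym {c = x ∷ xs} (closed j∈ (Adj-sym H bj)))))

  module _ (4∣length : length (x ∷ xs) % 4 ≡ 0) where

    module _ (p q : ℤi) (consistent : conj holonomy ⊗ p ≡ p) where

      wave : Vec n
      wave = trace x xs 1i p q

      private
        wave-x : wave x ≡ p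
        wave-x = trans (trace-head x xs 1i p q) (*-identityˡ p)

        closes : wave x ≡ conj holonomy ⊗ phase (length (x ∷ xs)) p q
        closes = trans wave-x (trans (sym consistent) (cong (conj holonomy ⊗_) (sym (phase-period (length (x ∷ xs)) p q 4∣length))))

      wave-Along : Along wave x (xs ++ [ x ]) 1i p q
      wave-Along = Along-snoc x (trace-Along x xs 1i p q uniq) closes

      wave-off : ∀ i → i ≢ x → (M ∙ wave) i ≡ 0i
      wave-off i i≢x with i ∈? x ∷ xs
      ... | yes (here i≡x)  = ⊥-elim (i≢x i≡x)
      ... | yes (there i∈)  = interior {wave} {x} {1i} {p} {q} xs wave-Along id i∈
      ... | no i∉  = outside-row {wave} (trace-outside x xs 1i p q) i∉

      Along-last : ∀ {V a P p q} as z → Along V a as P p q → ∃[ ℓ ] ∃[ P′ ] ((ℓ , z) ∈ links a as z ×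
                   V ℓ ≡ conj P′ ⊗ phase (length as) p q × walkProduct a as z P ≡ P′ ⊗ M ℓ z)
      Along-last {a = a} {P} []  z (end eq) = a , P , here refl , eq , refl
      Along-last  (b ∷ bs) z (_ ∷ al) with Along-last bs z al
      ... | ℓ , P′ , ℓz , Vℓ , prod = ℓ , P′ , there ℓz , Vℓ , prod

      wave-at : (M ∙ wave) x ≡ q ⊕ ⊖ (conj holonomy ⊗ q)
      wave-at = second xs refl
        where
        open ≡-Reasoning
        lemma : ∀ A B m m̄ q → A ⊗ (B ⊗ (⊖ q)) ⊕ m ⊗ (m̄ ⊗ q) ≡ (m ⊗ m̄) ⊗ q ⊕ ⊖ (B ⊗ A ⊗ q)
        lemma = solve-∀ ℤi-ring
        lemma′ : ∀ q b → 1i ⊗ q ⊕ ⊖ b ≡ q ⊕ ⊖ b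
        lemma′ = solve-∀ ℤi-ring
        second : ∀ ys → ys ≡ xs → (M ∙ wave) x ≡ q ⊕ ⊖ (conj holonomy ⊗ q)
        second [] eq = ⊥-elim (too-short (subst (λ l → 3 ≤ suc (length l)) (sym eq) (cycle-length H cyc)))
          where
          too-short : ¬ 3 ≤ 1
          too-short (s≤s ())
        second (y ∷ ys) refl with Along-last {wave} {x} {1i} {p} {q} (y ∷ ys) x (trace-Along x (y ∷ ys) 1i p q uniq)
        ... | ℓ , P′ , ℓx , Vℓ , prod = begin
          (M ∙ wave) x  ≡⟨ row ℓx (here refl) wave ⟩
          M x ℓ ⊗ wave ℓ ⊕ M x y ⊗ wave y  ≡⟨ cong₂ (λ s t → s ⊕ M x y ⊗ t)
            (cong₂ _⊗_ (mat-hermitian H ℓ x) (trans Vℓ (cong (conj P′ ⊗_) (phase-before-period (length (y ∷ ys)) p q 4∣length)))) wave-y ⟩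
          conj (M ℓ x) ⊗ (conj P′ ⊗ (⊖ q)) ⊕ M x y ⊗ (conj (M x y) ⊗ q)   ≡⟨ lemma (conj (M ℓ x)) (conj P′) (M x y) (conj (M x y)) q ⟩
          (M x y ⊗ conj (M x y)) ⊗ q ⊕ ⊖ (conj P′ ⊗ conj (M ℓ x) ⊗ q)  ≡⟨ cong₂ (λ s t → s ⊗ q ⊕ ⊖ (t ⊗ q)) (mat-norm H (cycle-Adj H cyc (here refl)))
                                                                              (trans (sym (conj-⊗ P′ (M ℓ x))) (cong conj (sym prod))) ⟩
          1i ⊗ q ⊕ ⊖ (conj holonomy ⊗ q)  ≡⟨ lemma′ q (conj holonomy ⊗ q) ⟩
          q ⊕ ⊖ (conj holonomy ⊗ q)  ∎
          where
          wave-y : wave y ≡ conj (M x y) ⊗ q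
          wave-y with trace-Along x (y ∷ ys) 1i p q uniq
          ... | _ ∷ al = trans (Along-head al) (cong (λ t → conj t ⊗ q) (*-identityˡ (M x y)))

      wave-self : wave x ≡ p
      wave-self = wave-x

    cycle-kernel : holonomy ≡ 1i → ∃[ z ] ((∀ i → (M ∙ z) i ≡ 0i) × z x ≢ 0i)
    cycle-kernel hol≡1 = wave 1i 0i consistent , kernel , λ z≡0 → 1≢0 (trans (sym (wave-self 1i 0i consistent)) z≡0)
      where
      1≢0 : 1i ≢ 0i
      1≢0 ()
      consistent : conj holonomy ⊗ 1i ≡ 1i
      consistent = cong (λ t → conj t ⊗ 1i) hol≡1
      kernel : ∀ i → (M ∙ wave 1i 0i consistent) i ≡ 0i
      kernel = by-cases x (trans (wave-at 1i 0i consistent) (cong (λ t → 0i ⊕ ⊖ t) (zeroʳ (conj holonomy)))) (wave-off 1i 0i consistent)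

    cycle-pole : holonomy ≢ 1i → ∃[ y ] ((∀ i → i ≢ x → (M ∙ y) i ≡ 0i) × (M ∙ y) x ≢ 0i × y x ≡ 0i)
    cycle-pole hol≢1 = wave 0i 1i consistent , wave-off 0i 1i consistent , pole , wave-self 0i 1i consistent
      where
      open ≡-Reasoning
      consistent : conj holonomy ⊗ 0i ≡ 0i
      consistent = zeroʳ (conj holonomy)
      lemma : ∀ t → t ≡ 1i ⊕ ⊖ (1i ⊕ ⊖ (t ⊗ 1i))
      lemma = solve-∀ ℤi-ring
      pole : (M ∙ wave 0i 1i consistent) x ≢ 0i
      pole p = hol≢1 (begin
        holonomy  ≡⟨ sym (conj-conj holonomy) ⟩
        conj (conj holonomy)  ≡⟨ cong conj (lemma (conj holonomy)) ⟩
        conj (1i ⊕ ⊖ (1i ⊕ ⊖ (conj holonomy ⊗ 1i)))  ≡⟨ cong (λ t → conj (1i ⊕ ⊖ t)) (trans (sym (wave-at 0i 1i consistent)) p) ⟩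
        1i  ∎)

  holonomy-ones : (∀ {u v} → Adj H u v → M u v ≡ 1i) → holonomy ≡ 1i
  holonomy-ones ones = go x xs (cycle-Adj H cyc)
    where
    go : ∀ a as → (∀ {u v} → (u , v) ∈ links a as x → Adj H u v) → walkProduct a as x 1i ≡ 1i
    go a []  adj = trans (*-identityˡ (M a x)) (ones (adj (here refl)))
    go a (b ∷ bs) adj = trans (cong (walkProduct b bs x) (trans (*-identityˡ (M a b)) (ones (adj (here refl))))) (go b bs (adj ∘ there))

-- Holonomy and signature

i^ : ℕ → ℤi
i^ zero  = 1i
i^ (suc k) = gi (+ 0) (+ 1) ⊗ i^ k

ī^ : ℕ → ℤi
ī^ k = conj (i^ k)

i^-norm : ∀ k → i^ k ⊗ ī^ k ≡ 1i
i^-norm zero  = refl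
i^-norm (suc k) = trans (cong (i^ (suc k) ⊗_) (conj-⊗ (gi (+ 0) (+ 1)) (i^ k)))
  (trans (lemma (gi (+ 0) (+ 1)) (i^ k) (gi (+ 0) -[1+ 0 ]) (ī^ k)) (trans (*-identityˡ _) (i^-norm k)))
  where
  lemma : ∀ a b c d → a ⊗ b ⊗ (c ⊗ d) ≡ a ⊗ c ⊗ (b ⊗ d)
  lemma = solve-∀ ℤi-ring

i^-+ : ∀ k l → i^ (k + l) ≡ i^ k ⊗ i^ l
i^-+ zero  l = sym (*-identityˡ (i^ l))
i^-+ (suc k) l = trans (cong (gi (+ 0) (+ 1) ⊗_) (i^-+ k l)) (sym (*-assoc (gi (+ 0) (+ 1)) (i^ k) (i^ l)))

i^-≡1 : ∀ k → i^ k ≡ 1i → k % 4 ≡ 0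
i^-≡1 0 _ = refl
i^-≡1 1 ()
i^-≡1 2 ()
i^-≡1 3 ()
i^-≡1 (suc (suc (suc (suc k)))) eq = trans (trans (cong (_% 4) (ℕP.+-comm 4 k)) ([m+n]%n≡m%n k 4))
  (i^-≡1 k (trans (sym (trans (i^-+ 4 k) (*-identityˡ (i^ k)))) eq))

i^-%4 : ∀ k → k % 4 ≡ 0 → i^ k ≡ 1i
i^-%4 0 _ = refl
i^-%4 1 ()
i^-%4 2 ()
i^-%4 3 ()
i^-%4 (suc (suc (suc (suc k)))) eq = trans (trans (i^-+ 4 k) (*-identityˡ (i^ k)))
  (i^-%4 k (trans (sym (trans (cong (_% 4) (ℕP.+-comm 4 k)) ([m+n]%n≡m%n k 4))) eq))

i^-difference : ∀ f b → let η = ℤ.∣ + f ℤ.- + b ∣ in (i^ f ⊗ ī^ b ≡ i^ η) ⊎ (i^ f ⊗ ī^ b ≡ ī^ η)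
i^-difference f b with ℕP.≤-total b f
... | inj₁ b≤f = inj₁ (begin
  i^ f ⊗ ī^ b  ≡⟨ cong (λ t → i^ t ⊗ ī^ b) (sym (ℕP.m∸n+n≡m b≤f)) ⟩
  i^ (f ∸ b + b) ⊗ ī^ b  ≡⟨ cong (_⊗ ī^ b) (i^-+ (f ∸ b) b) ⟩
  i^ (f ∸ b) ⊗ i^ b ⊗ ī^ b  ≡⟨ trans (*-assoc (i^ (f ∸ b)) (i^ b) (ī^ b)) (cong (i^ (f ∸ b) ⊗_) (i^-norm b)) ⟩
  i^ (f ∸ b) ⊗ 1i  ≡⟨ *-identityʳ (i^ (f ∸ b)) ⟩
  i^ (f ∸ b)  ≡⟨ cong i^ (sym (trans (cong ℤ.∣_∣ (trans (ℤP.m-n≡m⊖n f b) (ℤP.⊖-≥ b≤f))) refl)) ⟩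
  i^ ℤ.∣ + f ℤ.- + b ∣  ∎)
  where open ≡-Reasoning
... | inj₂ f≤b = inj₂ (begin
  i^ f ⊗ ī^ b  ≡⟨ cong (λ t → i^ f ⊗ ī^ t) (sym (ℕP.m+[n∸m]≡n f≤b)) ⟩
  i^ f ⊗ ī^ (f + (b ∸ f))  ≡⟨ cong (i^ f ⊗_) (trans (cong conj (i^-+ f (b ∸ f))) (conj-⊗ (i^ f) (i^ (b ∸ f)))) ⟩
  i^ f ⊗ (ī^ f ⊗ ī^ (b ∸ f))  ≡⟨ trans (sym (*-assoc (i^ f) (ī^ f) (ī^ (b ∸ f)))) (cong (_⊗ ī^ (b ∸ f)) (i^-norm f)) ⟩
  1i ⊗ ī^ (b ∸ f)  ≡⟨ *-identityˡ (ī^ (b ∸ f)) ⟩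
  ī^ (b ∸ f)  ≡⟨ cong ī^ (sym (trans (cong ℤ.∣_∣ (trans (ℤP.m-n≡m⊖n f b) (ℤP.⊖-≤ f≤b))) (ℤP.∣-i∣≡∣i∣ (+ (b ∸ f))))) ⟩
  ī^ ℤ.∣ + f ℤ.- + b ∣  ∎)
  where open ≡-Reasoning


%4-cases : ∀ k → k % 4 ≢ 0 → (k % 2 ≡ 1) ⊎ (k % 4 ≡ 2)
%4-cases k k%4≢0 = cases (k % 4) (m%n<n k 4) k%4≢0 refl (sym (m∣n⇒o%n%m≡o%m 2 4 k (Div.divides 2 refl)))
  where
  cases : ∀ m → m < 4 → m ≢ 0 → k % 4 ≡ m → k % 2 ≡ m % 2 → (k % 2 ≡ 1) ⊎ (k % 4 ≡ 2)
  cases 0 _ m≢0 _ _ = ⊥-elim (m≢0 refl)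
  cases 1 _ _ _ p = inj₁ p
  cases 2 _ _ q _ = inj₂ q
  cases 3 _ _ _ p = inj₁ p
  cases (suc (suc (suc (suc m)))) (s≤s (s≤s (s≤s (s≤s ())))) _ _ _

%4-cases⁻¹ : ∀ k → (k % 2 ≡ 1) ⊎ (k % 4 ≡ 2) → k % 4 ≢ 0
%4-cases⁻¹ k (inj₁ k%2≡1) k%4≡0 = case (trans (sym k%2≡1) (trans (sym (m∣n⇒o%n%m≡o%m 2 4 k (Div.divides 2 refl))) (cong (_% 2) k%4≡0)))
  where
  case : 1 ≢ 0
  case ()
%4-cases⁻¹ k (inj₂ k%4≡2) k%4≡0 = case (trans (sym k%4≡2) k%4≡0)
  where
  case : 2 ≢ 0
  case ()

forward backward : Lab → ℕ → ℕ
forward ar k = suc k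
forward o  k = k
forward e  k = k
forward ra k = k
backward ra k = suc k
backward o  k = k
backward e  k = k
backward ar k = k

module _ {n} (G : MixedGraph n) where

  pairsProduct : List (Fin n × Fin n) → ℤi
  pairsProduct = foldr (λ (u , v) k → mat G u v ⊗ k) 1i

  pairsProduct-arcs : ∀ {F B : Fin n × Fin n → ℕ → ℕ} ps → (∀ {u v} → (u , v) ∈ ps → Adj G u v) →
    (∀ u v k → F (u , v) k ≡ forward (h G u v) k) → (∀ u v k → B (u , v) k ≡ backward (h G u v) k) →
    pairsProduct ps ≡ i^ (foldr F 0 ps) ⊗ ī^ (foldr B 0 ps)
  pairsProduct-arcs [] adj F≗ B≗ = refl
  pairsProduct-arcs {F} {B} ((u , v) ∷ ps) adj F≗ B≗ = trans (cong (mat G u v ⊗_) (pairsProduct-arcs ps (adj ∘ there) F≗ B≗))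
    (trans (label (h G u v) (λ p → true≢false (adj (here refl)) (cong (not ∘ isO) p)) (foldr F 0 ps) (foldr B 0 ps))
           (sym (cong₂ (λ s t → i^ s ⊗ ī^ t) (F≗ u v (foldr F 0 ps)) (B≗ u v (foldr B 0 ps)))))
    where
    lemma : ∀ t a b → t ⊗ (a ⊗ b) ≡ a ⊗ (t ⊗ b)
    lemma = solve-∀ ℤi-ring
    label : ∀ l → l ≢ o → ∀ f b → labℤi l ⊗ (i^ f ⊗ ī^ b) ≡ i^ (forward l f) ⊗ ī^ (backward l b)
    label o  l≢o f b = ⊥-elim (l≢o refl)
    label e  _   f b = *-identityˡ (i^ f ⊗ ī^ b)
    label ar _   f b = sym (*-assoc (gi (+ 0) (+ 1)) (i^ f) (ī^ b))
    label ra _   f b = trans (lemma (labℤi ra) (i^ f) (ī^ b)) (cong (i^ f ⊗_) (sym (conj-⊗ (gi (+ 0) (+ 1)) (i^ b))))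

  module _ (c : List (Fin n)) where

    private
      forward-step : ∃[ F ] forwardArcs G c ≡ foldr F 0 (cyclicPairs c)
      forward-step = _ , refl

      backward-step : ∃[ B ] backwardArcs G c ≡ foldr B 0 (cyclicPairs c)
      backward-step = _ , refl

      forward-≗ : ∀ u v k → proj₁ forward-step (u , v) k ≡ forward (h G u v) k
      forward-≗ u v k with h G u v
      ... | o  = refl
      ... | e  = refl
      ... | ar = refl
      ... | ra = refl

      backward-≗ : ∀ u v k → proj₁ backward-step (u , v) k ≡ backward (h G u v) k
      backward-≗ u v k with h G u v
      ... | o  = refl
      ... | e  = refl
      ... | ar = refl
      ... | ra = refl

    cycle-product : (∀ {u v} → (u , v) ∈ cyclicPairs c → Adj G u v) →
                    pairsProduct (cyclicPairs c) ≡ i^ (forwardArcs G c) ⊗ ī^ (backwardArcs G c)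
    cycle-product adj = pairsProduct-arcs (cyclicPairs c) adj forward-≗ backward-≗

  product-η : ∀ c → (∀ {u v} → (u , v) ∈ cyclicPairs c → Adj G u v) →
              (pairsProduct (cyclicPairs c) ≡ 1i → η G c % 4 ≡ 0) × (η G c % 4 ≡ 0 → pairsProduct (cyclicPairs c) ≡ 1i)
  product-η c adj with i^-difference (forwardArcs G c) (backwardArcs G c)
  ... | inj₁ eq = (λ p → i^-≡1 (η G c) (trans (sym (trans (cycle-product c adj) eq)) p)) ,
                  (λ q → trans (cycle-product c adj) (trans eq (i^-%4 (η G c) q)))
  ... | inj₂ eq = (λ p → i^-≡1 (η G c) (trans (sym (conj-conj (i^ (η G c)))) (cong conj (trans (sym (trans (cycle-product c adj) eq)) p)))) ,
                  (λ q → trans (cycle-product c adj) (trans eq (cong conj (i^-%4 (η G c) q))))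

sub-h : ∀ {n} (G : MixedGraph n) S {u v} → Adj (sub G S) u v → h (sub G S) u v ≡ h G u v
sub-h G S {u} {v} uv = cong₂ (λ a b → if a ∧ b then h G u v else o) (proj₁ (sub-Adj⁻ G S uv)) (proj₁ (proj₂ (sub-Adj⁻ G S uv)))

und-ones : ∀ {n} (G : MixedGraph n) S {u v} → Adj (sub (und G) S) u v → mat (sub (und G) S) u v ≡ 1i
und-ones G S {u} {v} uv = trans (cong labℤi (sub-h (und G) S uv)) (one (adjB G u v) (proj₂ (proj₂ (sub-Adj⁻ (und G) S uv))))
  where
  one : ∀ b → not (isO (if b then e else o)) ≡ true → labℤi (if b then e else o) ≡ 1i
  one true _ = refl

Closed : ∀ {n} → MixedGraph n → List (Fin n) → Set
Closed H c = ∀ {u w} → u ∈ c → Adj H u w → CycleEdge c u w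

holonomy-η : ∀ {n} (G : MixedGraph n) S {x xs} (cyc : IsCycle (sub G S) (x ∷ xs)) (closed : Closed (sub G S) (x ∷ xs)) →
  let open CycleVectors (sub G S) cyc closed in
  (holonomy ≡ 1i → η G (x ∷ xs) % 4 ≡ 0) × (η G (x ∷ xs) % 4 ≡ 0 → holonomy ≡ 1i)
holonomy-η G S {x} {xs} cyc closed = (λ p → proj₁ (product-η G (x ∷ xs) adj) (trans (sym hol≡) p)) ,
                                     (λ q → trans hol≡ (proj₂ (product-η G (x ∷ xs) adj) q))
  where
  open CycleVectors (sub G S) cyc closed
  adj : ∀ {u v} → (u , v) ∈ cyclicPairs (x ∷ xs) → Adj G u v
  adj uv = proj₂ (proj₂ (sub-Adj⁻ G S (cycle-Adj (sub G S) cyc uv)))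
  entry : ∀ {u v} → (u , v) ∈ cyclicPairs (x ∷ xs) → mat (sub G S) u v ≡ mat G u v
  entry uv = cong labℤi (sub-h G S (cycle-Adj (sub G S) cyc uv))
  lemma : ∀ p → p ⊗ 1i ≡ p
  lemma = solve-∀ ℤi-ring
  go : ∀ a as P → (∀ {s} → s ∈ links a as x → s ∈ cyclicPairs (x ∷ xs)) → walkProduct a as x P ≡ P ⊗ pairsProduct G (links a as x)
  go a []  P sub = cong (P ⊗_) (trans (entry (sub (here refl))) (sym (lemma (mat G a x))))
  go a (b ∷ bs) P sub = trans (go b bs _ (sub ∘ there)) (trans (*-assoc P _ _)
    (cong (λ t → P ⊗ (t ⊗ pairsProduct G (links b bs x))) (entry (sub (here refl)))))
  hol≡ : holonomy ≡ pairsProduct G (cyclicPairs (x ∷ xs))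
  hol≡ = trans (go x xs 1i id) (*-identityˡ _)

CycleCond : ∀ {n} → MixedGraph n → List (Fin n) → Set
CycleCond G c = (length c % 4 ≡ 0) × ((η G c % 2 ≡ 1) ⊎ (η G c % 4 ≡ 2))

module _ {n} (G : MixedGraph n) where

  private
    U = und G
    same = und-adjB G

  open Extremality G U same
  open Terminality G U same

  IsCycle-und : ∀ S {c} → IsCycle (sub G S) c → IsCycle (sub U S) c
  IsCycle-und S = IsCycle-resp (sub G S) (sub U S) (λ {u} {v} _ uv → trans (sym (sub-SameAdj G U same S u v)) uv)

  Closed-und : ∀ S {c} → Closed (sub G S) c → Closed (sub U S) c
  Closed-und S closed u∈ uw = closed u∈ (trans (sub-SameAdj G U same S _ _) uw)

  terminal-CycleCond : ∀ {S c} → Extremal S → IsCycle (sub G S) c → Closed (sub G S) c → CycleCond G c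
  terminal-CycleCond {S} {[]}  ext (() , _) closed
  terminal-CycleCond {S} {x ∷ xs} ext cyc closed = length%4 , %4-cases (η G (x ∷ xs)) η%4≢0
    where
    removal = extremal-cycle ext cyc (here refl)
    x-free : Free U S x
    x-free = extremal-cycle-free ext cyc (here refl)
    length%4 : length (x ∷ xs) % 4 ≡ 0
    length%4 = CycleVectors.kernel⇒length%4 (sub U S) (IsCycle-und S cyc) (Closed-und S closed) (und-ones G S)
                 {Free.vector x-free} (Free.kernel x-free) (Free.nonzero x-free)
    η%4≢0 : η G (x ∷ xs) % 4 ≢ 0
    η%4≢0 p = let z , ker , zx≢0 = CycleVectors.cycle-kernel (sub G S) cyc closed length%4 (proj₂ (holonomy-η G S cyc closed) p)
              in ℕP.<⇒≱ (ℕP.n<1+n (rk (sub G (S ∖ x)))) (ℕP.≤-trans (ℕP.n≤1+n _)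
                   (ℕP.≤-trans (ℕP.≤-reflexive (sym (CycleVertexRemoval.rank₁ removal))) (rank-kernel G S {x} {z} ker zx≢0)))


n≤cyclo : ∀ {n} (G : MixedGraph n) → n ≤ cyclo G
n≤cyclo {n} G = subst (_≤ cyclo G) (cyclo-edgeless (sub G ∅) (λ u v uv → empty (proj₁ (sub-Adj⁻ G ∅ {u} {v} uv))))
                  (cyclo-mono G {sub G ∅} (λ {u} {v} uv → proj₂ (proj₂ (sub-Adj⁻ G ∅ {u} {v} uv))))
  where
  ∅ : VSet n
  ∅ _ = false
  empty : ¬ false ≡ true
  empty ()

Disjoint-unique : ∀ {n} {cs : List (List (Fin n))} → AllPairs VertexDisjoint cs → ∀ {c c′ v} → c ∈ cs → c′ ∈ cs → v ∈ c → v ∈ c′ → c ≡ c′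
Disjoint-unique (_ ∷ _)  (here refl) (here refl) _  _   = refl
Disjoint-unique (dis ∷ _)   (here refl) (there c′∈) v∈ v∈′ = ⊥-elim (All.lookup dis c′∈ _ v∈ v∈′)
Disjoint-unique (dis ∷ _)   (there c∈)  (here refl) v∈ v∈′ = ⊥-elim (All.lookup dis c∈ _ v∈′ v∈)
Disjoint-unique (_ ∷ diss)  (there c∈)  (there c′∈) v∈ v∈′ = Disjoint-unique diss c∈ c′∈ v∈ v∈′

module _ {n} (G : MixedGraph n) where

  private
    U = und G
    same = und-adjB G

  open Extremality G U same
  open Terminality G U same

  IsCycle-∖ : ∀ S {x c} → x ∉ c → IsCycle (sub G S) c → IsCycle (sub G (S ∖ x)) c
  IsCycle-∖ S {x} {c} x∉ = IsCycle-resp (sub G S) (sub G (S ∖ x)) λ uv adj →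
    ∖-Adj⁺ G {S} (λ { refl → x∉ (cyclicPairs-∈ˡ {c = c} uv) }) (λ { refl → x∉ (cyclicPairs-∈ʳ {c = c} uv) }) adj

  Closed-∖ : ∀ S {x c} → Closed (sub G S) c → Closed (sub G (S ∖ x)) c
  Closed-∖ S {x} closed u∈ uw = closed u∈ (∖-⊑ G S x uw)

  record Terminal (S : VSet n) : Set where
    field
      core  : VSet n
      steps  : Star (DeltaStep G) S core
      noPendant : NoPendant G core
      extremal′ : Extremal core
      cyclo-eq  : cyclo (sub G core) ≡ cyclo (sub G S)
      cycleCond : ∀ {c} → IsCycle (sub G S) c → CycleCond G c

  reduce : ∀ S → Extremal S → Terminal S
  reduce S = go S (<-wellFounded (countFin S))
    where
    go : ∀ S → Acc _<_ (countFin S) → Extremal S → Terminal S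
    go S (acc rec) ext with FinP.any? (Pendant? G S)
    ... | no ¬pendant = record
      { core = S ; steps = ε ; noPendant = noPendant ; extremal′ = ext ; cyclo-eq = refl
      ; cycleCond = λ cyc → terminal-CycleCond G ext cyc
          (λ u∈ uw → terminal-CycleEdge (λ {u} _ → leaf-lemma (S ∖ u)) ext noPendant cyc u∈ uw) }
      where
      noPendant : NoPendant G S
      noPendant v p = ¬pendant (v , p)
    ... | yes (v , pendant) = continue (Pendant⇒Leaf G pendant)
      where
      continue : ∃[ w ] Leaf G S v w → Terminal S
      continue (w , ℓ) = record
        { core = core ; steps = δ v w pendant (proj₁ (proj₂ edge⁻)) (proj₂ (proj₂ edge⁻)) ◅ steps ; noPendant = noPendant
        ; extremal′ = extremal′ ; cyclo-eq = trans cyclo-eq (proj₂ step) ; cycleCond = λ cyc → cycleCond (survives cyc) }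
        where
        S′ = removeTwo S v w
        edge⁻ = sub-Adj⁻ G S (Leaf.edge ℓ)
        step = extremal-pendant ext ℓ
        open Terminal (go S′ (rec (countFin-removeTwo S (proj₁ pendant))) (proj₁ step))
        w∉ : ∀ {c} → IsCycle (sub G S) c → w ∉ c
        w∉ = extremal-pendant-acyclic ext ℓ
        v∉ : ∀ {c} → IsCycle (sub G S) c → v ∉ c
        v∉ {c} cyc v∈ = let y , vy = cycle-neighbour (sub G S) cyc v∈
                            y∈ = CycleEdge-∈ˡ {c = c} (CycleEdge-sym {c = c} vy)
                        in w∉ cyc (subst (_∈ c) (Leaf.only ℓ y (CycleEdge-Adj (sub G S) cyc vy)) y∈)
        survives : ∀ {c} → IsCycle (sub G S) c → IsCycle (sub G S′) c
        survives {c} cyc = IsCycle-resp (sub G S) (sub G S′) (λ uu′ adj → removeTwo-Adj⁺ G {S}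
          (λ { refl → v∉ cyc (cyclicPairs-∈ˡ {c = c} uu′) }) (λ { refl → w∉ cyc (cyclicPairs-∈ˡ {c = c} uu′) })
          (λ { refl → v∉ cyc (cyclicPairs-∈ʳ {c = c} uu′) }) (λ { refl → w∉ cyc (cyclicPairs-∈ʳ {c = c} uu′) }) adj) cyc

  record DisjointCycles (S : VSet n) : Set where
    field
      cycles   : List (List (Fin n))
      number   : cyclo (sub G S) ≡ length cycles + n
      areCycle : All (IsCycle (sub G S)) cycles
      disjoint : AllPairs VertexDisjoint cycles
      meetsAll : ∀ {c} → IsCycle (sub G S) c → Any (λ c′ → ∃[ v ] (v ∈ c × v ∈ c′)) cycles

  module AddCycle {S : VSet n} (ext : Extremal S) {x xs} (cyc : IsCycle (sub G S) (x ∷ xs)) (inner : DisjointCycles (S ∖ x)) where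

    open DisjointCycles inner

    lift : ∀ {c} → IsCycle (sub G (S ∖ x)) c → IsCycle (sub G S) c
    lift = IsCycle-resp (sub G (S ∖ x)) (sub G S) (λ _ → ∖-⊑ G S x)

    x∉ : ∀ {c} → IsCycle (sub G (S ∖ x)) c → x ∉ c
    x∉ cyc′ x∈ = true≢false (∈-cycle-sub G (S ∖ x) cyc′ x∈) (∖-self S x)

    apart : ∀ {c} → IsCycle (sub G (S ∖ x)) c → VertexDisjoint (x ∷ xs) c
    apart {c} cyc′ v v∈ v∈′ = let y , xy = cycle-neighbour (sub G S) cyc (here refl)
      in x∉ cyc′ (CycleEdge-∈ˡ {c = c} (extremal-CycleEdge ext cyc (lift cyc′) v∈ v∈′ xy))

    meets : ∀ {c} → IsCycle (sub G S) c → Any (λ c′ → ∃[ v ] (v ∈ c × v ∈ c′)) ((x ∷ xs) ∷ cycles)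
    meets {c} cyc′ with x ∈? c
    ... | yes x∈ = here (x , x∈ , here refl)
    ... | no x∉c = there (meetsAll (IsCycle-∖ S x∉c cyc′))

    added : DisjointCycles S
    added = record
      { cycles = (x ∷ xs) ∷ cycles ; number = trans (CycleVertexRemoval.cyclo≡ (extremal-cycle ext cyc (here refl))) (cong suc number)
      ; areCycle = cyc ∷ All.map (λ {c} → lift {c}) areCycle ; disjoint = All.map (λ {c} → apart {c}) areCycle ∷ disjoint ; meetsAll = meets }

  no-cycles : ∀ {S} → cyclo (sub G S) ≡ n → DisjointCycles S
  no-cycles {S} forest = record { cycles = [] ; number = forest ; areCycle = [] ; disjoint = [] ; meetsAll = λ cyc → ⊥-elim (none cyc) }
    where
    none : ∀ {c} → ¬ IsCycle (sub G S) c
    none {[]}  (() , _)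
    none {x ∷ c} cyc = ℕP.<⇒≱ (ℕP.≤-trans
      (cyclo-drop-cycle (sub G S) (∖-⊑ G S x) cyc (here refl) (∖-isolated G S x)) (ℕP.≤-reflexive forest)) (n≤cyclo (sub G (S ∖ x)))

  disjoint-cycles : ∀ S → Extremal S → DisjointCycles S
  disjoint-cycles S = go S (<-wellFounded (countFin S))
    where
    go : ∀ S → Acc _<_ (countFin S) → Extremal S → DisjointCycles S
    go S (acc rec) ext = split (cycle-or-forest (sub G S))
      where
      split : (∃[ c ] IsCycle (sub G S) c) ⊎ cyclo (sub G S) ≡ n → DisjointCycles S
      split (inj₂ forest)  = no-cycles forest
      split (inj₁ ([] , () , _))
      split (inj₁ (x ∷ xs , cyc)) = AddCycle.added ext cyc (go (S ∖ x) (rec (countFin-∖-< S (∈-cycle-sub G S cyc (here refl))))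
        (CycleVertexRemoval.residual (extremal-cycle ext cyc (here refl))))

  terminal-union : ∀ {S} → Extremal S → NoPendant G S → ∃[ k ] (cyclo (sub G S) ≡ k + n × UnionOfCyclesAndIsolated G S k)
  terminal-union {S} ext noPendant = length cycles , number , cycles , refl ,
    All.map (λ {c} cyc → IsCycle-resp (sub G S) G (λ _ uv → proj₂ (proj₂ (sub-Adj⁻ G S uv))) cyc ,
                         All.tabulate (∈-cycle-sub G S {c} cyc)) areCycle , disjoint , covered
    where
    open DisjointCycles (disjoint-cycles S ext)
    IH : ∀ {u} → S u ≡ true → LeafLemma (S ∖ u)
    IH {u} _ = leaf-lemma (S ∖ u)
    covered : ∀ u v → S u ≡ true → S v ≡ true → Adj G u v → Any (λ c → CycleEdge c u v) cycles
    covered u v su sv uv = cover (terminal-on-cycle IH ext noPendant uv′)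
      where
      uv′ : Adj (sub G S) u v
      uv′ = sub-Adj⁺ G S su sv uv
      cover : ∃[ c ] (IsCycle (sub G S) c × u ∈ c) → Any (λ c → CycleEdge c u v) cycles
      cover (c , cyc , u∈) = find-cover areCycle (meetsAll cyc)
        where
        find-cover : ∀ {cs} → All (IsCycle (sub G S)) cs → Any (λ c′ → ∃[ v ] (v ∈ c × v ∈ c′)) cs → Any (λ c → CycleEdge c u v) cs
        find-cover (cyc′ ∷ _) (here (t , t∈ , t∈′)) =
          here (extremal-CycleEdge ext cyc cyc′ t∈ t∈′ (terminal-CycleEdge IH ext noPendant cyc u∈ uv′))
        find-cover (_ ∷ cycs) (there p) = there (find-cover cycs p)

  closed-cycles-bound : ∀ S cs → All (λ c → IsCycle (sub G S) c × Closed (sub G S) c × CycleCond G c) cs → AllPairs VertexDisjoint cs →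
    rk (sub U S) + (n + n) + (length cs + length cs + (length cs + length cs)) ≤ rk (sub G S) + (cyclo (sub G S) + cyclo (sub G S))
  closed-cycles-bound S [] _ _ = subst₂ _≤_ (sym (ℕP.+-identityʳ _))
    (cong (λ k → rk (sub G S) + (k + k)) (cyclo-cong (sub U S) (sub G S) (λ u v → sym (sub-SameAdj G U same S u v))))
    (Extremality.rank-bound U G (λ u v → sym (same u v)) S)
  closed-cycles-bound S ([] ∷ cs) (((() , _) , _) ∷ _) _
  closed-cycles-bound S ((x ∷ xs) ∷ cs) ((cyc , closed , length%4 , η-cond) ∷ rest) (apart ∷ disjoint) = begin
    rk (sub U S) + (n + n) + (suc k + suc k + (suc k + suc k))  ≤⟨ ℕP.+-monoˡ-≤ _ (ℕP.+-monoˡ-≤ (n + n) r₂≤) ⟩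
    rk (sub U S′) + (n + n) + (suc k + suc k + (suc k + suc k))  ≡⟨ lemma₁ (rk (sub U S′) + (n + n)) k ⟩
    4 + (rk (sub U S′) + (n + n) + (k + k + (k + k)))  ≤⟨ ℕP.+-monoʳ-≤ 4 (closed-cycles-bound S′ cs rest′ disjoint) ⟩
    4 + (rk (sub G S′) + (cyclo (sub G S′) + cyclo (sub G S′)))  ≡⟨ lemma₂ (rk (sub G S′)) (cyclo (sub G S′)) ⟩
    2 + rk (sub G S′) + (suc (cyclo (sub G S′)) + suc (cyclo (sub G S′)))  ≤⟨ ℕP.+-mono-≤ r₁≥ (ℕP.+-mono-≤ drop drop) ⟩
    rk (sub G S) + (cyclo (sub G S) + cyclo (sub G S))  ∎
    where
    open ℕP.≤-Reasoning
    k = length cs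
    S′ = S ∖ x
    lemma₁ : ∀ a k → a + (suc k + suc k + (suc k + suc k)) ≡ 4 + (a + (k + k + (k + k)))
    lemma₁ = ℕ-solve-∀
    lemma₂ : ∀ a c → 4 + (a + (c + c)) ≡ 2 + a + (suc c + suc c)
    lemma₂ = ℕ-solve-∀
    drop : suc (cyclo (sub G S′)) ≤ cyclo (sub G S)
    drop = cyclo-drop-cycle (sub G S) (∖-⊑ G S x) cyc (here refl) (∖-isolated G S x)
    r₂≤ : rk (sub U S) ≤ rk (sub U S′)
    r₂≤ = let z , ker , zx≢0 = CycleVectors.cycle-kernel (sub U S) (IsCycle-und G S cyc) (Closed-und G S closed) length%4
                                 (CycleVectors.holonomy-ones (sub U S) (IsCycle-und G S cyc) (Closed-und G S closed) (und-ones G S))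
          in rank-kernel U S {x} {z} ker zx≢0
    r₁≥ : 2 + rk (sub G S′) ≤ rk (sub G S)
    r₁≥ = let y , off , at , yx≡0 = CycleVectors.cycle-pole (sub G S) cyc closed length%4
                                      (λ hol≡1 → %4-cases⁻¹ (η G (x ∷ xs)) η-cond (proj₁ (holonomy-η G S cyc closed) hol≡1))
          in rank-∖+2 G S {x} {y} off at yx≡0
    rest′ : All (λ c → IsCycle (sub G S′) c × Closed (sub G S′) c × CycleCond G c) cs
    rest′ = All.zipWith (λ { {c} ((cyc′ , closed′ , cond) , dis) → IsCycle-∖ S (dis x (here refl)) cyc′ , Closed-∖ S {x} {c} closed′ , cond }) (rest , apart)

  private
    shift-two : ∀ {a a′ b b′ t u} → a ≡ suc (suc a′) → b ≡ suc (suc b′) → a′ + u ≡ t + b′ → a + u ≡ t + b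
    shift-two {b′ = b′} {t} refl refl eq = trans (cong (λ m → suc (suc m)) eq)
      (sym (trans (ℕP.+-suc t (suc b′)) (cong suc (ℕP.+-suc t b′))))

  steps-preserve : ∀ {S T} → Star (DeltaStep G) S T →
    rk (sub G S) + rk (sub U T) ≡ rk (sub G T) + rk (sub U S) × cyclo (sub G T) ≤ cyclo (sub G S)
  steps-preserve ε = refl , ℕP.≤-refl
  steps-preserve {S} {T} (_◅_ {j = S′} (δ v w pendant sw vw) steps) = combine (steps-preserve steps)
    where
    ℓ : Leaf G S v w
    ℓ = let w′ , leaf vw′ only = Pendant⇒Leaf G pendant
            w≡w′ = only w (sub-Adj⁺ G S (proj₁ pendant) sw vw)
        in subst (Leaf G S v) (sym w≡w′) (leaf vw′ only)
    combine : rk (sub G S′) + rk (sub U T) ≡ rk (sub G T) + rk (sub U S′) × cyclo (sub G T) ≤ cyclo (sub G S′) →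
              rk (sub G S) + rk (sub U T) ≡ rk (sub G T) + rk (sub U S) × cyclo (sub G T) ≤ cyclo (sub G S)
    combine (ranks , cyc) = shift-two (rank-pendant G ℓ) (rank-pendant U (Leaf-SameAdj G U same ℓ)) ranks ,
      ℕP.≤-trans cyc (cyclo-mono (sub G S) (removeTwo-⊑ G S v w))

module _ (a b n′ E w : ℤ) where

  difference⇒balance : a - b ≡ + 2 * ((E - n′) ℤ.+ w) → a ℤ.+ (n′ ℤ.+ n′) ≡ b ℤ.+ ((E ℤ.+ w) ℤ.+ (E ℤ.+ w))
  difference⇒balance eq = trans (lemma₁ a b n′) (trans (cong (ℤ._+ (b ℤ.+ (n′ ℤ.+ n′))) eq) (lemma₂ b n′ E w))
    where
    lemma₁ : ∀ a b n → a ℤ.+ (n ℤ.+ n) ≡ (a - b) ℤ.+ (b ℤ.+ (n ℤ.+ n))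
    lemma₁ = ℤ-solve-∀
    lemma₂ : ∀ b n E w → + 2 * ((E - n) ℤ.+ w) ℤ.+ (b ℤ.+ (n ℤ.+ n)) ≡ b ℤ.+ ((E ℤ.+ w) ℤ.+ (E ℤ.+ w))
    lemma₂ = ℤ-solve-∀

  balance⇒difference : a ℤ.+ (n′ ℤ.+ n′) ≡ b ℤ.+ ((E ℤ.+ w) ℤ.+ (E ℤ.+ w)) → a - b ≡ + 2 * ((E - n′) ℤ.+ w)
  balance⇒difference eq = trans (lemma₁ a b n′) (trans (cong (λ t → t - (b ℤ.+ (n′ ℤ.+ n′))) eq) (lemma₂ b n′ E w))
    where
    lemma₁ : ∀ a b n → a - b ≡ (a ℤ.+ (n ℤ.+ n)) - (b ℤ.+ (n ℤ.+ n))
    lemma₁ = ℤ-solve-∀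
    lemma₂ : ∀ b n E w → (b ℤ.+ ((E ℤ.+ w) ℤ.+ (E ℤ.+ w))) - (b ℤ.+ (n ℤ.+ n)) ≡ + 2 * ((E - n) ℤ.+ w)
    lemma₂ = ℤ-solve-∀

cyclo⇒d : ∀ {n} (G : MixedGraph n) {k} → cyclo G ≡ k + n → + k ≡ d G
cyclo⇒d {n} G {k} eq = trans (lemma₁ (+ k) (+ n)) (trans (cong (_- + n) (cong +_ (sym eq))) (lemma₂ (+ numEdges G) (+ n) (+ ω G)))
  where
  lemma₁ : ∀ k n → k ≡ (k ℤ.+ n) - n
  lemma₁ = ℤ-solve-∀
  lemma₂ : ∀ E n w → (E ℤ.+ w) - n ≡ (E - n) ℤ.+ w
  lemma₂ = ℤ-solve-∀

d⇒cyclo : ∀ {n} (G : MixedGraph n) {k} → + k ≡ d G → cyclo G ≡ k + n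
d⇒cyclo {n} G {k} eq = ℤP.+-injective (trans (lemma (+ numEdges G) (+ n) (+ ω G)) (cong (ℤ._+ + n) (sym eq)))
  where
  lemma : ∀ E n w → E ℤ.+ w ≡ ((E - n) ℤ.+ w) ℤ.+ n
  lemma = ℤ-solve-∀

module _ {n} (G : MixedGraph n) where

  private
    U = und G
    same = und-adjB G

  open Extremality G U same
  open Terminality G U same

  cyclo-full : cyclo (sub G fullSet) ≡ cyclo G
  cyclo-full = cyclo-cong (sub G fullSet) G (λ _ _ → refl)

  IsCycle-full : ∀ {c} → IsCycle G c → IsCycle (sub G fullSet) c
  IsCycle-full = IsCycle-resp G (sub G fullSet) (λ _ uv → uv)

  necessity : (+ rk G - + r G) ≡ + 2 * d G → CondI G × CondII G × CondIII G
  necessity eq = condI , (λ c cyc → cycleCond (IsCycle-full cyc)) , condIII (terminal-union G extremal′ noPendant)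
    where
    bal : rk G + (n + n) ≡ r G + (cyclo G + cyclo G)
    bal = ℤP.+-injective (difference⇒balance (+ rk G) (+ r G) (+ n) (+ numEdges G) (+ ω G) eq)
    ext : Extremal fullSet
    ext = extremal (trans bal (cong₂ (λ s c → s + (c + c)) (r-und G) (sym cyclo-full)))
    open Terminal (reduce G fullSet ext)
    condI : CondI G
    condI c₁ c₂ cyc₁ cyc₂ (v , v∈₁ , v∈₂) s t = mk⇔
      (extremal-CycleEdge ext (IsCycle-full cyc₁) (IsCycle-full cyc₂) v∈₁ v∈₂)
      (extremal-CycleEdge ext (IsCycle-full cyc₂) (IsCycle-full cyc₁) v∈₂ v∈₁)
    condIII : ∃[ k ] (cyclo (sub G core) ≡ k + n × UnionOfCyclesAndIsolated G core k) → CondIII G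
    condIII (k , number , union) = core , steps , noPendant , k ,
      cyclo⇒d G (trans (sym (trans cyclo-eq cyclo-full)) number) , union

  private
    core-arithmetic : ∀ {a b c k} → b + (n + n) + (k + k + (k + k)) ≤ a + (c + c) → c ≤ k + n → b + (k + k) ≤ a
    core-arithmetic {a} {b} {c} {k} le c≤ = ℕP.+-cancelʳ-≤ (k + n + (k + n)) _ a
      (ℕP.≤-trans (ℕP.≤-reflexive (lemma b k n)) (ℕP.≤-trans le (ℕP.+-monoʳ-≤ a (ℕP.+-mono-≤ c≤ c≤))))
      where
      lemma : ∀ b k n → b + (k + k) + (k + n + (k + n)) ≡ b + (n + n) + (k + k + (k + k))
      lemma = ℕ-solve-∀

    transfer : ∀ {A a B b K} → A + b ≡ a + B → b + K ≤ a → B + K ≤ A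
    transfer {A} {a} {B} {b} {K} eq le = ℕP.+-cancelʳ-≤ b _ A
      (ℕP.≤-trans (ℕP.≤-reflexive (lemma B K b)) (ℕP.≤-trans (ℕP.+-monoˡ-≤ B le) (ℕP.≤-reflexive (sym eq))))
      where
      lemma : ∀ B K b → B + K + b ≡ b + K + B
      lemma = ℕ-solve-∀

  sufficiency : CondII G → CondIII G → (+ rk G - + r G) ≡ + 2 * d G
  sufficiency condII (S , steps , _ , k , k≡d , cs , refl , areCycles , disjoint , covered) =
    balance⇒difference (+ rk G) (+ r G) (+ n) (+ numEdges G) (+ ω G) (cong +_ bal)
    where
    cyclo-G : cyclo G ≡ k + n
    cyclo-G = d⇒cyclo G k≡d
    closed : ∀ {c} → c ∈ cs → Closed (sub G S) c
    closed {c} c∈ {u} {w} u∈ uw = pick (find (covered u w (proj₁ uw⁻) (proj₁ (proj₂ uw⁻)) (proj₂ (proj₂ uw⁻))))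
      where
      uw⁻ = sub-Adj⁻ G S {u} {w} uw
      pick : ∃[ c′ ] (c′ ∈ cs × CycleEdge c′ u w) → CycleEdge c u w
      pick (c′ , c′∈ , uw∈) = subst (λ c → CycleEdge c u w) (Disjoint-unique disjoint c′∈ c∈ (CycleEdge-∈ˡ {c = c′} uw∈) u∈) uw∈
    conditions : All (λ c → IsCycle (sub G S) c × Closed (sub G S) c × CycleCond G c) cs
    conditions = All.tabulate λ {c} c∈ → let cyc , in-S = All.lookup areCycles c∈ in
      IsCycle-resp G (sub G S) (λ uv adj → sub-Adj⁺ G S (All.lookup in-S (cyclicPairs-∈ˡ {c = c} uv)) (All.lookup in-S (cyclicPairs-∈ʳ {c = c} uv)) adj) cyc ,
      closed c∈ , condII c cyc
    preserved = steps-preserve G steps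
    lower : r G + (k + k) ≤ rk G
    lower = subst (λ s → s + (k + k) ≤ rk G) (sym (r-und G)) (transfer {rk G} {rk (sub G S)} {rk U} {rk (sub U S)} (proj₁ preserved)
      (core-arithmetic {rk (sub G S)} {rk (sub U S)} (closed-cycles-bound G S cs conditions disjoint)
        (ℕP.≤-trans (proj₂ preserved) (ℕP.≤-reflexive (trans cyclo-full cyclo-G)))))
    upper : rk G + (n + n) ≤ r G + (cyclo G + cyclo G)
    upper = subst₂ (λ s c → rk G + (n + n) ≤ s + (c + c)) (sym (r-und G)) cyclo-full (rank-bound fullSet)
    lemma : ∀ s k n → s + (k + n + (k + n)) ≡ s + (k + k) + (n + n)
    lemma = ℕ-solve-∀
    bal : rk G + (n + n) ≡ r G + (cyclo G + cyclo G)
    bal = ℕP.≤-antisym upper (ℕP.≤-trans (ℕP.≤-reflexive (trans (cong (λ c → r G + (c + c)) cyclo-G) (lemma (r G) k n)))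
                                         (ℕP.+-monoˡ-≤ (n + n) lower))

theorem1p2 : ∀ {n : ℕ} (G : MixedGraph n) →
    ((+ rk G - + r G) ≡ + 2 * d G) ⇔ (CondI G × CondII G × CondIII G)
theorem1p2 G = mk⇔ (necessity G) (λ (_ , condII , condIII) → sufficiency G condII condIII)
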